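{- For every integer $r\geq 2$ there exists $\epsilon_0>0$ such that for every $0<\epsilon\le\epsilon_0$ there exists $C$ such that if $p=p(n)\in[0,1]$ satisfies $p\geq \frac{C}{n}$, then asymptotically almost surely every $r$-coloring of the edges of $G(n,p)$ contains either a monochromatic tree of order at least $(1-\epsilon)n$ or a monochromatic tree with at least $(1-\epsilon)\frac{n}{r-1}$ leaves; in particular, asymptotically almost surely $\mathrm{tm}_r(G(n,p))\geq (1-\epsilon)\frac{n}{r-1}$.
   Context: $G(n,p)$ is the binomial random graph on $n$ vertices in which each pair is an edge independently with probability $p$. A sequence of events $A_n$ holds asymptotically almost surely if $\Pr[A_n]\to 1$ as $n\to\infty$. An $r$-coloring is an arbitrary assignment of one of $r$ colors to each edge. The order of a tree is its number of vertices; trees are subgraphs (not necessarily induced). For a graph $G$, $\mathrm{tm}_r(G)$ is the maximum integer $s$ such that in every $r$-coloring of the edges of $G$ there exists a monochromatic component (connected monochromatic subgraph) with at least $s$ vertices. -}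

module Defs where

open import Data.Bool.Base using (Bool; if_then_else_; _∨_; T)
open import Data.Fin.Base using (Fin)
import Data.Fin.Properties as Fin
open import Data.Fin.Subset using (Subset; inside; outside; _∈_; _⊆_; _∩_; ∣_∣; Nonempty)
open import Data.Integer.Base using (+_)
open import Data.List.Base as List
  using (List; _∷_; _++_; [_]; map; filter; foldr; length; allFin; cartesianProduct)
open import Data.List.Relation.Unary.Linked using (Linked)
open import Data.List.Relation.Unary.Unique.Propositional using (Unique)
open import Data.Nat.Base as ℕ using (ℕ; zero; suc; NonZero; NonTrivial; 2+)
import Data.Nat.Properties as ℕ
open import Data.Product.Base using (Σ; ∃; _×_; _,_; proj₁; proj₂; uncurry)
open import Data.Rational.Base as ℚ using (ℚ; 0ℚ; 1ℚ; ½)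
import Data.Rational.Properties as ℚ
open import Data.Rational.Solver using (module +-*-Solver)
open import Data.Sum.Base using (_⊎_)
open import Data.Vec.Base as Vec using (tabulate)
open import Relation.Binary.Construct.Closure.ReflexiveTransitive using (Star)
open import Relation.Binary.PropositionalEquality using (_≡_; refl; sym; trans; cong; subst)
open import Relation.Nullary using (¬_; does)

-- Real numbers: Cauchy sequences of rationals.  The setoid equality is
-- x ≤ℝ y × y ≤ℝ x; everything below respects it.

IsCauchy : (ℕ → ℚ) → Set
IsCauchy s = ∀ δ → 0ℚ ℚ.< δ →
  ∃ λ N → ∀ m n → N ℕ.≤ m → N ℕ.≤ n → ℚ.∣ s m ℚ.- s n ∣ ℚ.≤ δ

record ℝ : Set where
  constructor mkℝ
  field
    seq    : ℕ → ℚ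
    cauchy : IsCauchy seq
open ℝ

infix 4 _≤ℝ_ _<ℝ_

_≤ℝ_ : ℝ → ℝ → Set
x ≤ℝ y = ∀ δ → 0ℚ ℚ.< δ → ∃ λ N → ∀ n → N ℕ.≤ n → seq x n ℚ.≤ seq y n ℚ.+ δ

_<ℝ_ : ℝ → ℝ → Set
x <ℝ y = ∃ λ δ → 0ℚ ℚ.< δ × ∃ λ N → ∀ n → N ℕ.≤ n → seq x n ℚ.+ δ ℚ.≤ seq y n

private
  half-pos : ∀ {δ} → 0ℚ ℚ.< δ → 0ℚ ℚ.< ½ ℚ.* δ
  half-pos {δ} δ>0 = ℚ.positive⁻¹ (½ ℚ.* δ)
    {{ℚ.pos*pos⇒pos ½ δ {{ℚ.positive δ>0}}}}

  half+half : ∀ δ → ½ ℚ.* δ ℚ.+ ½ ℚ.* δ ≡ δ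
  half+half δ = trans (sym (ℚ.*-distribʳ-+ δ ½ ½)) (ℚ.*-identityˡ δ)

  +-cauchy : ∀ {s t} → IsCauchy s → IsCauchy t → IsCauchy (λ n → s n ℚ.+ t n)
  +-cauchy {s} {t} cs ct δ δ>0
    with cs (½ ℚ.* δ) (half-pos δ>0) | ct (½ ℚ.* δ) (half-pos δ>0)
  ... | M , hM | N , hN = M ℕ.⊔ N , λ m n hm hn → begin
      ℚ.∣ (s m ℚ.+ t m) ℚ.- (s n ℚ.+ t n) ∣
        ≡⟨ cong ℚ.∣_∣ (regroup (s m) (t m) (s n) (t n)) ⟩
      ℚ.∣ (s m ℚ.- s n) ℚ.+ (t m ℚ.- t n) ∣
        ≤⟨ ℚ.∣p+q∣≤∣p∣+∣q∣ (s m ℚ.- s n) (t m ℚ.- t n) ⟩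
      ℚ.∣ s m ℚ.- s n ∣ ℚ.+ ℚ.∣ t m ℚ.- t n ∣
        ≤⟨ ℚ.+-mono-≤ (hM m n (ℕ.m⊔n≤o⇒m≤o M N hm) (ℕ.m⊔n≤o⇒m≤o M N hn))
                      (hN m n (ℕ.m⊔n≤o⇒n≤o M N hm) (ℕ.m⊔n≤o⇒n≤o M N hn)) ⟩
      ½ ℚ.* δ ℚ.+ ½ ℚ.* δ
        ≡⟨ half+half δ ⟩
      δ ∎
    where
    open ℚ.≤-Reasoning
    open +-*-Solver
    regroup : ∀ a b c d → (a ℚ.+ b) ℚ.- (c ℚ.+ d) ≡ (a ℚ.- c) ℚ.+ (b ℚ.- d)
    regroup = solve 4 (λ a b c d → (a :+ b) :- (c :+ d) := (a :- c) :+ (b :- d)) refl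

  neg-cauchy : ∀ {s} → IsCauchy s → IsCauchy (λ n → ℚ.- s n)
  neg-cauchy {s} cs δ δ>0 with cs δ δ>0
  ... | N , h = N , λ m n hm hn →
      subst (ℚ._≤ δ) (trans (sym (ℚ.∣-p∣≡∣p∣ (s m ℚ.- s n)))
                            (cong ℚ.∣_∣ (negate (s m) (s n))))
            (h m n hm hn)
    where
    open +-*-Solver
    negate : ∀ a b → ℚ.- (a ℚ.- b) ≡ (ℚ.- a) ℚ.- (ℚ.- b)
    negate = solve 2 (λ a b → :- (a :- b) := (:- a) :- (:- b)) refl

  EventuallyBounded : (ℕ → ℚ) → Set
  EventuallyBounded s =
    ∃ λ K → ℚ.Positive K × ∃ λ N → ∀ n → N ℕ.≤ n → ℚ.∣ s n ∣ ℚ.≤ K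

  cauchy⇒bounded : ∀ {s} → IsCauchy s → EventuallyBounded s
  cauchy⇒bounded {s} cs with cs 1ℚ (ℚ.positive⁻¹ 1ℚ)
  ... | N , h = 1ℚ ℚ.+ ℚ.∣ s N ∣ ,
                ℚ.pos+nonNeg⇒pos 1ℚ ℚ.∣ s N ∣ {{ℚ.∣-∣-nonNeg (s N)}} ,
                N , λ n hn → begin
      ℚ.∣ s n ∣
        ≡⟨ cong ℚ.∣_∣ (split (s n) (s N)) ⟩
      ℚ.∣ (s n ℚ.- s N) ℚ.+ s N ∣
        ≤⟨ ℚ.∣p+q∣≤∣p∣+∣q∣ (s n ℚ.- s N) (s N) ⟩
      ℚ.∣ s n ℚ.- s N ∣ ℚ.+ ℚ.∣ s N ∣
        ≤⟨ ℚ.+-monoˡ-≤ ℚ.∣ s N ∣ (h n N hn ℕ.≤-refl) ⟩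
      1ℚ ℚ.+ ℚ.∣ s N ∣ ∎
    where
    open ℚ.≤-Reasoning
    open +-*-Solver
    split : ∀ a b → a ≡ (a ℚ.- b) ℚ.+ b
    split = solve 2 (λ a b → a := (a :- b) :+ b) refl

  scaled-bound : ∀ {s} → IsCauchy s → ∀ K → ℚ.Positive K → ∀ δ → 0ℚ ℚ.< δ →
    ∃ λ N → ∀ m n → N ℕ.≤ m → N ℕ.≤ n → K ℚ.* ℚ.∣ s m ℚ.- s n ∣ ℚ.≤ δ
  scaled-bound {s} cs K K>0 δ δ>0 with cs (K⁻¹ ℚ.* δ) (ℚ.positive⁻¹ (K⁻¹ ℚ.* δ) {{posK⁻¹δ}})
    where
    K⁻¹ : ℚ
    K⁻¹ = (ℚ.1/ K) {{ℚ.pos⇒nonZero K {{K>0}}}}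
    posK⁻¹δ : ℚ.Positive (K⁻¹ ℚ.* δ)
    posK⁻¹δ = ℚ.pos*pos⇒pos K⁻¹ {{ℚ.1/pos⇒pos K {{K>0}}}} δ {{ℚ.positive δ>0}}
  ... | N , h = N , λ m n hm hn → begin
      K ℚ.* ℚ.∣ s m ℚ.- s n ∣
        ≤⟨ ℚ.*-monoˡ-≤-nonNeg K {{ℚ.pos⇒nonNeg K {{K>0}}}} (h m n hm hn) ⟩
      K ℚ.* (K⁻¹ ℚ.* δ)
        ≡⟨ sym (ℚ.*-assoc K K⁻¹ δ) ⟩
      (K ℚ.* K⁻¹) ℚ.* δ
        ≡⟨ cong (ℚ._* δ) (ℚ.*-inverseʳ K {{ℚ.pos⇒nonZero K {{K>0}}}}) ⟩
      1ℚ ℚ.* δ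
        ≡⟨ ℚ.*-identityˡ δ ⟩
      δ ∎
    where
    open ℚ.≤-Reasoning
    K⁻¹ : ℚ
    K⁻¹ = (ℚ.1/ K) {{ℚ.pos⇒nonZero K {{K>0}}}}

  product-bound : ∀ {K} x y {η} → ℚ.∣ x ∣ ℚ.≤ K → K ℚ.* ℚ.∣ y ∣ ℚ.≤ η →
                  ℚ.∣ x ℚ.* y ∣ ℚ.≤ η
  product-bound {K} x y {η} hx h = begin
      ℚ.∣ x ℚ.* y ∣          ≡⟨ ℚ.∣p*q∣≡∣p∣*∣q∣ x y ⟩
      ℚ.∣ x ∣ ℚ.* ℚ.∣ y ∣    ≤⟨ ℚ.*-monoʳ-≤-nonNeg ℚ.∣ y ∣ {{ℚ.∣-∣-nonNeg y}} hx ⟩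
      K ℚ.* ℚ.∣ y ∣          ≤⟨ h ⟩
      η                      ∎
    where open ℚ.≤-Reasoning

  product-difference : ∀ {K L} a b c d δ →
    ℚ.∣ a ∣ ℚ.≤ K → ℚ.∣ d ∣ ℚ.≤ L →
    K ℚ.* ℚ.∣ b ℚ.- d ∣ ℚ.≤ ½ ℚ.* δ → L ℚ.* ℚ.∣ a ℚ.- c ∣ ℚ.≤ ½ ℚ.* δ →
    ℚ.∣ a ℚ.* b ℚ.- c ℚ.* d ∣ ℚ.≤ δ
  product-difference {K} {L} a b c d δ ha hd hbd hac = begin
      ℚ.∣ a ℚ.* b ℚ.- c ℚ.* d ∣
        ≡⟨ cong ℚ.∣_∣ (regroup a b c d) ⟩
      ℚ.∣ a ℚ.* (b ℚ.- d) ℚ.+ d ℚ.* (a ℚ.- c) ∣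
        ≤⟨ ℚ.∣p+q∣≤∣p∣+∣q∣ (a ℚ.* (b ℚ.- d)) (d ℚ.* (a ℚ.- c)) ⟩
      ℚ.∣ a ℚ.* (b ℚ.- d) ∣ ℚ.+ ℚ.∣ d ℚ.* (a ℚ.- c) ∣
        ≤⟨ ℚ.+-mono-≤ (product-bound {K} a (b ℚ.- d) {½ ℚ.* δ} ha hbd)
                      (product-bound {L} d (a ℚ.- c) {½ ℚ.* δ} hd hac) ⟩
      ½ ℚ.* δ ℚ.+ ½ ℚ.* δ
        ≡⟨ half+half δ ⟩
      δ ∎
    where
    open ℚ.≤-Reasoning
    open +-*-Solver
    regroup : ∀ a b c d →
      a ℚ.* b ℚ.- c ℚ.* d ≡ a ℚ.* (b ℚ.- d) ℚ.+ d ℚ.* (a ℚ.- c)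
    regroup = solve 4 (λ a b c d →
      a :* b :- c :* d := a :* (b :- d) :+ d :* (a :- c)) refl

  *-cauchy : ∀ {s t} → IsCauchy s → IsCauchy t → IsCauchy (λ n → s n ℚ.* t n)
  *-cauchy {s} {t} cs ct δ δ>0 =
    let K , K>0 , A , hA = cauchy⇒bounded {s} cs
        L , L>0 , B , hB = cauchy⇒bounded {t} ct
        M , hM = scaled-bound {t} ct K K>0 (½ ℚ.* δ) (half-pos {δ} δ>0)
        N , hN = scaled-bound {s} cs L L>0 (½ ℚ.* δ) (half-pos {δ} δ>0)
        P = A ℕ.⊔ B
        Q = M ℕ.⊔ N
    in P ℕ.⊔ Q , λ m n hm hn →
      product-difference {K} {L} (s m) (t m) (s n) (t n) δ
        (hA m (ℕ.m⊔n≤o⇒m≤o A B (ℕ.m⊔n≤o⇒m≤o P Q hm)))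
        (hB n (ℕ.m⊔n≤o⇒n≤o A B (ℕ.m⊔n≤o⇒m≤o P Q hn)))
        (hM m n (ℕ.m⊔n≤o⇒m≤o M N (ℕ.m⊔n≤o⇒n≤o P Q hm))
                (ℕ.m⊔n≤o⇒m≤o M N (ℕ.m⊔n≤o⇒n≤o P Q hn)))
        (hN m n (ℕ.m⊔n≤o⇒n≤o M N (ℕ.m⊔n≤o⇒n≤o P Q hm))
                (ℕ.m⊔n≤o⇒n≤o M N (ℕ.m⊔n≤o⇒n≤o P Q hn)))

infixl 7 _*ℝ_ _/ℝ_
infixl 6 _+ℝ_ _-ℝ_

fromℚ : ℚ → ℝ
fromℚ q = mkℝ (λ _ → q) λ δ δ>0 → 0 , λ _ _ _ _ →
  subst (λ z → ℚ.∣ z ∣ ℚ.≤ δ) (sym (ℚ.+-inverseʳ q)) (ℚ.<⇒≤ δ>0)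

fromℕ : ℕ → ℝ
fromℕ n = fromℚ (+ n ℚ./ 1)

0ℝ 1ℝ : ℝ
0ℝ = fromℚ 0ℚ
1ℝ = fromℚ 1ℚ

_+ℝ_ _*ℝ_ _-ℝ_ : ℝ → ℝ → ℝ
x +ℝ y = mkℝ (λ n → seq x n ℚ.+ seq y n)
              (+-cauchy {seq x} {seq y} (cauchy x) (cauchy y))
x *ℝ y = mkℝ (λ n → seq x n ℚ.* seq y n)
              (*-cauchy {seq x} {seq y} (cauchy x) (cauchy y))
x -ℝ y = mkℝ (λ n → seq x n ℚ.- seq y n)
              (+-cauchy {seq x} {λ n → ℚ.- seq y n} (cauchy x) (neg-cauchy {seq y} (cauchy y)))

_/ℝ_ : ℝ → (n : ℕ) → .{{NonZero n}} → ℝ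
x /ℝ n = x *ℝ fromℚ (+ 1 ℚ./ n)

_⟶_ : (ℕ → ℝ) → ℝ → Set
a ⟶ L = ∀ δ → 0ℝ <ℝ δ →
  ∃ λ N → ∀ n → N ℕ.≤ n → (L -ℝ δ <ℝ a n) × (a n <ℝ L +ℝ δ)

instance
  nonTrivial⇒pred-nonZero : ∀ {r} → .{{NonTrivial r}} → NonZero (r ℕ.∸ 1)
  nonTrivial⇒pred-nonZero {2+ _} = _

-- Each unordered pair {i , j} with i ≢ j is listed once, as (i , j) with i < j.
pairs : (n : ℕ) → List (Fin n × Fin n)
pairs n = filter (uncurry Fin._<?_) (cartesianProduct (allFin n) (allFin n))

#pairs : ℕ → ℕ
#pairs n = length (pairs n)

Edge : ℕ → Set
Edge n = Fin (#pairs n)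

ends : ∀ n → Edge n → Fin n × Fin n
ends n = List.lookup (pairs n)

record Graph (n : ℕ) : Set where
  constructor mkGraph
  field
    edges : Subset (#pairs n)
open Graph

record Subgraph {n : ℕ} (G : Graph n) : Set where
  field
    V      : Subset n
    E      : Subset (#pairs n)
    E⊆G    : E ⊆ edges G
    closed : ∀ {e} → e ∈ E → proj₁ (ends n e) ∈ V × proj₂ (ends n e) ∈ V

module _ {n : ℕ} {G : Graph n} (H : Subgraph G) where
  open Subgraph H

  Adj : Fin n → Fin n → Set
  Adj u v = ∃ λ e → e ∈ E × (ends n e ≡ (u , v) ⊎ ends n e ≡ (v , u))

  Connected : Set
  Connected = Nonempty V × (∀ {u v} → u ∈ V → v ∈ V → Star Adj u v)

  -- v ∷ vs is the sequence of distinct vertices around the cycle.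
  IsCycle : Fin n → List (Fin n) → Set
  IsCycle v vs =
    3 ℕ.≤ length (v ∷ vs) × Unique (v ∷ vs) × Linked Adj (v ∷ vs ++ [ v ])

  IsTree : Set
  IsTree = Connected × (∀ v vs → ¬ IsCycle v vs)

  order : ℕ
  order = ∣ V ∣

  degree : Fin n → ℕ
  degree v = ∣ E ∩ tabulate (λ e → does (v Fin.≟ proj₁ (ends n e))
                                 ∨ does (v Fin.≟ proj₂ (ends n e))) ∣

  #leaves : ℕ
  #leaves = ∣ V ∩ tabulate (λ v → does (degree v ℕ.≟ 1)) ∣

-- The proof argument restricts the domain to the edges of G; such proofs
-- are unique (Data.Vec.Properties.[]=-irrelevant).
Coloring : ℕ → ∀ {n} → Graph n → Set
Coloring r {n} G = (e : Edge n) → e ∈ edges G → Fin r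

Monochromatic : ∀ {r n} {G : Graph n} → Coloring r G → Subgraph G → Set
Monochromatic {r} c H = Σ (Fin r) λ k → ∀ e (e∈E : e ∈ E) → c e (E⊆G e∈E) ≡ k
  where open Subgraph H

ForcesMonoComponent : ℕ → ∀ {n} → Graph n → ℕ → Set
ForcesMonoComponent r G s = (c : Coloring r G) →
  Σ (Subgraph G) λ H → Connected H × Monochromatic c H × s ℕ.≤ order H

-- s is the value of tm_r(G).
IsTm : ℕ → ∀ {n} → Graph n → ℕ → Set
IsTm r G s = ForcesMonoComponent r G s × (∀ t → ForcesMonoComponent r G t → t ℕ.≤ s)

TmAtLeast : ℕ → ∀ {n} → Graph n → ℝ → Set
TmAtLeast r G x = ∃ λ s → IsTm r G s × x ≤ℝ fromℕ s

MonoTreeOfOrder≥ : ∀ {r n} (G : Graph n) → Coloring r G → ℝ → Set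
MonoTreeOfOrder≥ G c x =
  Σ (Subgraph G) λ H → IsTree H × Monochromatic c H × x ≤ℝ fromℕ (order H)

MonoTreeWithLeaves≥ : ∀ {r n} (G : Graph n) → Coloring r G → ℝ → Set
MonoTreeWithLeaves≥ G c x =
  Σ (Subgraph G) λ H → IsTree H × Monochromatic c H × x ≤ℝ fromℕ (#leaves H)

allSubsets : (m : ℕ) → List (Subset m)
allSubsets zero    = [ Vec.[] ]
allSubsets (suc m) = map (inside Vec.∷_) (allSubsets m) ++ map (outside Vec.∷_) (allSubsets m)

sumℝ : List ℝ → ℝ
sumℝ = foldr _+ℝ_ 0ℝ

-- The probability of an edge set under G(n,p): a factor p for every pair
-- that is an edge and a factor 1 - p for every pair that is not.
weight : ℝ → ∀ {m} → Subset m → ℝ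
weight p = Vec.foldr (λ _ → ℝ) (λ b w → (if b then p else 1ℝ -ℝ p) *ℝ w) 1ℝ

Pr : ∀ n → ℝ → (Graph n → Bool) → ℝ
Pr n p B = sumℝ (map (λ G → if B G then weight p (edges G) else 0ℝ)
                      (map mkGraph (allSubsets (#pairs n))))

-- Pr takes Boolean events, whereas an event mentioning a real number need
-- not be decidable.  Such an event holds a.a.s. when it contains Boolean
-- events of probability tending to 1; for decidable A this says exactly
-- that Pr[A n] tends to 1, by monotonicity of Pr.
Aas : (ℕ → ℝ) → (∀ n → Graph n → Set) → Set
Aas p A = Σ (∀ n → Graph n → Bool) λ B →
  (∀ n G → T (B n G) → A n G) × ((λ n → Pr n (p n) (B n)) ⟶ 1ℝ)

{-# OPTIONS --safe #-}

-- With high probability, any two vertex sets of linear size have an edge between them, and this property of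
-- G(n,p) is all that is needed.  In each colour, cover the vertices by boundedly many small pieces, each of
-- which is connected or a union of small components.  Classify a vertex v by its
-- pieces and by the pieces it is adjacent to, and drop the vertices in rare classes.  An edge between two of the
-- remaining classes, of colour i say, shows that each vertex of one class is adjacent in colour i to the
-- piece of each vertex of the other; so the relation "v touches the i-piece of w and conversely" colours all
-- pairs of remaining vertices.  If one component of the first colour does not cover them, then there is a cut
-- avoiding that colour, and averaging d(u) + d(w) over the edges uw of the most frequent of the other r - 1
-- colours gives a double star of order n/(r-1).  Its two centres stand for small connected pieces, which form
-- the core of a monochromatic tree; the other vertices of the double star are its leaves.

module Submission where

open import Defs
open import Algebra.Bundles using (CommutativeRing)
open import Data.Bool.Base as Bool using (Bool; true; false; if_then_else_; _∧_; not)
import Data.Bool.Properties as Bool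
open import Data.Empty using (⊥; ⊥-elim)
open import Data.Fin.Base as Fin using (Fin; zero; suc; toℕ; fromℕ<)
import Data.Fin.Properties as Fin
open import Data.Fin.Subset as Subset using (Subset; ∣_∣)
import Data.Fin.Subset.Properties as Subset
open import Data.Integer.Base as ℤ using (+_)
import Data.Integer.Properties as ℤ
open import Data.List.Base as List using (List; []; _∷_; _++_; [_]; length)
import Data.List.Membership.DecPropositional as DecMembership
open import Data.List.Membership.Propositional using () renaming (_∈_ to _∈ᴸ_)
open import Data.List.Membership.Propositional.Properties using (∈-cartesianProduct⁺; ∈-allFin)
import Data.List.Properties as List
open import Data.List.Relation.Unary.All as All using (All; []; _∷_)
open import Data.List.Relation.Unary.AllPairs using (_∷_)
open import Data.List.Relation.Unary.Any using (here; there)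
open import Data.List.Relation.Unary.Linked as Linked using (Linked; []; [-]; _∷_)
open import Data.List.Relation.Unary.Unique.Propositional using (Unique)
open import Data.Maybe.Base as Maybe using (Maybe; just; nothing; fromMaybe)
open import Data.Nat.Base as ℕ
  using (ℕ; zero; suc; _+_; _*_; _∸_; _^_; _/_; _%_; _≤_; _<_; z≤n; s≤s; s≤s⁻¹; NonZero; NonTrivial; >-nonZero)
import Data.Nat.DivMod as ℕ
open import Data.Nat.ListAction using () renaming (sum to sumᴸ)
open import Data.Nat.ListAction.Properties using () renaming (sum-++ to sumᴸ-++)
import Data.Nat.Properties as ℕ
open import Data.Nat.Tactic.RingSolver using (solve-∀)
open import Data.Product.Base using (Σ; ∃; ∃₂; _×_; _,_; proj₁; proj₂; uncurry)
import Data.Product.Properties as Product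
open import Data.Rational.Base as ℚ using (ℚ; 0ℚ; 1ℚ; ½)
import Data.Rational.Properties as ℚ
open import Data.Rational.Solver using (module +-*-Solver)
import Data.Rational.Unnormalised.Base as ℚᵘ
import Data.Rational.Unnormalised.Properties as ℚᵘ
open import Data.Sum.Base as Sum using (_⊎_; inj₁; inj₂; [_,_]′)
open import Data.Vec.Base as Vec using (Vec; []; _∷_; lookup; tabulate)
import Data.Vec.Properties as Vec
import Data.Vec.Properties.WithK as Vec
open import Function.Base using (_∘_; id; flip; case_of_)
open import Relation.Binary.Construct.Closure.ReflexiveTransitive as Star using (Star; _◅_; _◅◅_)
open import Relation.Binary.Definitions using (tri<; tri≈; tri>)
open import Relation.Binary.PropositionalEquality
  using (_≡_; _≢_; refl; sym; trans; cong; cong₂; subst; module ≡-Reasoning)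
open import Relation.Nullary using (¬_; Dec; yes; no; does; contradiction; map′; _×-dec_; _⊎-dec_; ¬?)
open import Relation.Nullary.Decidable using (dec-true)
open import Algebra.Properties.Semiring.Exp (CommutativeRing.semiring ℚ.+-*-commutativeRing)
  using (^-homo-*; ^-assocʳ) renaming (_^_ to _↑_)
open import Algebra.Properties.Semiring.Sum ℕ.+-*-semiring
  using (sum; ∑-distrib-+; ∑-comm; *-distribˡ-sum; *-distribʳ-sum; sum-cong-≗)
open Graph

-- Finite sets and counting

-- Two demands on the pieces pull against each other. There must be boundedly many, so that a class
-- that is not rare has linear order and sends an edge to every other such class; and they must be
-- small, so that deleting two of them from the double star costs only a small fraction of `n`. The
-- components of a colour can violate both. Cutting off connected sets of `q` vertices, with `q` a
-- constant fraction of `n`, and hanging every leftover component on one of the sets that it touches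
-- meets both demands. Components that touch no such set are bundled merely to keep the number of
-- pieces bounded. A piece of this kind need not be connected, but no edge of its colour leaves it;
-- a double star centred there stays inside its at most `3q` vertices, too few to be the one found
-- by averaging. On the probabilistic side `p` is real, and the rational approximations of a number
-- in [0,1] may leave [0,1]. The chance of a hole is therefore bounded at a nearby rational in [0,1]
-- and carried over by a Lipschitz estimate whose constant depends on `n` alone.

Sub : ℕ → Set
Sub n = Fin n → Bool

infix 4 _∈_ _∉_ _⊆_ _∈?_
infixr 6 _∪_
infixl 7 _─_

-- A record instead of the bare equation `A v ≡ true`, from which unification could not recover `A`
-- and `v`.
record _∈_ {n} (v : Fin n) (A : Sub n) : Set where
  constructor mem
  field holds : A v ≡ true

_∉_ : ∀ {n} → Fin n → Sub n → Set
v ∉ A = ¬ v ∈ A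

_⊆_ : ∀ {n} → Sub n → Sub n → Set
A ⊆ B = ∀ {v} → v ∈ A → v ∈ B

_∈?_ : ∀ {n} (v : Fin n) (A : Sub n) → Dec (v ∈ A)
v ∈? A = map′ mem _∈_.holds (A v Bool.≟ true)

⟦_⟧ : ∀ {n} {P : Fin n → Set} → (∀ v → Dec (P v)) → Sub n
⟦ P? ⟧ v = does (P? v)

∈⁺ : ∀ {n} {P : Fin n → Set} (P? : ∀ v → Dec (P v)) {v} → P v → v ∈ ⟦ P? ⟧
∈⁺ P? {v} p = mem (dec-true (P? v) p)

∈⁻ : ∀ {n} {P : Fin n → Set} (P? : ∀ v → Dec (P v)) {v} → v ∈ ⟦ P? ⟧ → P v
∈⁻ P? {v} (mem h) with P? v
... | yes p = p

∅ univ : ∀ {n} → Sub n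
∅ _ = false
univ _ = true

⁅_⁆ : ∀ {n} → Fin n → Sub n
⁅ v ⁆ = ⟦ Fin._≟ v ⟧

_∪_ _─_ : ∀ {n} → Sub n → Sub n → Sub n
A ∪ B = ⟦ (λ v → v ∈? A ⊎-dec v ∈? B) ⟧
A ─ B = ⟦ (λ v → v ∈? A ×-dec ¬? (v ∈? B)) ⟧

module _ {n} (A B : Sub n) {v : Fin n} where
  ∪⁺ : v ∈ A ⊎ v ∈ B → v ∈ A ∪ B
  ∪⁺ = ∈⁺ (λ v → v ∈? A ⊎-dec v ∈? B)

  ∪⁻ : v ∈ A ∪ B → v ∈ A ⊎ v ∈ B
  ∪⁻ = ∈⁻ (λ v → v ∈? A ⊎-dec v ∈? B)

  ─⁺ : v ∈ A → v ∉ B → v ∈ A ─ B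
  ─⁺ a b = ∈⁺ (λ v → v ∈? A ×-dec ¬? (v ∈? B)) (a , b)

  ─⁻ : v ∈ A ─ B → v ∈ A × v ∉ B
  ─⁻ = ∈⁻ (λ v → v ∈? A ×-dec ¬? (v ∈? B))

∈⁅⁆⁻ : ∀ {n} {u v : Fin n} → u ∈ ⁅ v ⁆ → u ≡ v
∈⁅⁆⁻ {v = v} = ∈⁻ (Fin._≟ v)

∈⁅⁆⁺ : ∀ {n} (v : Fin n) → v ∈ ⁅ v ⁆
∈⁅⁆⁺ v = ∈⁺ (Fin._≟ v) refl

sum-mono-≤ : ∀ {n} {f g : Fin n → ℕ} → (∀ i → f i ≤ g i) → sum f ≤ sum g
sum-mono-≤ {zero}  h = z≤n
sum-mono-≤ {suc n} h = ℕ.+-mono-≤ (h zero) (sum-mono-≤ (h ∘ suc))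

sum-const : ∀ n c → sum {n} (λ _ → c) ≡ n * c
sum-const zero    c = refl
sum-const (suc n) c = cong (λ z → c + z) (sum-const n c)

sum-zero : ∀ n → sum {n} (λ _ → 0) ≡ 0
sum-zero n = trans (sum-const n 0) (ℕ.*-zeroʳ n)

term≤sum : ∀ {n} (f : Fin n → ℕ) i → f i ≤ sum f
term≤sum f zero    = ℕ.m≤m+n _ _
term≤sum f (suc i) = ℕ.m≤n⇒m≤o+n (f zero) (term≤sum (f ∘ suc) i)

χ : Bool → ℕ
χ b = if b then 1 else 0

# : ∀ {n} → Sub n → ℕ
# A = sum (χ ∘ A)

χ-∈ : ∀ {n} {A : Sub n} {v} → v ∈ A → χ (A v) ≡ 1
χ-∈ (mem h) = cong χ h

χ≤1 : ∀ b → χ b ≤ 1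
χ≤1 true  = ℕ.≤-refl
χ≤1 false = z≤n

χ-≤ : ∀ {n} (A : Sub n) v {k} → (v ∈ A → 1 ≤ k) → χ (A v) ≤ k
χ-≤ A v h with A v in eq
... | true  = h (mem eq)
... | false = z≤n

module _ {n} {A B : Sub n} where
  #-mono : A ⊆ B → # A ≤ # B
  #-mono h = sum-mono-≤ λ v → χ-≤ A v λ a → ℕ.≤-reflexive (sym (χ-∈ (h a)))

  #-cover : ∀ {C} → (∀ {v} → v ∈ C → v ∈ A ⊎ v ∈ B) → # C ≤ # A + # B
  #-cover {C} h = ℕ.≤-trans
    (sum-mono-≤ λ v → χ-≤ C v λ c →
      [ (λ a → ℕ.≤-trans (ℕ.≤-reflexive (sym (χ-∈ a))) (ℕ.m≤m+n _ _))
      , (λ b → ℕ.≤-trans (ℕ.≤-reflexive (sym (χ-∈ b))) (ℕ.m≤n+m _ _)) ]′ (h c))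
    (ℕ.≤-reflexive (∑-distrib-+ (χ ∘ A) (χ ∘ B)))

  #-disjoint : ∀ {C} → A ⊆ C → B ⊆ C → (∀ {v} → v ∈ A → v ∉ B) → # A + # B ≤ # C
  #-disjoint {C} hA hB dis = ℕ.≤-trans
    (ℕ.≤-reflexive (sym (∑-distrib-+ (χ ∘ A) (χ ∘ B))))
    (sum-mono-≤ pointwise)
    where
    pointwise : ∀ v → χ (A v) + χ (B v) ≤ χ (C v)
    pointwise v with v ∈? A | v ∈? B
    ... | yes a | yes b = contradiction b (dis a)
    ... | yes a | no ¬b rewrite χ-∈ {A = C} (hA a) | χ-∈ {A = A} a =
      s≤s (χ-≤ B v λ b → contradiction b ¬b)
    ... | no ¬a | _ = ℕ.≤-trans
      (ℕ.+-monoˡ-≤ _ (χ-≤ A v {0} λ a → contradiction a ¬a))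
      (χ-≤ B v λ b → ℕ.≤-reflexive (sym (χ-∈ (hB b))))

#≤n : ∀ {n} (A : Sub n) → # A ≤ n
#≤n {n} A = ℕ.≤-trans (sum-mono-≤ (χ≤1 ∘ A))
                     (ℕ.≤-reflexive (trans (sum-const n 1) (ℕ.*-identityʳ n)))

#-univ : ∀ n → # (univ {n}) ≡ n
#-univ n = trans (sum-const n 1) (ℕ.*-identityʳ n)

∈⇒#>0 : ∀ {n} {A : Sub n} {v} → v ∈ A → 1 ≤ # A
∈⇒#>0 {A = A} {v} a = subst (_≤ # A) (χ-∈ a) (term≤sum (χ ∘ A) v)

#-empty : ∀ {n} {A : Sub n} → (∀ {v} → v ∉ A) → # A ≡ 0
#-empty {n} {A} h = ℕ.n≤0⇒n≡0 (ℕ.≤-trans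
  (sum-mono-≤ λ v → χ-≤ A v λ a → contradiction a h) (ℕ.≤-reflexive (sum-zero n)))

#>0⇒∃ : ∀ {n} (A : Sub n) → 1 ≤ # A → ∃ λ v → v ∈ A
#>0⇒∃ A h with Fin.any? (_∈? A)
... | yes p = p
... | no ¬p = contradiction (#-empty {A = A} λ {v} a → ¬p (v , a)) (ℕ.>⇒≢ h)

#-⁅⁆ : ∀ {n} (v : Fin n) → # ⁅ v ⁆ ≡ 1
#-⁅⁆ {suc n} zero    = cong suc (sum-zero n)
#-⁅⁆ {suc n} (suc v) = trans (sum-cong-≗ pointwise) (#-⁅⁆ v)
  where
  pointwise : ∀ u → χ (⁅ suc v ⁆ (suc u)) ≡ χ (⁅ v ⁆ u)
  pointwise u with u Fin.≟ v
  ... | yes _ = refl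
  ... | no _  = refl

#-insert : ∀ {n} (A : Sub n) {v} → v ∉ A → # (A ∪ ⁅ v ⁆) ≡ suc (# A)
#-insert A {v} v∉A = ℕ.≤-antisym
  (ℕ.≤-trans (#-cover {A = A} {⁅ v ⁆} (∪⁻ A ⁅ v ⁆)) (ℕ.≤-reflexive eq))
  (ℕ.≤-trans (ℕ.≤-reflexive (sym eq))
    (#-disjoint (∪⁺ A ⁅ v ⁆ ∘ inj₁) (∪⁺ A ⁅ v ⁆ ∘ inj₂)
      λ a b → v∉A (subst (_∈ A) (∈⁅⁆⁻ b) a)))
  where
  eq : # A + # ⁅ v ⁆ ≡ suc (# A)
  eq = trans (cong (λ z → # A + z) (#-⁅⁆ v)) (ℕ.+-comm (# A) 1)

#-split : ∀ {n} (A B : Sub n) → B ⊆ A → # (A ─ B) + # B ≡ # A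
#-split A B B⊆A = ℕ.≤-antisym
  (#-disjoint (proj₁ ∘ ─⁻ A B) B⊆A (proj₂ ∘ ─⁻ A B))
  (#-cover λ {v} a → cover v a)
  where
  cover : ∀ v → v ∈ A → v ∈ A ─ B ⊎ v ∈ B
  cover v a with v ∈? B
  ... | yes b = inj₂ b
  ... | no ¬b = inj₁ (─⁺ A B a ¬b)

-- Connected sets in a graph

∀⊎⇒∃⊎∀ : ∀ {n} {P Q : Fin n → Set} → (∀ v → P v ⊎ Q v) → ∃ P ⊎ (∀ v → Q v)
∀⊎⇒∃⊎∀ {zero}  h = inj₂ λ ()
∀⊎⇒∃⊎∀ {suc n} h with h zero | ∀⊎⇒∃⊎∀ (h ∘ suc)
... | inj₁ p | _            = inj₁ (zero , p)
... | inj₂ q | inj₁ (v , p) = inj₁ (suc v , p)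
... | inj₂ q | inj₂ qs      = inj₂ λ { zero → q ; (suc v) → qs v }

-- Depends only on the extension of `A` (`least-cong`), so it yields the same representative of a
-- component whichever vertex the component was grown from.
least : ∀ {n} → Sub n → Maybe (Fin n)
least {zero}  A = nothing
least {suc n} A = if A zero then just zero else Maybe.map suc (least (A ∘ suc))

least-cong : ∀ {n} {A B : Sub n} → (∀ v → A v ≡ B v) → least A ≡ least B
least-cong {zero}  h = refl
least-cong {suc n} h rewrite h zero | least-cong (h ∘ suc) = refl

least-∈ : ∀ {n} (A : Sub n) {v} → v ∈ A → ∃ λ x → least A ≡ just x × x ∈ A
least-∈ {suc n} A {v} (mem h) with A zero in eq
... | true = zero , refl , mem eq
least-∈ {suc n} A {zero}  (mem h) | false = case trans (sym h) eq of λ ()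
least-∈ {suc n} A {suc v} (mem h) | false =
  let x , leq , x∈ = least-∈ (A ∘ suc) {v} (mem h)
  in suc x , cong (Maybe.map suc) leq , mem (_∈_.holds x∈)

⊆-antisym : ∀ {n} {A B : Sub n} → A ⊆ B → B ⊆ A → ∀ v → A v ≡ B v
⊆-antisym {A = A} {B} h h′ v with A v in a | B v in b
... | true  | true  = refl
... | false | false = refl
... | true  | false = trans (sym (_∈_.holds (h (mem a)))) b
... | false | true  = trans (sym a) (_∈_.holds (h′ (mem b)))

load : ∀ {N} → (Fin N → ℕ) → (Fin N → ℕ) → ℕ → ℕ
load f g j = sum λ x → χ (does (g x ℕ.≟ j)) * f x

-- Next-fit bin packing; c is the load of the open bin number 0.
pack : ∀ q {N} c (f : Fin N → ℕ) → c ≤ q → (∀ x → f x ≤ q) →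
       ∃ λ (g : Fin N → ℕ) → (∀ x → q * g x ≤ c + sum f) ×
         c + load f g 0 ≤ q + q × (∀ j → load f g j ≤ q + q)
pack q {zero} c f c≤q f≤q =
  (λ ()) , (λ ()) , ℕ.≤-trans (ℕ.≤-reflexive (ℕ.+-identityʳ c)) (ℕ.m≤n⇒m≤n+o q c≤q) , λ _ → z≤n
pack q {suc N} c f c≤q f≤q with c + f zero ℕ.≤? q
... | yes fits with pack q (c + f zero) (f ∘ suc) fits (f≤q ∘ suc)
... | g , bound , load₀ , loads =
  g′ , bound′ , load₀′ , λ { zero → ℕ.≤-trans (ℕ.m≤n+m _ c) load₀′ ; (suc j) → loads (suc j) }
  where
  g′ : Fin (suc N) → ℕ
  g′ zero    = 0
  g′ (suc x) = g x
  bound′ : ∀ x → q * g′ x ≤ c + sum f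
  bound′ zero    = ℕ.≤-trans (ℕ.≤-reflexive (ℕ.*-zeroʳ q)) z≤n
  bound′ (suc x) = ℕ.≤-trans (bound x) (ℕ.≤-reflexive (ℕ.+-assoc c _ _))
  load₀′ : c + load f g′ 0 ≤ q + q
  load₀′ = ℕ.≤-trans (ℕ.≤-reflexive
    (trans (cong (λ z → c + (z + load (f ∘ suc) g 0)) (ℕ.+-identityʳ (f zero)))
           (sym (ℕ.+-assoc c (f zero) _)))) load₀
-- The item that overflows the open bin is still put into it. A closed bin thus holds more than `q`,
-- which bounds the bin numbers, and at most `q + q`.
pack q {suc N} c f c≤q f≤q | no full with pack q 0 (f ∘ suc) z≤n (f≤q ∘ suc)
... | g , bound , _ , loads =
  g′ , bound′ , load₀′ , λ { zero → ℕ.≤-trans (ℕ.m≤n+m _ c) load₀′ ; (suc j) → loads j }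
  where
  g′ : Fin (suc N) → ℕ
  g′ zero    = 0
  g′ (suc x) = suc (g x)
  bound′ : ∀ x → q * g′ x ≤ c + sum f
  bound′ zero    = ℕ.≤-trans (ℕ.≤-reflexive (ℕ.*-zeroʳ q)) z≤n
  bound′ (suc x) = ℕ.≤-trans (ℕ.≤-reflexive (ℕ.*-suc q (g x)))
    (ℕ.≤-trans (ℕ.+-mono-≤ (ℕ.<⇒≤ (ℕ.≰⇒> full)) (bound x)) (ℕ.≤-reflexive (ℕ.+-assoc c _ _)))
  load₀′ : c + load f g′ 0 ≤ q + q
  load₀′ = ℕ.+-mono-≤ c≤q (ℕ.≤-trans (ℕ.≤-reflexive
    (trans (cong (λ z → f zero + 0 + z) (sum-zero N))
      (trans (ℕ.+-identityʳ _) (ℕ.+-identityʳ _)))) (f≤q zero))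

module Growth {n} (E : Fin n → Fin n → Set) (E? : ∀ u v → Dec (E u v))
              (E-sym : ∀ {u v} → E u v → E v u) where

  Path : Sub n → Fin n → Fin n → Set
  Path S = Star λ x y → x ∈ S × y ∈ S × E x y

  Conn : Sub n → Set
  Conn S = ∀ {u v} → u ∈ S → v ∈ S → Path S u v

  ClosedIn : Sub n → Sub n → Set
  ClosedIn U S = ∀ {x y} → x ∈ S → y ∈ U → E x y → y ∈ S

  path-mono : ∀ {S T} → S ⊆ T → ∀ {u v} → Path S u v → Path T u v
  path-mono h = Star.map λ (x∈ , y∈ , e) → h x∈ , h y∈ , e

  path-sym : ∀ {S u v} → Path S u v → Path S v u
  path-sym = Star.reverse λ (x∈ , y∈ , e) → y∈ , x∈ , E-sym e

  path-closed : ∀ {U S} → ClosedIn U S → ∀ {u v} → Path U u v → u ∈ S → v ∈ S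
  path-closed cl Star.ε                    u∈ = u∈
  path-closed cl ((_ , y∈ , e) ◅ p) u∈ = path-closed cl p (cl u∈ y∈ e)

  conn-from : ∀ {S v} → (∀ {w} → w ∈ S → Path S v w) → Conn S
  conn-from h u∈ w∈ = path-sym (h u∈) ◅◅ h w∈

  frontier? : ∀ U S → (∃₂ λ x y → x ∈ S × y ∈ U × y ∉ S × E x y) ⊎ ClosedIn U S
  frontier? U S with Fin.any? (λ x → Fin.any? (λ y →
    x ∈? S ×-dec y ∈? U ×-dec ¬? (y ∈? S) ×-dec E? x y))
  ... | yes p = inj₁ p
  ... | no ¬p = inj₂ closed
    where
    closed : ClosedIn U S
    closed {x} {y} x∈ y∈U e with y ∈? S
    ... | yes y∈ = y∈
    ... | no y∉  = contradiction (x , y , x∈ , y∈U , y∉ , e) ¬p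

  -- Vertices are added one at a time, so growth either reaches exactly `suc m` vertices or gets
  -- stuck earlier at a set closed in `U`. The invariant `I` lets one loop serve for connected sets
  -- and for spanning trees.
  grow : (I : Sub n → Set) {U : Sub n} {v : Fin n} → v ∈ U → I ⁅ v ⁆ →
         (∀ {S x y} → I S → S ⊆ U → x ∈ S → y ∈ U → y ∉ S → E x y → I (S ∪ ⁅ y ⁆)) →
         ∀ m → ∃ λ S → I S × v ∈ S × S ⊆ U × (# S ≡ suc m ⊎ # S ≤ m × ClosedIn U S)
  grow I {U} {v} v∈U base step zero =
    ⁅ v ⁆ , base , ∈⁅⁆⁺ v , (λ w∈ → subst (_∈ U) (sym (∈⁅⁆⁻ w∈)) v∈U) , inj₁ (#-⁅⁆ v)
  grow I {U} v∈U base step (suc m) with grow I v∈U base step m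
  ... | S , i , v∈ , S⊆U , inj₂ (small , closed) = S , i , v∈ , S⊆U , inj₂ (ℕ.m≤n⇒m≤1+n small , closed)
  ... | S , i , v∈ , S⊆U , inj₁ size with frontier? U S
  ... | inj₂ closed = S , i , v∈ , S⊆U , inj₂ (ℕ.≤-reflexive size , closed)
  ... | inj₁ (x , y , x∈ , y∈U , y∉ , e) =
    S ∪ ⁅ y ⁆ , step i S⊆U x∈ y∈U y∉ e , ∪⁺ S ⁅ y ⁆ (inj₁ v∈) ,
    (λ w∈ → [ S⊆U , (λ w≡y → subst (_∈ U) (sym (∈⁅⁆⁻ w≡y)) y∈U) ]′ (∪⁻ S ⁅ y ⁆ w∈)) ,
    inj₁ (trans (#-insert S y∉) (cong suc size))

  growConn : ∀ {U v} → v ∈ U → ∀ m →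
    ∃ λ S → Conn S × v ∈ S × S ⊆ U × (# S ≡ suc m ⊎ # S ≤ m × ClosedIn U S)
  growConn {U} {v} v∈U m =
    let S , reach , rest = grow (λ S → v ∈ S × (∀ {w} → w ∈ S → Path S v w)) v∈U
          (∈⁅⁆⁺ v , λ w∈ → subst (Path ⁅ v ⁆ v) (sym (∈⁅⁆⁻ w∈)) Star.ε) extend m
    in S , conn-from (proj₂ reach) , rest
    where
    extend : ∀ {S x y} → v ∈ S × (∀ {w} → w ∈ S → Path S v w) → S ⊆ U → x ∈ S → y ∈ U → y ∉ S →
             E x y → v ∈ S ∪ ⁅ y ⁆ × (∀ {w} → w ∈ S ∪ ⁅ y ⁆ → Path (S ∪ ⁅ y ⁆) v w)
    extend {S} {x} {y} (v∈ , reach) _ x∈ _ _ e = old v∈ , λ w∈ → case ∪⁻ S ⁅ y ⁆ w∈ of λ where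
        (inj₁ w∈S) → path-mono old (reach w∈S)
        (inj₂ w≡y) → subst (Path _ v) (sym (∈⁅⁆⁻ w≡y))
          (path-mono old (reach x∈) ◅◅ (old x∈ , ∪⁺ S ⁅ y ⁆ (inj₂ (∈⁅⁆⁺ y)) , e) ◅ Star.ε)
      where
      old : S ⊆ S ∪ ⁅ y ⁆
      old = ∪⁺ S ⁅ y ⁆ ∘ inj₁

  component : ∀ {U v} → v ∈ U → ∃ λ S → Conn S × v ∈ S × S ⊆ U × ClosedIn U S
  component {U} v∈U with growConn v∈U n
  ... | S , conn , v∈ , S⊆U , inj₂ (_ , closed) = S , conn , v∈ , S⊆U , closed
  ... | S , _ , _ , _ , inj₁ big = contradiction (#≤n S) (ℕ.<⇒≱ (ℕ.≤-reflexive (sym big)))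

  record SmallComponent (q : ℕ) (R : Sub n) (v : Fin n) : Set where
    field
      comp   : Sub n
      conn   : Conn comp
      center : v ∈ comp
      inside : comp ⊆ R
      small  : # comp ≤ q
      closed : ClosedIn R comp

  record Balls (q f : ℕ) (U : Sub n) : Set where
    field
      ball      : Fin f → Sub n
      ball-conn : ∀ a → Conn (ball a)
      ball-size : ∀ a → # (ball a) ≤ q
      rest      : Sub n
      cover     : ∀ {v} → v ∈ U → v ∈ rest ⊎ ∃ λ a → v ∈ ball a
      local     : ∀ v → v ∈ rest → SmallComponent q rest v

  -- Greedy: while some vertex reaches `suc m` vertices of what is left, a connected set of exactly
  -- that order is cut off. Each one costs `suc m` of fewer than `f * suc m` vertices, so `f` of
  -- them are never exhausted. When no vertex reaches that far, all components of the remainder are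
  -- small, and the balls still to be named are empty.
  balls : ∀ m f U → # U < f * suc m → Balls (suc m) f U
  balls m (suc f) U size with ∀⊎⇒∃⊎∀ {P = λ v → ∃ λ S → Conn S × S ⊆ U × # S ≡ suc m}
                                      {Q = λ v → v ∈ U → SmallComponent (suc m) U v} attempt
    where
    attempt : ∀ v → (∃ λ S → Conn S × S ⊆ U × # S ≡ suc m) ⊎ (v ∈ U → SmallComponent (suc m) U v)
    attempt v with v ∈? U
    ... | no v∉  = inj₂ λ v∈ → contradiction v∈ v∉
    ... | yes v∈ with growConn v∈ m
    ... | S , conn , _ , S⊆U , inj₁ size = inj₁ (S , conn , S⊆U , size)
    ... | S , conn , v∈S , S⊆U , inj₂ (small , closed) = inj₂ λ _ → record
      { comp = S ; conn = conn ; center = v∈S ; inside = S⊆U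
      ; small = ℕ.m≤n⇒m≤1+n small ; closed = closed }
  ... | inj₂ local = record
    { ball = λ _ → ∅
    ; ball-conn = λ { _ (mem ()) }
    ; ball-size = λ _ → ℕ.≤-trans (ℕ.≤-reflexive (sum-zero n)) z≤n
    ; rest = U ; cover = inj₁ ; local = local }
  ... | inj₁ (_ , S , conn , S⊆U , sizeS) = record
    { ball = λ { zero → S ; (suc a) → Balls.ball rec a }
    ; ball-conn = λ { zero → conn ; (suc a) → Balls.ball-conn rec a }
    ; ball-size = λ { zero → ℕ.≤-reflexive sizeS ; (suc a) → Balls.ball-size rec a }
    ; rest = Balls.rest rec ; cover = cover ; local = Balls.local rec }
    where
    rec : Balls (suc m) f (U ─ S)
    rec = balls m f (U ─ S) (ℕ.+-cancelʳ-< (suc m) _ _ (ℕ.≤-trans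
      (ℕ.≤-reflexive (cong suc (trans (cong (λ z → # (U ─ S) + z) (sym sizeS)) (#-split U S S⊆U))))
      (ℕ.≤-trans size (ℕ.≤-reflexive (ℕ.+-comm (suc m) (f * suc m))))))
    cover : ∀ {v} → v ∈ U → _
    cover {v} v∈ with v ∈? S
    ... | yes v∈S = inj₂ (zero , v∈S)
    ... | no v∉S with Balls.cover rec (─⁺ U S v∈ v∉S)
    ... | inj₁ v∈R       = inj₁ v∈R
    ... | inj₂ (a , v∈a) = inj₂ (suc a , v∈a)

-- Decomposition into boundedly many small pieces

module Decomposition {n} (E : Fin n → Fin n → Set) (E? : ∀ u v → Dec (E u v))
              (E-sym : ∀ {u v} → E u v → E v u) where
  open Growth E E? E-sym

  -- A hub, where zero stands for no hub, and a bin.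
  Label : ℕ → Set
  Label f = Fin (suc f) × Fin f

  -- The pieces cover all vertices but may overlap, since a hub belongs to the pieces of all its
  -- bins. A piece of the second `kind` is a union of components of the whole graph, and there
  -- membership determines the label.
  record Pieces (f q : ℕ) : Set where
    field
      label : Fin n → Label f
      piece : Label f → Sub n
      size  : ∀ k → # (piece k) ≤ q + (q + q)
      own   : ∀ v → v ∈ piece (label v)
      kind  : ∀ k → Conn (piece k) ⊎
                    ClosedIn univ (piece k) × (∀ {x} → x ∈ piece k → label x ≡ k)

  module Bundling {f q} (n<fq : n < f * q) (B : Balls q f univ) where
    open Balls B
    open SmallComponent

    abstract
      -- Fixes a single set for each vertex, independent of the proof that the vertex lies in
      -- `rest`.
      comp? : ∀ v → ∃ λ (C : Sub n) → v ∈ rest → Σ (SmallComponent q rest v) λ c → comp c ≡ C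
      comp? v with v ∈? rest
      ... | yes v∈ = comp (local v v∈) , λ _ → local v v∈ , refl
      ... | no v∉  = ∅ , λ v∈ → contradiction v∈ v∉

    co : Fin n → Sub n
    co v = proj₁ (comp? v)

    module _ {x} (x∈ : x ∈ rest) where
      private
        c : SmallComponent q rest x
        c = proj₁ (proj₂ (comp? x) x∈)
        eq : comp c ≡ co x
        eq = proj₂ (proj₂ (comp? x) x∈)

      co-conn : Conn (co x)
      co-conn = subst Conn eq (conn c)
      co-center : x ∈ co x
      co-center = subst (x ∈_) eq (center c)
      co-inside : co x ⊆ rest
      co-inside = subst (_⊆ rest) eq (inside c)
      co-small : # (co x) ≤ q
      co-small = subst (λ C → # C ≤ q) eq (small c)
      co-closed : ClosedIn rest (co x)
      co-closed = subst (ClosedIn rest) eq (closed c)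

    module _ {x y} (x∈ : x ∈ rest) (y∈x : y ∈ co x) where
      -- A path inside the connected set grown from `y` cannot leave the one grown from `x`, which
      -- is closed in `rest` and contains `y`. With `co-⊇`, sets grown from the same component
      -- coincide.
      co-⊆ : co y ⊆ co x
      co-⊆ z∈ = path-closed (co-closed x∈)
        (path-mono (co-inside y∈) (co-conn y∈ (co-center y∈) z∈)) y∈x
        where y∈ = co-inside x∈ y∈x

      co-⊇ : co x ⊆ co y
      co-⊇ z∈ = path-closed (co-closed y∈) (path-mono (co-inside x∈) (co-conn x∈ y∈x z∈)) (co-center y∈)
        where y∈ = co-inside x∈ y∈x

    rep : Fin n → Fin n
    rep v = fromMaybe v (least (co v))

    rep-∈ : ∀ {x} → x ∈ rest → rep x ∈ co x
    rep-∈ {x} x∈ with least-∈ (co x) (co-center x∈)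
    ... | z , eq , z∈ rewrite eq = z∈

    rep-cong : ∀ {x y} → x ∈ rest → y ∈ co x → rep y ≡ rep x
    rep-cong {x} {y} x∈ y∈x with least-∈ (co x) (co-center x∈)
    ... | z , eq , _ rewrite least-cong {A = co y} {co x} (⊆-antisym (co-⊆ x∈ y∈x) (co-⊇ x∈ y∈x)) | eq = refl

    -- Empty unless `x` represents a component, so all `n` vertices can be packed as items with
    -- total size at most `n`.
    class : Fin n → Sub n
    class x = ⟦ (λ w → w ∈? rest ×-dec rep w Fin.≟ x) ⟧

    ∈-class⁻ : ∀ {x w} → w ∈ class x → w ∈ rest × rep w ≡ x
    ∈-class⁻ {x} = ∈⁻ (λ w → w ∈? rest ×-dec rep w Fin.≟ x)

    ∈-class⁺ : ∀ {w} → w ∈ rest → w ∈ class (rep w)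
    ∈-class⁺ {w} w∈ = ∈⁺ (λ w′ → w′ ∈? rest ×-dec rep w′ Fin.≟ rep w) (w∈ , refl)

    class-size : ∀ x → # (class x) ≤ q
    class-size x with Fin.any? (_∈? class x)
    ... | no none = ℕ.≤-trans (ℕ.≤-reflexive (#-empty {A = class x} λ {v} v∈ → none (v , v∈))) z≤n
    ... | yes (w , w∈x) with ∈-class⁻ w∈x
    ... | w∈ , refl = ℕ.≤-trans (#-mono {A = class x} {co x} sub) (co-small x∈)
      where
      x∈ : rep w ∈ rest
      x∈ = co-inside w∈ (rep-∈ w∈)
      sub : class (rep w) ⊆ co (rep w)
      sub {v} v∈x with ∈-class⁻ v∈x
      ... | v∈ , eq = subst (λ z → v ∈ co z) eq (co-⊇ v∈ (rep-∈ v∈) (co-center v∈))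

    classes-total : sum (λ x → # (class x)) ≤ n
    classes-total = ℕ.≤-trans (ℕ.≤-reflexive (∑-comm λ x w → χ (class x w)))
      (ℕ.≤-trans (sum-mono-≤ λ w → single w) (ℕ.≤-reflexive (#-univ n)))
      where
      single : ∀ w → sum (λ x → χ (class x w)) ≤ 1
      single w = ℕ.≤-trans
        (sum-mono-≤ λ x → χ-≤ (class x) w λ w∈ → ℕ.≤-reflexive (sym (χ-∈ {A = ⁅ rep w ⁆}
          (subst (_∈ ⁅ rep w ⁆) (proj₂ (∈-class⁻ w∈)) (∈⁅⁆⁺ (rep w))))))
        (ℕ.≤-reflexive (#-⁅⁆ (rep w)))

    packing = pack q 0 (λ x → # (class x)) z≤n class-size

    bin : Fin n → ℕ
    bin = proj₁ packing

    bin< : ∀ x → bin x < f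
    bin< x = ℕ.*-cancelˡ-< q _ _ (ℕ.≤-<-trans (proj₁ (proj₂ packing) x)
      (ℕ.≤-<-trans classes-total (ℕ.<-≤-trans n<fq (ℕ.≤-reflexive (ℕ.*-comm f q)))))

    Touches : Fin n → Fin f → Set
    Touches x a = ∃₂ λ u y → u ∈ co x × y ∈ ball a × E u y

    abstract
      -- A component touching several balls is assigned to one of them. The value `zero` certifies
      -- that it touches none; together with closedness in `rest` this makes it a component of the
      -- whole graph.
      base? : ∀ x → ∃ λ b → (∀ {a} → b ≡ suc a → Touches x a) × (b ≡ zero → ∀ a → ¬ Touches x a)
      base? x with Fin.any? (λ a → Fin.any? λ u → Fin.any? λ y →
        u ∈? co x ×-dec y ∈? ball a ×-dec E? u y)
      ... | yes (a , t) = suc a , (λ { refl → t }) , λ ()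
      ... | no ¬t       = zero , (λ ()) , λ _ a t → ¬t (a , t)

    base : Fin n → Fin (suc f)
    base x = proj₁ (base? x)

    -- Base and bin are read off the representative, so that no component is split between bundles.
    InBundle : Label f → Fin n → Set
    InBundle (b , j) w = w ∈ rest × base (rep w) ≡ b × bin (rep w) ≡ toℕ j

    inBundle? : ∀ k w → Dec (InBundle k w)
    inBundle? (b , j) w = w ∈? rest ×-dec base (rep w) Fin.≟ b ×-dec bin (rep w) ℕ.≟ toℕ j

    bundle : Label f → Sub n
    bundle k = ⟦ inBundle? k ⟧

    -- Whatever the base, a bundle lies inside a single bin, whose load is at most `q + q`.
    bundle-size : ∀ k → # (bundle k) ≤ q + q
    bundle-size k@(b , j) = ℕ.≤-trans (ℕ.≤-trans (sum-mono-≤ pointwise) (ℕ.≤-reflexive (sym expand)))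
                                (proj₂ (proj₂ (proj₂ packing)) (toℕ j))
      where
      inBin : Fin n → ℕ
      inBin x = χ (does (bin x ℕ.≟ toℕ j))
      expand : load (λ x → # (class x)) bin (toℕ j) ≡ sum (λ w → sum λ x → inBin x * χ (class x w))
      expand = trans (sum-cong-≗ λ x → *-distribˡ-sum (inBin x) (χ ∘ class x))
                     (∑-comm λ x w → inBin x * χ (class x w))
      pointwise : ∀ w → χ (bundle k w) ≤ sum (λ x → inBin x * χ (class x w))
      pointwise w = χ-≤ (bundle k) w λ w∈ → let w∈R , _ , eq = ∈⁻ (inBundle? k) w∈ in
        ℕ.≤-trans (ℕ.≤-reflexive (sym (cong₂ _*_
            (χ-∈ {A = ⟦ (λ x → bin x ℕ.≟ toℕ j) ⟧} (∈⁺ (λ x → bin x ℕ.≟ toℕ j) eq))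
            (χ-∈ (∈-class⁺ w∈R)))))
          (term≤sum (λ x → inBin x * χ (class x w)) (rep w))

    hub : Fin (suc f) → Sub n
    hub zero    = ∅
    hub (suc a) = ball a

    hub-size : ∀ b → # (hub b) ≤ q
    hub-size zero    = ℕ.≤-trans (ℕ.≤-reflexive (sum-zero n)) z≤n
    hub-size (suc a) = ball-size a

    piece : Label f → Sub n
    piece k = hub (proj₁ k) ∪ bundle k

    bundle⊆piece : ∀ k → bundle k ⊆ piece k
    bundle⊆piece k = ∪⁺ (hub (proj₁ k)) (bundle k) ∘ inj₂

    hub⊆piece : ∀ k → hub (proj₁ k) ⊆ piece k
    hub⊆piece k = ∪⁺ (hub (proj₁ k)) (bundle k) ∘ inj₁

    restLabel : Fin n → Label f
    restLabel v = base (rep v) , fromℕ< (bin< (rep v))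

    label? : ∀ v → ∃ λ k → v ∈ piece k × (v ∈ rest → k ≡ restLabel v)
    label? v with v ∈? rest
    ... | yes v∈ = restLabel v , bundle⊆piece (restLabel v)
      (∈⁺ (inBundle? (restLabel v)) (v∈ , refl , sym (Fin.toℕ-fromℕ< (bin< (rep v))))) , λ _ → refl
    ... | no v∉ with cover {v} (mem refl)
    ... | inj₁ v∈ = contradiction v∈ v∉
    ... | inj₂ (a , v∈a) = k , hub⊆piece k v∈a , λ v∈ → contradiction v∈ v∉
      where
      k : Label f
      -- The ball lies in each piece with this hub, so the first bin will do; it exists because `a`
      -- inhabits `Fin f`.
      k = suc a , fromℕ< (ℕ.≤-<-trans z≤n (Fin.toℕ<n a))

    co⊆bundle : ∀ k {w} → w ∈ bundle k → co w ⊆ bundle k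
    co⊆bundle k {w} w∈ {z} z∈ =
      let w∈R , beq , jeq = ∈⁻ (inBundle? k) w∈
          same = rep-cong w∈R z∈
      in ∈⁺ (inBundle? k) (co-inside w∈R z∈ , trans (cong base same) beq , trans (cong bin same) jeq)

    -- Every component in the bundle reaches the ball through the edge recorded by `base?`, so all
    -- paths can be routed through the ball.
    ball-conn-piece : ∀ a j → Conn (piece (suc a , j))
    ball-conn-piece a j u∈ v∈ =
      let y , y∈ , p = toBall u∈ ; z , z∈ , p′ = toBall v∈
      in p ◅◅ path-mono (hub⊆piece k) (ball-conn a y∈ z∈) ◅◅ path-sym p′
      where
      k : Label f
      k = suc a , j
      toBall : ∀ {w} → w ∈ piece k → ∃ λ y → y ∈ ball a × Path (piece k) w y
      toBall {w} w∈ with ∪⁻ (ball a) (bundle k) w∈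
      ... | inj₁ w∈a = w , w∈a , Star.ε
      ... | inj₂ w∈b =
        let w∈R , beq , _ = ∈⁻ (inBundle? k) w∈b
            u , y , u∈ , y∈ , e = proj₁ (proj₂ (base? (rep w))) beq
            u∈w = co-⊆ w∈R (rep-∈ w∈R) u∈
            into : co w ⊆ piece k
            into z∈ = bundle⊆piece k (co⊆bundle k w∈b z∈)
        in y , y∈ , path-mono into (co-conn w∈R (co-center w∈R) u∈w)
                    ◅◅ (into u∈w , hub⊆piece k y∈ , e) ◅ Star.ε

    unattached : ∀ j {x} → x ∈ piece (zero , j) → InBundle (zero , j) x
    unattached j x∈ with ∪⁻ ∅ (bundle (zero , j)) x∈
    ... | inj₂ x∈b = ∈⁻ (inBundle? (zero , j)) x∈b

    -- An edge from such a component either ends in `rest`, where the component is closed, or in a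
    -- ball, which base `zero` rules out.
    closed-piece : ∀ j → ClosedIn univ (piece (zero , j))
    closed-piece j {x} {y} x∈ _ e with unattached j x∈
    ... | x∈R , beq , jeq with cover {y} (mem refl)
    ... | inj₁ y∈R = bundle⊆piece k (co⊆bundle k (∈⁺ (inBundle? k) (x∈R , beq , jeq))
                       (co-closed x∈R (co-center x∈R) y∈R e))
      where k = zero , j
    ... | inj₂ (a , y∈a) = contradiction
      (x , y , co-⊇ x∈R (rep-∈ x∈R) (co-center x∈R) , y∈a , e)
      (proj₂ (proj₂ (base? (rep x))) beq a)

    pieces : Pieces f q
    pieces = record
      { label = λ v → proj₁ (label? v)
      ; piece = piece
      ; size  = λ k → ℕ.≤-trans (#-cover {A = hub (proj₁ k)} {bundle k} (∪⁻ _ _))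
                                (ℕ.+-mono-≤ (hub-size (proj₁ k)) (bundle-size k))
      ; own   = λ v → proj₁ (proj₂ (label? v))
      ; kind  = λ { (suc a , j) → inj₁ (ball-conn-piece a j)
                  ; (zero , j)  → inj₂ (closed-piece j , labelled j) }
      }
      where
      labelled : ∀ j {x} → x ∈ piece (zero , j) → proj₁ (label? x) ≡ (zero , j)
      labelled j {x} x∈ =
        let x∈R , beq , jeq = unattached j x∈
        in trans (proj₂ (proj₂ (label? x)) x∈R)
             (cong₂ _,_ beq (Fin.toℕ-injective (trans (Fin.toℕ-fromℕ< (bin< (rep x))) jeq)))

  decompose : ∀ m f → n < f * suc m → Pieces f (suc m)
  decompose m f n<fq = Bundling.pieces n<fq
    (balls m f univ (subst (_< f * suc m) (sym (#-univ n)) n<fq))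

-- Twin classes and the double star

module Classes {n} {I : Set} (test : I → Fin n → Bool) (D m : ℕ) where

  Agree : List I → Fin n → Fin n → Set
  Agree ts u v = All (λ t → test t u ≡ test t v) ts

  InClass : List I → Sub n → Fin n → Fin n → Set
  InClass ts U v w = w ∈ U × Agree ts v w

  inClass? : ∀ ts U v w → Dec (InClass ts U v w)
  inClass? ts U v w = w ∈? U ×-dec All.all? (λ t → test t v Bool.≟ test t w) ts

  classOf : List I → Sub n → Fin n → Sub n
  classOf ts U v = ⟦ inClass? ts U v ⟧

  rare? : ∀ ts U v → Dec (v ∈ U × D * # (classOf ts U v) < m)
  rare? ts U v = v ∈? U ×-dec D * # (classOf ts U v) ℕ.<? m

  rare : List I → Sub n → Sub n
  rare ts U = ⟦ rare? ts U ⟧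

  -- A test halves `U`, and the class of a vertex for the other tests within its half lies in its
  -- class for all tests within `U`; so rare vertices stay rare in their half. With no tests left,
  -- `U` is one class and contributes only if it is below the threshold.
  rare-size : ∀ ts U → D * # (rare ts U) ≤ 2 ^ length ts * m
  rare-size [] U with Fin.any? (_∈? rare [] U)
  ... | no none = ℕ.≤-trans (ℕ.≤-reflexive (trans
        (cong (D *_) (#-empty {A = rare [] U} λ {v} v∈ → none (v , v∈))) (ℕ.*-zeroʳ D))) z≤n
  ... | yes (v , v∈) = ℕ.≤-trans (ℕ.*-monoʳ-≤ D (#-mono {A = rare [] U} {classOf [] U v} sub))
        (ℕ.≤-trans (ℕ.<⇒≤ (proj₂ (∈⁻ (rare? [] U) v∈))) (ℕ.≤-reflexive (sym (ℕ.*-identityˡ m))))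
    where
    sub : rare [] U ⊆ classOf [] U v
    sub w∈ = ∈⁺ (inClass? [] U v) (proj₁ (∈⁻ (rare? [] U) w∈) , [])
  rare-size (t ∷ ts) U = begin
    D * # (rare (t ∷ ts) U)                             ≤⟨ ℕ.*-monoʳ-≤ D (#-cover {C = rare (t ∷ ts) U} cover) ⟩
    D * (# (rare ts (half true)) + # (rare ts (half false)))
      ≡⟨ ℕ.*-distribˡ-+ D (# (rare ts (half true))) _ ⟩
    D * # (rare ts (half true)) + D * # (rare ts (half false))
      ≤⟨ ℕ.+-mono-≤ (rare-size ts (half true)) (rare-size ts (half false)) ⟩
    2 ^ length ts * m + 2 ^ length ts * m               ≡⟨ double (2 ^ length ts) m ⟩
    2 ^ suc (length ts) * m ∎
    where
    open ℕ.≤-Reasoning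
    double : ∀ a b → a * b + a * b ≡ (a + (a + 0)) * b
    double = solve-∀
    half? : ∀ b v → Dec (v ∈ U × test t v ≡ b)
    half? b v = v ∈? U ×-dec test t v Bool.≟ b
    half : Bool → Sub n
    half b = ⟦ half? b ⟧
    descend : ∀ {v} b → test t v ≡ b → v ∈ rare (t ∷ ts) U → v ∈ rare ts (half b)
    descend {v} b eq v∈ =
      let v∈U , small = ∈⁻ (rare? (t ∷ ts) U) v∈
      in ∈⁺ (rare? ts (half b)) (∈⁺ (half? b) (v∈U , eq) ,
           ℕ.≤-<-trans (ℕ.*-monoʳ-≤ D (#-mono {A = classOf ts (half b) v} λ w∈ →
             let w∈h , agree = ∈⁻ (inClass? ts (half b) v) w∈
                 w∈U , weq = ∈⁻ (half? b) w∈h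
             in ∈⁺ (inClass? (t ∷ ts) U v) (w∈U , trans eq (sym weq) ∷ agree))) small)
    cover : ∀ {v} → v ∈ rare (t ∷ ts) U → v ∈ rare ts (half true) ⊎ v ∈ rare ts (half false)
    cover {v} v∈ with test t v in eq
    ... | true  = inj₁ (descend true eq v∈)
    ... | false = inj₂ (descend false eq v∈)

2xy≤x²+y² : ∀ x y → 2 * (x * y) ≤ x * x + y * y
2xy≤x²+y² x y with ℕ.≤-total x y
... | inj₁ x≤y = go x y x≤y
  where
  go : ∀ x y → x ≤ y → 2 * (x * y) ≤ x * x + y * y
  go x y x≤y with ℕ.m≤n⇒∃[o]m+o≡n x≤y
  ... | k , refl = ℕ.≤-trans (ℕ.m≤m+n _ (k * k)) (ℕ.≤-reflexive (expand x k))
    where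
    expand : ∀ x k → 2 * (x * (x + k)) + k * k ≡ x * x + (x + k) * (x + k)
    expand = solve-∀
... | inj₂ y≤x with ℕ.m≤n⇒∃[o]m+o≡n y≤x
... | k , refl = ℕ.≤-trans (ℕ.m≤m+n _ (k * k)) (ℕ.≤-reflexive (expand y k))
    where
    expand : ∀ y k → 2 * ((y + k) * y) + k * k ≡ (y + k) * (y + k) + y * y
    expand = solve-∀

module _ {n} (A : Sub n) (d : Fin n → ℕ) (supp : ∀ u → 1 ≤ d u → u ∈ A) where
  private
    S Q : ℕ
    S = sum d
    Q = sum (λ u → d u * d u)

    vanish : ∀ u → u ∉ A → d u ≡ 0
    vanish u u∉ = ℕ.n<1⇒n≡0 (ℕ.≰⇒> λ h → u∉ (supp u h))

    -- The sum of `2xd ≤ d² + x²` over the support. The optimal `x` is the mean of `d`, which need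
    -- not be a natural number; `cauchy-schwarz` takes `x = d u` instead and sums over `u`, which
    -- avoids division.
    tangent : ∀ x → 2 * (x * S) ≤ Q + # A * (x * x)
    tangent x = begin
      2 * (x * S)                                ≡⟨ cong (2 *_) (*-distribˡ-sum x d) ⟩
      2 * sum (λ u → x * d u)                    ≡⟨ *-distribˡ-sum 2 (λ u → x * d u) ⟩
      sum (λ u → 2 * (x * d u))                  ≤⟨ sum-mono-≤ pointwise ⟩
      sum (λ u → d u * d u + χ (A u) * (x * x))  ≡⟨ ∑-distrib-+ (λ u → d u * d u) (λ u → χ (A u) * (x * x)) ⟩
      Q + sum (λ u → χ (A u) * (x * x))          ≡⟨ cong (λ z → Q + z) (*-distribʳ-sum (x * x) (χ ∘ A)) ⟨
      Q + # A * (x * x)                          ∎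
      where
      open ℕ.≤-Reasoning
      pointwise : ∀ u → 2 * (x * d u) ≤ d u * d u + χ (A u) * (x * x)
      pointwise u with u ∈? A
      ... | yes u∈ rewrite χ-∈ {A = A} u∈ | ℕ.+-identityʳ (x * x) =
        ℕ.≤-trans (2xy≤x²+y² x (d u)) (ℕ.≤-reflexive (ℕ.+-comm (x * x) _))
      ... | no u∉ rewrite vanish u u∉ | ℕ.*-zeroʳ x = z≤n

  cauchy-schwarz : sum d * sum d ≤ # A * sum (λ u → d u * d u)
  cauchy-schwarz = ℕ.*-cancelˡ-≤ 2 (begin
    2 * (S * S)                                ≡⟨ cong (2 *_) (*-distribʳ-sum S d) ⟩
    2 * sum (λ u → d u * S)                    ≡⟨ *-distribˡ-sum 2 (λ u → d u * S) ⟩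
    sum (λ u → 2 * (d u * S))                  ≤⟨ sum-mono-≤ pointwise ⟩
    sum (λ u → χ (A u) * Q + # A * (d u * d u))
      ≡⟨ ∑-distrib-+ (λ u → χ (A u) * Q) (λ u → # A * (d u * d u)) ⟩
    sum (λ u → χ (A u) * Q) + sum (λ u → # A * (d u * d u))
      ≡⟨ cong₂ _+_ (*-distribʳ-sum Q (χ ∘ A)) (*-distribˡ-sum (# A) (λ u → d u * d u)) ⟨
    # A * Q + # A * Q                          ≡⟨ cong (λ z → # A * Q + z) (ℕ.+-identityʳ _) ⟨
    2 * (# A * Q)                              ∎)
    where
    open ℕ.≤-Reasoning
    pointwise : ∀ u → 2 * (d u * S) ≤ χ (A u) * Q + # A * (d u * d u)
    pointwise u with u ∈? A
    ... | yes u∈ rewrite χ-∈ {A = A} u∈ | ℕ.+-identityʳ Q = tangent (d u)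
    ... | no u∉ rewrite vanish u u∉ = z≤n

pigeonhole : ∀ {s m} (f : Fin s → ℕ) → 1 ≤ m → m ≤ sum f → ∃ λ i → m ≤ s * f i
pigeonhole {zero} f 1≤m m≤0 = contradiction (ℕ.≤-trans 1≤m m≤0) λ ()
pigeonhole {s@(suc _)} {suc m} f _ h with Fin.any? (λ i → suc m ℕ.≤? s * f i)
... | yes p = p
... | no ¬p = contradiction h (ℕ.<⇒≱ (s≤s (ℕ.*-cancelˡ-≤ s (begin
    s * sum f               ≡⟨ *-distribˡ-sum s f ⟩
    sum (λ i → s * f i)     ≤⟨ sum-mono-≤ (λ i → s≤s⁻¹ (ℕ.≰⇒> λ q → ¬p (i , q))) ⟩
    sum {s} (λ _ → m)       ≡⟨ sum-const s m ⟩
    s * m ∎))))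
    where open ℕ.≤-Reasoning

module DoubleStar {n s} (A B : Sub n) (F : Fin s → Fin n → Fin n → Set)
                  (F? : ∀ i u w → Dec (F i u w))
                  (complete : ∀ {u w} → u ∈ A → w ∈ B → ∃ λ i → F i u w) where

  forward? : ∀ i u w → Dec (w ∈ B × F i u w)
  forward? i u w = w ∈? B ×-dec F? i u w

  backward? : ∀ i w u → Dec (u ∈ A × F i u w)
  backward? i w u = u ∈? A ×-dec F? i u w

  forward backward : Fin s → Fin n → Sub n
  forward i u  = ⟦ forward? i u ⟧
  backward i w = ⟦ backward? i w ⟧

  private
    edge? : ∀ i u w → Dec (u ∈ A × w ∈ B × F i u w)
    edge? i u w = u ∈? A ×-dec w ∈? B ×-dec F? i u w

    edge : Fin s → Fin n → Sub n
    edge i u = ⟦ edge? i u ⟧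

    ε : Fin s → Fin n → Fin n → ℕ
    ε i u w = χ (edge i u w)

    dᴬ dᴮ : Fin s → Fin n → ℕ
    dᴬ i u = sum (λ w → ε i u w)
    dᴮ i w = sum (λ u → ε i u w)

    size : Fin s → ℕ
    size i = sum (dᴬ i)

    size-comm : ∀ i → size i ≡ sum (dᴮ i)
    size-comm i = ∑-comm (ε i)

    total : # A * # B ≤ sum size
    total = begin
      # A * # B                               ≡⟨ *-distribʳ-sum (# B) (χ ∘ A) ⟩
      sum (λ u → χ (A u) * # B)               ≡⟨ sum-cong-≗ (λ u → *-distribˡ-sum (χ (A u)) (χ ∘ B)) ⟩
      sum (λ u → sum λ w → χ (A u) * χ (B w)) ≤⟨ sum-mono-≤ (λ u → sum-mono-≤ λ w → pointwise u w) ⟩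
      sum (λ u → sum λ w → sum λ i → ε i u w) ≡⟨ sum-cong-≗ (λ u → ∑-comm λ w i → ε i u w) ⟩
      sum (λ u → sum λ i → dᴬ i u)            ≡⟨ ∑-comm (λ u i → dᴬ i u) ⟩
      sum size ∎
      where
      open ℕ.≤-Reasoning
      pointwise : ∀ u w → χ (A u) * χ (B w) ≤ sum λ i → ε i u w
      pointwise u w with u ∈? A | w ∈? B
      ... | no u∉ | _ = ℕ.≤-trans (ℕ.*-monoˡ-≤ (χ (B w)) (χ-≤ A u {0} λ u∈ → contradiction u∈ u∉)) z≤n
      ... | yes _ | no w∉ = ℕ.≤-trans (ℕ.*-monoʳ-≤ (χ (A u)) (χ-≤ B w {0} λ w∈ → contradiction w∈ w∉))
            (ℕ.≤-trans (ℕ.≤-reflexive (ℕ.*-zeroʳ (χ (A u)))) z≤n)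
      ... | yes u∈ | yes w∈ =
        let i , e = complete u∈ w∈
        in ℕ.≤-trans (ℕ.*-mono-≤ (χ≤1 (A u)) (χ≤1 (B w)))
             (ℕ.≤-trans (ℕ.≤-reflexive (sym (χ-∈ {A = edge i u} (∈⁺ (edge? i u) (u∈ , w∈ , e)))))
               (term≤sum (λ i → ε i u w) i))

    dᴬ≤ : ∀ i u → dᴬ i u ≤ # (forward i u)
    dᴬ≤ i u = #-mono {A = edge i u} λ w∈ → ∈⁺ (forward? i u) (proj₂ (∈⁻ (edge? i u) w∈))

    dᴮ≤ : ∀ i w → dᴮ i w ≤ # (backward i w)
    dᴮ≤ i w = sum-mono-≤ λ u → χ-≤ (edge i u) w λ w∈ →
      let u∈ , _ , e = ∈⁻ (edge? i u) w∈
      in ℕ.≤-reflexive (sym (χ-∈ {A = backward i w} (∈⁺ (backward? i w) (u∈ , e))))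

    suppᴬ : ∀ i u → 1 ≤ dᴬ i u → u ∈ A
    suppᴬ i u h = let w , w∈ = #>0⇒∃ (edge i u) h in proj₁ (∈⁻ (edge? i u) w∈)

    suppᴮ : ∀ i w → 1 ≤ dᴮ i w → w ∈ B
    suppᴮ i w h = let u , u∈ = #>0⇒∃ (λ u → edge i u w) h
                  in proj₁ (proj₂ (∈⁻ (edge? i u) (mem (_∈_.holds u∈))))

    -- If every one of the `e` edges had `s (d(u) + d(w)) < a + b`, summing over the edges would
    -- give the negated inequality. Multiplied by `ab` it contradicts `ab ≤ se` and the two
    -- Cauchy-Schwarz bounds. The summand `e`, one unit per edge from the strictness, makes the
    -- contradiction strict.
    arith : ∀ s a b e Qa Qb → 1 ≤ a * b → a * b ≤ s * e → e * e ≤ a * Qa → e * e ≤ b * Qb →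
            ¬ s * (Qa + Qb) + e ≤ e * (a + b)
    arith s a b e Qa Qb ab≥1 ab≤se ca cb h = ℕ.<-irrefl refl (begin-strict
      a * b * (e * (a + b))                                    ≤⟨ ℕ.*-monoˡ-≤ (e * (a + b)) ab≤se ⟩
      s * e * (e * (a + b))                                    ≡⟨ lem₁ s a b e ⟩
      s * (b * (e * e) + a * (e * e))                          <⟨ ℕ.m<m+n _ (ℕ.*-mono-≤ ab≥1 e≥1) ⟩
      s * (b * (e * e) + a * (e * e)) + a * b * e              ≤⟨ ℕ.+-monoˡ-≤ (a * b * e) (ℕ.*-monoʳ-≤ s
        (ℕ.+-mono-≤ (ℕ.*-monoʳ-≤ b ca) (ℕ.*-monoʳ-≤ a cb))) ⟩
      s * (b * (a * Qa) + a * (b * Qb)) + a * b * e            ≡⟨ lem₂ s a b e Qa Qb ⟩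
      a * b * (s * (Qa + Qb) + e)                              ≤⟨ ℕ.*-monoʳ-≤ (a * b) h ⟩
      a * b * (e * (a + b))                                    ∎)
      where
      open ℕ.≤-Reasoning
      positive : ∀ e → a * b ≤ s * e → 1 ≤ e
      positive zero    p = contradiction (ℕ.≤-trans ab≥1 (ℕ.≤-trans p (ℕ.≤-reflexive (ℕ.*-zeroʳ s)))) λ ()
      positive (suc _) _ = s≤s z≤n
      e≥1 : 1 ≤ e
      e≥1 = positive e ab≤se
      lem₁ : ∀ s a b e → s * e * (e * (a + b)) ≡ s * (b * (e * e) + a * (e * e))
      lem₁ = solve-∀
      lem₂ : ∀ s a b e x y → s * (b * (a * x) + a * (b * y)) + a * b * e ≡ a * b * (s * (x + y) + e)
      lem₂ = solve-∀

  -- The average of d(u) + d(w) over the edges uw of the most frequent colour is large by Cauchy-Schwarz.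
  doubleStar : 1 ≤ # A * # B → ∃ λ i → ∃₂ λ u w → u ∈ A × w ∈ B × F i u w ×
               # A + # B ≤ s * (# (forward i u) + # (backward i w))
  doubleStar ab≥1 with pigeonhole size ab≥1 total
  ... | i , ab≤se with Fin.any? (λ u → Fin.any? (λ w →
        edge? i u w ×-dec # A + # B ℕ.≤? s * (dᴬ i u + dᴮ i w)))
  ... | yes (u , w , (u∈ , w∈ , e) , h) = i , u , w , u∈ , w∈ , e ,
        ℕ.≤-trans h (ℕ.*-monoʳ-≤ s (ℕ.+-mono-≤ (dᴬ≤ i u) (dᴮ≤ i w)))
  ... | no none = contradiction averaged (arith s (# A) (# B) (size i) Qa Qb ab≥1 ab≤se
        (cauchy-schwarz A (dᴬ i) (suppᴬ i))
        (subst (λ z → z * z ≤ # B * Qb) (sym (size-comm i)) (cauchy-schwarz B (dᴮ i) (suppᴮ i))))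
    where
    open ℕ.≤-Reasoning
    Qa Qb : ℕ
    Qa = sum (λ u → dᴬ i u * dᴬ i u)
    Qb = sum (λ w → dᴮ i w * dᴮ i w)
    weigh : ∀ {P : Set} (P? : Dec P) x y N → (P → suc (s * (x + y)) ≤ N) →
            χ (does P?) * (s * x) + χ (does P?) * (s * y) + χ (does P?) ≤ χ (does P?) * N
    weigh (no _)  x y N h = z≤n
    weigh (yes p) x y N h = begin
      1 * (s * x) + 1 * (s * y) + 1 ≡⟨ lem s x y ⟩
      suc (s * (x + y))             ≤⟨ h p ⟩
      N                             ≡⟨ ℕ.*-identityˡ N ⟨
      1 * N                         ∎
      where
      lem : ∀ s x y → 1 * (s * x) + 1 * (s * y) + 1 ≡ suc (s * (x + y))
      lem = solve-∀
    light : ∀ u w → ε i u w * (s * dᴬ i u) + ε i u w * (s * dᴮ i w) + ε i u w ≤ ε i u w * (# A + # B)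
    light u w = weigh (edge? i u w) (dᴬ i u) (dᴮ i w) (# A + # B)
      λ p → ℕ.≰⇒> λ q → none (u , w , p , q)
    -- A vertex `u` lies on `sum (a u)` edges, so adding up its degree over all edges gives a sum of
    -- squares of degrees.
    out : ∀ (a : Fin n → Fin n → ℕ) (g : Fin n → ℕ) →
          sum (λ u → sum λ w → a u w * (s * g u)) ≡ s * sum (λ u → sum (a u) * g u)
    out a g = trans (sum-cong-≗ λ u → trans (sym (*-distribʳ-sum (s * g u) (a u))) (lem (sum (a u)) s (g u)))
                    (sym (*-distribˡ-sum s (λ u → sum (a u) * g u)))
      where
      lem : ∀ a s g → a * (s * g) ≡ s * (a * g)
      lem = solve-∀
    averaged : s * (Qa + Qb) + size i ≤ size i * (# A + # B)
    averaged = begin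
      s * (Qa + Qb) + size i
        ≡⟨ cong (_+ size i) (ℕ.*-distribˡ-+ s Qa Qb) ⟩
      s * Qa + s * Qb + size i
        ≡⟨ cong₂ (λ x y → x + y + size i) (out (ε i) (dᴬ i)) (trans (∑-comm λ u w → ε i u w * (s * dᴮ i w)) (out (flip (ε i)) (dᴮ i))) ⟨
      sum (λ u → sum λ w → ε i u w * (s * dᴬ i u)) + sum (λ u → sum λ w → ε i u w * (s * dᴮ i w)) + size i
        ≡⟨ cong (_+ size i) (∑-distrib-+ (λ u → sum λ w → ε i u w * (s * dᴬ i u)) (λ u → sum λ w → ε i u w * (s * dᴮ i w))) ⟨
      sum (λ u → sum (λ w → ε i u w * (s * dᴬ i u)) + sum (λ w → ε i u w * (s * dᴮ i w))) + size i
        ≡⟨ ∑-distrib-+ (λ u → sum (λ w → ε i u w * (s * dᴬ i u)) + sum (λ w → ε i u w * (s * dᴮ i w))) (dᴬ i) ⟨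
      sum (λ u → sum (λ w → ε i u w * (s * dᴬ i u)) + sum (λ w → ε i u w * (s * dᴮ i w)) + dᴬ i u)
        ≡⟨ sum-cong-≗ (λ u → trans
             (∑-distrib-+ (λ w → ε i u w * (s * dᴬ i u) + ε i u w * (s * dᴮ i w)) (ε i u))
             (cong (_+ dᴬ i u) (∑-distrib-+ (λ w → ε i u w * (s * dᴬ i u)) (λ w → ε i u w * (s * dᴮ i w))))) ⟨
      sum (λ u → sum λ w → ε i u w * (s * dᴬ i u) + ε i u w * (s * dᴮ i w) + ε i u w)
        ≤⟨ sum-mono-≤ (λ u → sum-mono-≤ (light u)) ⟩
      sum (λ u → sum λ w → ε i u w * (# A + # B))
        ≡⟨ sum-cong-≗ (λ u → *-distribʳ-sum (# A + # B) (ε i u)) ⟨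
      sum (λ u → dᴬ i u * (# A + # B))
        ≡⟨ *-distribʳ-sum (# A + # B) (dᴬ i) ⟨
      size i * (# A + # B) ∎

-- Colourings without sparse holes

-- Pieces have order at most 3q with q about n / scale, so that the two pieces forming a core cost at most
-- a fraction 1 / (2 (d₁ + 1)) of the n / s leaves.
scale : (s d₁ : ℕ) → ℕ
scale s d₁ = 12 * (suc d₁ * s)

-- With `q` the integer part of `n / scale` and `n ≥ scale`, the product of `q` and `2 * scale`
-- exceeds `n`. This is the number of balls and of bins in each colour.
labelBound : (s d₁ : ℕ) → ℕ
labelBound s d₁ = 2 * scale s d₁

-- The Boolean selects the question put to a vertex about a colour and a piece: whether the piece is
-- its own, or whether it is near that piece.
Test : ℕ → ℕ → Set
Test s f = Bool × Fin (suc s) × Fin (suc f) × Fin f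

tests : ∀ s f → List (Test s f)
tests s f = List.cartesianProduct (true ∷ false ∷ []) (List.cartesianProduct (List.allFin (suc s))
  (List.cartesianProduct (List.allFin (suc f)) (List.allFin f)))

tests-complete : ∀ s f t → t ∈ᴸ tests s f
tests-complete s f (b , i , x , y) =
  ∈-cartesianProduct⁺ (bool b) (∈-cartesianProduct⁺ (∈-allFin i) (∈-cartesianProduct⁺ (∈-allFin x) (∈-allFin y)))
  where
  bool : ∀ b → b ∈ᴸ true ∷ false ∷ []
  bool true  = here refl
  bool false = there (here refl)

-- There are at most 2 ^ #tests classes, so those of order below n / density cover at most n / (2 (d₁ + 1))
-- vertices.
density : (s d₁ : ℕ) → ℕ
density s d₁ = 2 ^ length (tests s (labelBound s d₁)) * (2 * suc d₁)

-- The sets may overlap or coincide: the property is applied to two classes that can be the same.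
NoHole : ℕ → ∀ {n} → (Fin n → Fin n → Set) → Set
NoHole D {n} E = ∀ A B → n ≤ D * # A → n ≤ D * # B → ∃₂ λ u v → u ∈ A × v ∈ B × E u v

-- Both `v` and `b` are at most `n / (2d)`, and `d ≥ 2`, so together they fall short of `n`.
few-null-arith : ∀ d₂ s q v b {n} → 1 ≤ n → 12 * (suc (suc d₂) * s) * q ≤ n → 2 * suc (suc d₂) * b ≤ n →
  v ≤ s * (q + (q + q) + (q + (q + q))) → v + b ≡ n → ⊥
few-null-arith d₂ s q v b {n} n≥1 q-small b-small v≤ eq = ℕ.<-irrefl refl (begin-strict
  2 * n                             ≤⟨ ℕ.*-monoˡ-≤ n {2} {d} (s≤s (s≤s z≤n)) ⟩
  d * n                             <⟨ ℕ.m<m+n (d * n) (ℕ.*-mono-≤ {1} {d} (s≤s z≤n) n≥1) ⟩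
  d * n + d * n                     ≡⟨ cong (λ z → d * z + d * z) eq ⟨
  d * (v + b) + d * (v + b)         ≡⟨ lem d v b ⟩
  2 * d * v + 2 * d * b             ≤⟨ ℕ.+-mono-≤ (ℕ.*-monoʳ-≤ (2 * d) v≤) b-small ⟩
  2 * d * (s * (q + (q + q) + (q + (q + q)))) + n ≡⟨ lem₂ d s q n ⟩
  12 * (d * s) * q + n              ≤⟨ ℕ.+-monoˡ-≤ n q-small ⟩
  n + n                             ≡⟨ cong (λ z → n + z) (ℕ.+-identityʳ n) ⟨
  2 * n                             ∎)
  where
  open ℕ.≤-Reasoning
  d : ℕ
  d = suc (suc d₂)
  lem : ∀ d v b → d * (v + b) + d * (v + b) ≡ 2 * d * v + 2 * d * b
  lem = solve-∀
  lem₂ : ∀ d s q n → 2 * d * (s * (q + (q + q) + (q + (q + q)))) + n ≡ 12 * (d * s) * q + n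
  lem₂ = solve-∀

good-big-arith : ∀ d₁ g b {n} → 2 * suc d₁ * b ≤ n → g + b ≡ n → d₁ * n ≤ suc d₁ * g
good-big-arith d₁ g b {n} b-small eq = ℕ.+-cancelʳ-≤ n (d₁ * n) (suc d₁ * g) (begin
  d₁ * n + n                      ≡⟨ ℕ.+-comm (d₁ * n) n ⟩
  suc d₁ * n                      ≡⟨ cong (suc d₁ *_) eq ⟨
  suc d₁ * (g + b)                ≡⟨ ℕ.*-distribˡ-+ (suc d₁) g b ⟩
  suc d₁ * g + suc d₁ * b         ≤⟨ ℕ.+-monoʳ-≤ (suc d₁ * g) (ℕ.*-monoˡ-≤ b (ℕ.m≤n*m (suc d₁) 2)) ⟩
  suc d₁ * g + 2 * suc d₁ * b     ≤⟨ ℕ.+-monoʳ-≤ (suc d₁ * g) b-small ⟩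
  suc d₁ * g + n ∎)
  where open ℕ.≤-Reasoning

-- The loss allowed is `n / d`: half of it pays for the bad vertices, the other half for `s` times
-- the `6q` vertices of the core.
leaves-large-arith : ∀ d₁ s q g b l {n} → 12 * (suc d₁ * s) * q ≤ n → 2 * suc d₁ * b ≤ n → g + b ≡ n →
  g ≤ s * (l + (q + (q + q) + (q + (q + q)))) → d₁ * n ≤ suc d₁ * (s * l)
leaves-large-arith d₁ s q g b l {n} q-small b-small eq g≤ =
  ℕ.*-cancelˡ-≤ 2 (ℕ.+-cancelʳ-≤ (n + n) (2 * (d₁ * n)) (2 * (suc d₁ * (s * l))) (begin
    2 * (d₁ * n) + (n + n)                               ≡⟨ lem₁ d₁ n ⟩
    2 * suc d₁ * n                                       ≡⟨ cong (2 * suc d₁ *_) eq ⟨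
    2 * suc d₁ * (g + b)                                 ≡⟨ ℕ.*-distribˡ-+ (2 * suc d₁) g b ⟩
    2 * suc d₁ * g + 2 * suc d₁ * b
      ≤⟨ ℕ.+-mono-≤ (ℕ.*-monoʳ-≤ (2 * suc d₁) g≤) b-small ⟩
    2 * suc d₁ * (s * (l + (q + (q + q) + (q + (q + q))))) + n
      ≡⟨ lem₂ (suc d₁) s l q n ⟩
    2 * (suc d₁ * (s * l)) + (12 * (suc d₁ * s) * q + n)
      ≤⟨ ℕ.+-monoʳ-≤ (2 * (suc d₁ * (s * l))) (ℕ.+-monoˡ-≤ n q-small) ⟩
    2 * (suc d₁ * (s * l)) + (n + n) ∎))
  where
  open ℕ.≤-Reasoning
  lem₁ : ∀ d₁ n → 2 * (d₁ * n) + (n + n) ≡ 2 * suc d₁ * n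
  lem₁ = solve-∀
  lem₂ : ∀ d s l q n → 2 * d * (s * (l + (q + (q + q) + (q + (q + q))))) + n
                     ≡ 2 * (d * (s * l)) + (12 * (d * s) * q + n)
  lem₂ = solve-∀

-- In the notation of the theorem, s = r - 1 and d₁ / d = 1 - Star.ε.
module Deterministic {n s : ℕ} (d₂ : ℕ) (s≥1 : 1 ≤ s)
  (E : Fin (suc s) → Fin n → Fin n → Set) (E? : ∀ i u v → Dec (E i u v))
  (E-sym : ∀ i {u v} → E i u v → E i v u) where

  d₁ d f D : ℕ
  d₁ = suc d₂
  d  = suc d₁
  f  = labelBound s d₁
  D  = density s d₁

  open module G i = Growth (E i) (E? i) (E-sym i) using
    (Conn; Path; ClosedIn; component; path-mono; path-sym; path-closed; conn-from)
  open module P i = Decomposition (E i) (E? i) (E-sym i) using (Pieces; decompose)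

  -- The data from which a tree is built: a spanning tree of `core`, with each vertex of `leaves`
  -- hung on a single neighbour in `core`. The two cases of `large` are the two outcomes of the
  -- theorem.
  record Broom : Set where
    field
      color     : Fin (suc s)
      core      : Sub n
      leaves    : Sub n
      center    : ∃ λ v → v ∈ core
      connected : Conn color core
      outside   : ∀ {v} → v ∈ leaves → v ∉ core
      attached  : ∀ {v} → v ∈ leaves → ∃ λ x → x ∈ core × E color x v
      large     : d₁ * n ≤ d * # core ⊎ d₁ * n ≤ d * (s * # leaves)

  module _ (n≥1 : 1 ≤ n) (m : ℕ) (q-small : scale s d₁ * suc m ≤ n) (n<fq : n < f * suc m)
           (dense : NoHole D λ u v → ∃ λ i → E i u v) where

    q : ℕ
    q = suc m

    abstract
      pieces : ∀ i → Pieces i f q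
      pieces i = decompose i m f n<fq

    Lab : Set
    Lab = Fin (suc f) × Fin f

    ℓ : Fin (suc s) → Fin n → Lab
    ℓ i = P.Pieces.label (pieces i)

    pc : Fin (suc s) → Lab → Sub n
    pc i = P.Pieces.piece (pieces i)

    own : ∀ i v → v ∈ pc i (ℓ i v)
    own i = P.Pieces.own (pieces i)

    Null : Fin (suc s) → Lab → Set
    Null i k = ClosedIn i univ (pc i k) × (∀ {x} → x ∈ pc i k → ℓ i x ≡ k)

    kind : ∀ i k → Conn i (pc i k) ⊎ Null i k
    kind i = P.Pieces.kind (pieces i)

    pc-size : ∀ i k → # (pc i k) ≤ q + (q + q)
    pc-size i = P.Pieces.size (pieces i)

    Near : Fin (suc s) → Lab → Fin n → Set
    Near i k w = ∃ λ x → x ∈ pc i k × (x ≡ w ⊎ E i x w)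

    near? : ∀ i k w → Dec (Near i k w)
    near? i k w = Fin.any? (λ x → x ∈? pc i k ×-dec (x Fin.≟ w ⊎-dec E? i x w))

    _≟ᴸ_ : (k k′ : Lab) → Dec (k ≡ k′)
    _≟ᴸ_ = Product.≡-dec Fin._≟_ Fin._≟_

    test : Test s f → Fin n → Bool
    test (true  , i , k) v = does (ℓ i v ≟ᴸ k)
    test (false , i , k) v = does (near? i k v)

    open Classes test D n

    ts : List (Test s f)
    ts = tests s f

    class : Fin n → Sub n
    class = classOf ts univ

    same-label : ∀ i {u x} → x ∈ class u → ℓ i x ≡ ℓ i u
    same-label i {u} {x} x∈ = ∈⁻ (λ y → ℓ i y ≟ᴸ ℓ i u) (mem (trans
      (sym (All.lookup (proj₂ (∈⁻ (inClass? ts univ u) x∈)) (tests-complete s f (true , i , ℓ i u))))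
      (_∈_.holds (∈⁺ (λ y → ℓ i y ≟ᴸ ℓ i u) refl))))

    same-near : ∀ i k {u x} → x ∈ class u → Near i k x → Near i k u
    same-near i k {u} {x} x∈ near = ∈⁻ (near? i k) (mem (trans
      (All.lookup (proj₂ (∈⁻ (inClass? ts univ u) x∈)) (tests-complete s f (false , i , k)))
      (_∈_.holds (∈⁺ (near? i k) near))))

    abstract
      bad good : Sub n
      bad  = rare ts univ
      good = univ ─ bad

      bad-size : 2 * d * # bad ≤ n
      bad-size = ℕ.*-cancelˡ-≤ (2 ^ length ts) {{ℕ.m^n≢0 2 (length ts)}} (ℕ.≤-trans
        (ℕ.≤-reflexive (sym (ℕ.*-assoc (2 ^ length ts) (2 * d) (# bad)))) (rare-size ts univ))

      good+bad : # good + # bad ≡ n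
      good+bad = trans (#-split univ bad λ _ → mem refl) (#-univ n)

      good-common : ∀ {v} → v ∈ good → n ≤ D * # (class v)
      good-common {v} v∈ = ℕ.≮⇒≥ λ small →
        proj₂ (─⁻ univ bad v∈) (∈⁺ (rare? ts univ) (mem refl , small))

    Rel : Fin (suc s) → Fin n → Fin n → Set
    Rel i u w = Near i (ℓ i u) w × Near i (ℓ i w) u

    rel? : ∀ i u w → Dec (Rel i u w)
    rel? i u w = near? i (ℓ i u) w ×-dec near? i (ℓ i w) u

    -- Whether the edge xy makes y near the piece of x depends only on the classes of x and y.
    complete : ∀ {u w} → u ∈ good → w ∈ good → ∃ λ i → Rel i u w
    complete {u} {w} u∈ w∈ with dense (class u) (class w) (good-common u∈) (good-common w∈)
    ... | x , y , x∈ , y∈ , i , e =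
      i , same-near i _ y∈ (subst (λ k → Near i k y) (same-label i x∈) (x , own i x , inj₂ e))
        , same-near i _ x∈ (subst (λ k → Near i k x) (same-label i y∈) (y , own i y , inj₂ (E-sym i e)))

    near-null : ∀ {i k w} → Null i k → Near i k w → w ∈ pc i k
    near-null (closed , _) (x , x∈ , inj₁ refl) = x∈
    near-null (closed , _) (x , x∈ , inj₂ e)    = closed x∈ (mem refl) e

    near-path : ∀ {i u w} → Conn i (pc i (ℓ i u)) → Near i (ℓ i u) w → Path i univ u w
    near-path {i} {u} conn (x , x∈ , xw) = path-mono i (λ _ → mem refl) (conn (own i u) x∈) ◅◅ last xw
      where
      last : ∀ {w} → x ≡ w ⊎ E i x w → Path i univ x w
      last (inj₁ refl) = Star.ε
      last (inj₂ e)    = (mem refl , mem refl , e) ◅ Star.ε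

    -- Disposes of the degenerate cases, with `v` the number of good vertices: neither one small
    -- side nor a double star inside a null piece can account for them.
    few-null : ∀ {v} → v ≤ s * (q + (q + q) + (q + (q + q))) → v + # bad ≡ n → ⊥
    few-null {v} = few-null-arith d₂ s q v (# bad) n≥1 q-small bad-size

    s*-mono : ∀ {v x} → v ≤ x → v ≤ s * x
    s*-mono {v} {x} h = ℕ.≤-trans h (ℕ.≤-trans (ℕ.≤-reflexive (sym (ℕ.*-identityˡ x))) (ℕ.*-monoˡ-≤ x s≥1))

    good-big : d₁ * n ≤ d * # good
    good-big = good-big-arith d₁ (# good) (# bad) bad-size good+bad

    -- A set that the first colour cannot leave, in the sense of `Rel` and not only of edges, since
    -- it is `Rel` that colours the pairs across the cut.
    record Side : Set where
      field
        side   : Sub n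
        start  : ∃ λ v → v ∈ side × v ∈ good
        closed : ∀ {u w} → u ∈ side → Rel zero u w → w ∈ side
        kinds  : Conn zero side ⊎ # side ≤ q + (q + q)

    good≥1 : 1 ≤ # good
    good≥1 = ℕ.n≢0⇒n>0 λ eq → few-null z≤n (trans (cong (_+ # bad) (sym eq)) good+bad)

    side-of : ∀ {v₀} → v₀ ∈ good → Conn zero (pc zero (ℓ zero v₀)) ⊎ Null zero (ℓ zero v₀) → Side
    side-of {v₀} v₀∈ (inj₂ null) = record
      { side = pc zero (ℓ zero v₀) ; start = v₀ , own zero v₀ , v₀∈
      ; closed = λ {u} {w} u∈ r →
          near-null null (subst (λ k → Near zero k w) (proj₂ null u∈) (proj₁ r))
      ; kinds = inj₂ (pc-size zero (ℓ zero v₀)) }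
    side-of {v₀} v₀∈ (inj₁ conn₀) = fromComponent (component zero {univ} {v₀} (mem refl))
      where
      fromComponent : (∃ λ C → Conn zero C × v₀ ∈ C × C ⊆ univ × ClosedIn zero univ C) → Side
      fromComponent (C , conn , v₀∈C , _ , closedC) = record
        { side = C ; start = v₀ , v₀∈C , v₀∈
        ; closed = λ {u} u∈ r → closed u∈ (proj₁ r) (kind zero (ℓ zero u)) ; kinds = inj₁ conn }
        where
        closed : ∀ {u w} → u ∈ C → Near zero (ℓ zero u) w →
                 Conn zero (pc zero (ℓ zero u)) ⊎ Null zero (ℓ zero u) → w ∈ C
        closed u∈ near (inj₁ conn-u) = path-closed zero closedC (near-path conn-u near) u∈
        -- A null piece that meets the component of `v₀` contains `v₀`, so it is the piece of `v₀`,
        -- and that one is connected by assumption.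
        closed {u} {w} u∈ near (inj₂ (closed-u , fiber)) = path-closed zero closedC
          (near-path conn₀ (subst (λ k → Near zero k w) (sym (fiber v₀∈piece)) near)) v₀∈C
          where
          v₀∈piece : v₀ ∈ pc zero (ℓ zero u)
          v₀∈piece = path-closed zero closed-u (path-mono zero (λ _ → mem refl) (conn u∈ v₀∈C)) (own zero u)

    abstract
      findSide : Side
      findSide = let v₀ , v₀∈ = #>0⇒∃ good good≥1 in side-of v₀∈ (kind zero (ℓ zero v₀))

    open Side findSide

    abstract
      A B : Sub n
      B = good ─ side
      A = good ─ B

      B⁻ : ∀ {v} → v ∈ B → v ∈ good × v ∉ side
      B⁻ = ─⁻ good side

      B⁺ : ∀ {v} → v ∈ good → v ∉ side → v ∈ B
      B⁺ = ─⁺ good side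

      A⁻ : ∀ {v} → v ∈ A → v ∈ good × v ∉ B
      A⁻ = ─⁻ good B

      A⁺ : ∀ {v} → v ∈ good → v ∉ B → v ∈ A
      A⁺ = ─⁺ good B

      A+B : # A + # B ≡ # good
      A+B = #-split good B (proj₁ ∘ ─⁻ good side)

    good∖B⊆side : ∀ {v} → v ∈ good → v ∉ B → v ∈ side
    good∖B⊆side {v} v∈g v∉B with v ∈? side
    ... | yes v∈s = v∈s
    ... | no v∉s  = contradiction (B⁺ v∈g v∉s) v∉B

    -- The relation of colour `zero` would keep `w` inside `side`. Only `s` colours remain on these
    -- pairs, which is why the bound is `n / (r - 1)` and not `n / r`.
    cross : ∀ {u w} → u ∈ A → w ∈ B → ∃ λ i → Rel (suc i) u w
    cross u∈ w∈ = off-side (complete (proj₁ (A⁻ u∈)) (proj₁ (B⁻ w∈)))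
      where
      off-side : (∃ λ i → Rel i _ _) → ∃ λ i → Rel (suc i) _ _
      off-side (suc i , r) = i , r
      off-side (zero , r)  = contradiction
        (closed (good∖B⊆side (proj₁ (A⁻ u∈)) (proj₂ (A⁻ u∈))) r) (proj₂ (B⁻ w∈))

    open DoubleStar A B (λ i → Rel (suc i)) (λ i → rel? (suc i)) cross

    broom-covering : (∀ {v} → v ∈ good → v ∈ side) → Conn zero side ⊎ # side ≤ q + (q + q) → Broom
    broom-covering cov (inj₂ small) = ⊥-elim (few-null {# good} (s*-mono
      (ℕ.≤-trans (#-mono {A = good} {side} cov) (ℕ.≤-trans small (ℕ.m≤m+n (q + (q + q)) _)))) good+bad)
    broom-covering cov (inj₁ conn) = record
      { color = zero ; core = side ; leaves = ∅ ; center = proj₁ start , proj₁ (proj₂ start)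
      ; connected = conn ; outside = λ { (mem ()) } ; attached = λ { (mem ()) }
      ; large = inj₁ (ℕ.≤-trans good-big (ℕ.*-monoʳ-≤ d (#-mono {A = good} {side} cov))) }

    broom-star : ∀ {i u w} → u ∈ A → w ∈ B → Rel (suc i) u w →
                 # A + # B ≤ s * (# (forward i u) + # (backward i w)) → Broom
    broom-star {i} {u} {w} u∈ w∈ (near-w , near-u) count =
      go (kind (suc i) (ℓ (suc i) u)) (kind (suc i) (ℓ (suc i) w))
      where
      k₁ k₂ : Lab
      k₁ = ℓ (suc i) u
      k₂ = ℓ (suc i) w
      forward-near : ∀ {v} → v ∈ forward i u → Near (suc i) k₁ v
      forward-near v∈ = proj₁ (proj₂ (∈⁻ (forward? i u) v∈))
      backward-near : ∀ {v} → v ∈ backward i w → Near (suc i) k₂ v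
      backward-near v∈ = proj₂ (proj₂ (∈⁻ (backward? i w) v∈))
      -- If the piece of one centre is null, the other centre, being near it, lies in it and has the
      -- same label. Then both halves of the double star lie in that piece, with at most `3q`
      -- vertices each.
      null : ∀ k → k₁ ≡ k → k₂ ≡ k → Null (suc i) k → ⊥
      null k eq₁ eq₂ nul = few-null {# good} (ℕ.≤-trans (ℕ.≤-reflexive (sym A+B)) (ℕ.≤-trans count
        (ℕ.*-monoʳ-≤ s (ℕ.+-mono-≤
          (ℕ.≤-trans (#-mono {A = forward i u} {pc (suc i) k} inF) (pc-size (suc i) k))
          (ℕ.≤-trans (#-mono {A = backward i w} {pc (suc i) k} inB) (pc-size (suc i) k)))))) good+bad
        where
        inF : forward i u ⊆ pc (suc i) k
        inF {v} v∈ = near-null nul (subst (λ k → Near (suc i) k v) eq₁ (forward-near v∈))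
        inB : backward i w ⊆ pc (suc i) k
        inB {v} v∈ = near-null nul (subst (λ k → Near (suc i) k v) eq₂ (backward-near v∈))
      S X L : Sub n
      S = pc (suc i) k₁ ∪ pc (suc i) k₂
      X = forward i u ∪ backward i w
      L = X ─ S
      inS₁ : pc (suc i) k₁ ⊆ S
      inS₁ = ∪⁺ (pc (suc i) k₁) (pc (suc i) k₂) ∘ inj₁
      inS₂ : pc (suc i) k₂ ⊆ S
      inS₂ = ∪⁺ (pc (suc i) k₁) (pc (suc i) k₂) ∘ inj₂
      attach : ∀ {k v} → pc (suc i) k ⊆ S → v ∉ S → Near (suc i) k v → ∃ λ x → x ∈ S × E (suc i) x v
      attach inS v∉ (x , x∈ , inj₁ refl) = contradiction (inS x∈) v∉
      attach inS v∉ (x , x∈ , inj₂ e)    = x , inS x∈ , e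
      X≤L+6q : # X ≤ # L + (q + (q + q) + (q + (q + q)))
      X≤L+6q = ℕ.≤-trans (#-cover {A = L} {S} cov) (ℕ.+-monoʳ-≤ (# L)
        (ℕ.≤-trans (#-cover {A = pc (suc i) k₁} {pc (suc i) k₂} (∪⁻ _ _))
                   (ℕ.+-mono-≤ (pc-size (suc i) k₁) (pc-size (suc i) k₂))))
        where
        cov : ∀ {v} → v ∈ X → v ∈ L ⊎ v ∈ S
        cov {v} v∈ with v ∈? S
        ... | yes v∈S = inj₂ v∈S
        ... | no v∉S  = inj₁ (─⁺ X S v∈ v∉S)
      good≤ : # good ≤ s * (# L + (q + (q + q) + (q + (q + q))))
      good≤ = begin
        # good                                      ≡⟨ A+B ⟨
        # A + # B                                   ≤⟨ count ⟩
        s * (# (forward i u) + # (backward i w))    ≤⟨ ℕ.*-monoʳ-≤ s (#-disjoint {C = X}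
          (∪⁺ (forward i u) (backward i w) ∘ inj₁) (∪⁺ (forward i u) (backward i w) ∘ inj₂) dis) ⟩
        s * # X                                     ≤⟨ ℕ.*-monoʳ-≤ s X≤L+6q ⟩
        s * (# L + (q + (q + q) + (q + (q + q))))   ∎
        where
        open ℕ.≤-Reasoning
        dis : ∀ {v} → v ∈ forward i u → v ∉ backward i w
        dis v∈ v∈′ = proj₂ (A⁻ (proj₁ (∈⁻ (backward? i w) v∈′))) (proj₁ (∈⁻ (forward? i u) v∈))
      leaves-large : d₁ * n ≤ d * (s * # L)
      leaves-large = leaves-large-arith d₁ s q (# good) (# bad) (# L) q-small bad-size good+bad good≤
      go : Conn (suc i) (pc (suc i) k₁) ⊎ Null (suc i) k₁ →
           Conn (suc i) (pc (suc i) k₂) ⊎ Null (suc i) k₂ → Broom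
      go (inj₂ nul) _ = ⊥-elim (null k₁ refl (proj₂ nul (near-null nul near-w)) nul)
      go _ (inj₂ nul) = ⊥-elim (null k₂ (proj₂ nul (near-null nul near-u)) refl nul)
      go (inj₁ c₁) (inj₁ c₂) = record
        { color = suc i ; core = S ; leaves = L
        ; center = u , inS₁ (own (suc i) u)
        ; connected = conn-from (suc i) {S} {u} reach
        ; outside = λ v∈ → proj₂ (─⁻ X S v∈)
        ; attached = λ v∈ → let v∈X , v∉S = ─⁻ X S v∈ in
            [ (λ v∈F → attach inS₁ v∉S (forward-near v∈F)) , (λ v∈B → attach inS₂ v∉S (backward-near v∈B)) ]′
              (∪⁻ (forward i u) (backward i w) v∈X)
        ; large = inj₂ leaves-large }
        where
        to-w : Near (suc i) k₁ w → Path (suc i) S u w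
        to-w (x , x∈ , inj₁ x≡w) = subst (Path (suc i) S u) x≡w (path-mono (suc i) inS₁ (c₁ (own (suc i) u) x∈))
        to-w (x , x∈ , inj₂ e)   = path-mono (suc i) inS₁ (c₁ (own (suc i) u) x∈)
          ◅◅ (inS₁ x∈ , inS₂ (own (suc i) w) , e) ◅ Star.ε
        u-w : Path (suc i) S u w
        u-w = to-w near-w
        reach : ∀ {v} → v ∈ S → Path (suc i) S u v
        reach v∈ = [ (λ v∈₁ → path-mono (suc i) inS₁ (c₁ (own (suc i) u) v∈₁))
                   , (λ v∈₂ → u-w ◅◅ path-mono (suc i) inS₂ (c₂ (own (suc i) w) v∈₂)) ]′
                   (∪⁻ (pc (suc i) k₁) (pc (suc i) k₂) v∈)

    broom : Broom
    broom = cases (Fin.any? (_∈? B))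
      where
      start∈A : ∃ λ v → v ∈ A
      start∈A = let v , v∈s , v∈g = start in v , A⁺ v∈g λ v∈B → proj₂ (B⁻ v∈B) v∈s
      cases : Dec (∃ λ w → w ∈ B) → Broom
      cases (no none)      = broom-covering (λ {v} v∈ → good∖B⊆side v∈ λ v∈B → none (v , v∈B)) kinds
      cases (yes (w , w∈)) =
        let i , u , w , u∈ , w∈ , e , count =
              doubleStar (ℕ.*-mono-≤ (∈⇒#>0 (proj₂ start∈A)) (∈⇒#>0 w∈))
        in broom-star u∈ w∈ e count

-- Trees as subgraphs

mkBroom : ∀ {n s} d₂ (s≥1 : 1 ≤ s) (E : Fin (suc s) → Fin n → Fin n → Set) (E? : ∀ i u v → Dec (E i u v))
  (E-sym : ∀ i {u v} → E i u v → E i v u) → scale s (suc d₂) ≤ n →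
  NoHole (density s (suc d₂)) (λ u v → ∃ λ i → E i u v) →
  Deterministic.Broom d₂ s≥1 E E? E-sym
mkBroom {n} {s} d₂ s≥1 E E? E-sym n≥N hole = go ((n / N) {{N≢0}}) refl
  where
  N : ℕ
  N = scale s (suc d₂)
  N≥1 : 1 ≤ N
  N≥1 = ℕ.*-mono-≤ {1} {12} (s≤s z≤n) (ℕ.*-mono-≤ {1} {suc (suc d₂)} (s≤s z≤n) s≥1)
  N≢0 : NonZero N
  N≢0 = >-nonZero N≥1
  go : ∀ q → q ≡ (n / N) {{N≢0}} → Deterministic.Broom d₂ s≥1 E E? E-sym
  go zero    eq = contradiction (ℕ.m≥n⇒m/n>0 {{N≢0}} n≥N) (ℕ.<⇒≱ (s≤s (ℕ.≤-reflexive (sym eq))))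
  go (suc m) eq = Deterministic.broom d₂ s≥1 E E? E-sym (ℕ.≤-trans N≥1 n≥N) m
    (ℕ.≤-trans (ℕ.≤-reflexive (trans (ℕ.*-comm N (suc m)) (cong (_* N) eq))) (ℕ.m/n*n≤m n N {{N≢0}}))
    (begin-strict
      n                                 ≡⟨ ℕ.m≡m%n+[m/n]*n n N {{N≢0}} ⟩
      (n % N) {{N≢0}} + Q * N           <⟨ ℕ.+-monoˡ-< (Q * N) (ℕ.m%n<n n N {{N≢0}}) ⟩
      N + Q * N                         ≡⟨ cong (λ z → N + z * N) eq ⟨
      N + suc m * N                     ≤⟨ ℕ.m≤m+n (N + suc m * N) (m * N) ⟩
      N + suc m * N + m * N             ≡⟨ lem N m ⟩
      2 * N * suc m                     ∎)
    hole
    where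
    open ℕ.≤-Reasoning
    Q : ℕ
    Q = (n / N) {{N≢0}}
    lem : ∀ N m → N + (N + m * N) + m * N ≡ 2 * N * suc m
    lem = solve-∀

∈-lookup⁺ : ∀ {n} {i : Fin n} {p : Subset n} → i Subset.∈ p → i ∈ lookup p
∈-lookup⁺ h = mem (Vec.[]=⇒lookup h)

∈-lookup⁻ : ∀ {n} {i : Fin n} {p : Subset n} → i ∈ lookup p → i Subset.∈ p
∈-lookup⁻ {i = i} {p} (mem h) = Vec.lookup⇒[]= i p h

∈-tabulate⁺ : ∀ {n} {i : Fin n} {A : Sub n} → i ∈ A → i Subset.∈ tabulate A
∈-tabulate⁺ {i = i} {A} (mem h) = Vec.lookup⇒[]= i (tabulate A) (trans (Vec.lookup∘tabulate A i) h)

∈-tabulate⁻ : ∀ {n} {i : Fin n} {A : Sub n} → i Subset.∈ tabulate A → i ∈ A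
∈-tabulate⁻ {i = i} {A} h = mem (trans (sym (Vec.lookup∘tabulate A i)) (Vec.[]=⇒lookup h))

∣_∣≡# : ∀ {n} (p : Subset n) → ∣ p ∣ ≡ # (lookup p)
∣ [] ∣≡#          = refl
∣ true ∷ p ∣≡#  = cong suc ∣ p ∣≡#
∣ false ∷ p ∣≡# = ∣ p ∣≡#

∣tabulate∣≡# : ∀ {n} (A : Sub n) → ∣ tabulate A ∣ ≡ # A
∣tabulate∣≡# A = trans ∣ tabulate A ∣≡# (sum-cong-≗ λ i → cong χ (Vec.lookup∘tabulate A i))

module _ {X : Set} {R : X → X → Set} where
  linked-gmap : ∀ {R′ : X → X → Set} {P : X → Set} → (∀ {a b} → P a → P b → R a b → R′ a b) →
                ∀ {xs} → All P xs → Linked R xs → Linked R′ xs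
  linked-gmap f []            []        = []
  linked-gmap f (_ ∷ [])      [-]       = [-]
  linked-gmap f (p ∷ p′ ∷ ps) (r ∷ rs) = f p p′ r ∷ linked-gmap f (p′ ∷ ps) rs

  last-step : ∀ {v} b ws → Linked R (b ∷ ws ++ [ v ]) → ∃ λ z → z ∈ᴸ b ∷ ws × R z v
  last-step b []       (r ∷ _)  = b , here refl , r
  last-step b (w ∷ ws) (_ ∷ rs) = let z , z∈ , r = last-step w ws rs in z , there z∈ , r

  CycleNeighbours : X → Set
  CycleNeighbours y = ∃₂ λ a b → a ≢ b × R a y × R y b

  -- The two neighbours are the predecessor and the successor of `y`. Only for the last vertex,
  -- whose successor is `v`, can they fail to differ by uniqueness alone; there `p ≢ v` is required.
  -- The alternative `2 ≤ length ws` covers the start, where `p` is `v` itself and the next vertex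
  -- is not the last.
  interior : ∀ {v y} p ws → Linked R (p ∷ ws ++ [ v ]) → Unique (p ∷ ws) → p ≢ v ⊎ 2 ≤ length ws →
             All (v ≢_) ws → y ∈ᴸ ws → CycleNeighbours y
  interior p (y ∷ []) (r ∷ r′ ∷ _) _ (inj₁ p≢v) _ (here refl) = p , _ , p≢v , r , r′
  interior p (y ∷ []) _ _ (inj₂ (s≤s ())) _ _
  interior p (y ∷ w ∷ ws) (r ∷ r′ ∷ _) ((_ ∷ p≢w ∷ _) ∷ _) _ _ (here refl) = p , w , p≢w , r , r′
  interior p (x ∷ ws) (_ ∷ rs) (_ ∷ uniq) _ (v≢x ∷ v∉) (there y∈) =
    interior x ws rs uniq (inj₁ (v≢x ∘ sym)) v∉ y∈

  cycle-neighbours : ∀ {y} v vs → 3 ≤ length (v ∷ vs) → Unique (v ∷ vs) → Linked R (v ∷ vs ++ [ v ]) →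
                     y ∈ᴸ v ∷ vs → CycleNeighbours y
  cycle-neighbours v (a ∷ b ∷ vs) _ (_ ∷ a∉ ∷ _) (r ∷ _ ∷ rs) (here refl) =
    let z , z∈ , r′ = last-step b vs rs in z , a , (λ z≡a → All.lookup a∉ z∈ (sym z≡a)) , r′ , r
  cycle-neighbours v (_ ∷ []) (s≤s (s≤s ())) _ _ _
  cycle-neighbours v vs (s≤s len) uniq@(v∉ ∷ _) linked (there y∈) =
    interior v vs linked uniq (inj₂ len) v∉ y∈

module Trees {n : ℕ} (K : Edge n → Set) where

  Joins : Edge n → Fin n → Fin n → Set
  Joins e u v = ends n e ≡ (u , v) ⊎ ends n e ≡ (v , u)

  joins? : ∀ e u v → Dec (Joins e u v)
  joins? e u v = Product.≡-dec Fin._≟_ Fin._≟_ (ends n e) (u , v)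
           ⊎-dec Product.≡-dec Fin._≟_ Fin._≟_ (ends n e) (v , u)

  Link : (Edge n → Set) → Fin n → Fin n → Set
  Link P u v = ∃ λ e → P e × Joins e u v

  link-sym : ∀ {P u v} → Link P u v → Link P v u
  link-sym (e , p , j) = e , p , Sum.swap j

  Incident : Fin n → Edge n → Set
  Incident v e = v ≡ proj₁ (ends n e) ⊎ v ≡ proj₂ (ends n e)

  joins-ends : ∀ {e u v w} → Joins e u v → Incident w e → w ≡ u ⊎ w ≡ v
  joins-ends (inj₁ eq) (inj₁ w≡) = inj₁ (trans w≡ (cong proj₁ eq))
  joins-ends (inj₁ eq) (inj₂ w≡) = inj₂ (trans w≡ (cong proj₂ eq))
  joins-ends (inj₂ eq) (inj₁ w≡) = inj₂ (trans w≡ (cong proj₁ eq))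
  joins-ends (inj₂ eq) (inj₂ w≡) = inj₁ (trans w≡ (cong proj₂ eq))

  joins-incidentˡ : ∀ {e u v} → Joins e u v → Incident u e
  joins-incidentˡ (inj₁ eq) = inj₁ (sym (cong proj₁ eq))
  joins-incidentˡ (inj₂ eq) = inj₂ (sym (cong proj₂ eq))

  joins-incidentʳ : ∀ {e u v} → Joins e u v → Incident v e
  joins-incidentʳ = joins-incidentˡ ∘ Sum.swap

  Acyclic : (Edge n → Set) → Set
  Acyclic P = ∀ v vs → 3 ≤ length (v ∷ vs) → Unique (v ∷ vs) → ¬ Linked (Link P) (v ∷ vs ++ [ v ])

  -- `S` is the core, and only vertices outside it must be leaves. While `V` grows inside `S` this
  -- is vacuous, and afterwards each new vertex is hung on a vertex of `S`; so a single insertion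
  -- step serves both phases.
  record TreeOn (S V : Sub n) : Set where
    field
      E       : Sub (#pairs n)
      allowed : ∀ {e} → e ∈ E → K e
      closed  : ∀ {e v} → e ∈ E → Incident v e → v ∈ V
      reach   : ∀ {u v} → u ∈ V → v ∈ V → Star (Link (_∈ E)) u v
      acyclic : Acyclic (_∈ E)
      leaf    : ∀ {v} → v ∈ V → v ∉ S → ∃ λ e → e ∈ E × Incident v e × (∀ {e′} → e′ ∈ E → Incident v e′ → e′ ≡ e)

  point : ∀ {S v} → v ∈ S → TreeOn S ⁅ v ⁆
  point {S} {v} v∈S = record
    { E = ∅
    ; allowed = λ { (mem ()) }
    ; closed = λ { (mem ()) }
    ; reach = λ u∈ w∈ → subst (Star _ _) (trans (∈⁅⁆⁻ u∈) (sym (∈⁅⁆⁻ w∈))) Star.ε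
    ; acyclic = λ { v (_ ∷ _) _ _ ((_ , mem () , _) ∷ _) ; v [] (s≤s ()) _ _ }
    ; leaf = λ w∈ w∉S → contradiction (subst (_∈ S) (sym (∈⁅⁆⁻ w∈)) v∈S) w∉S }

  module _ {S V x y} (x∈ : x ∈ V) (y∉ : y ∉ V) (xy : Link K x y) (x∈S : x ∈ S) (T : TreeOn S V) where
    private
      open module T = TreeOn T using (E)
      e : Edge n
      e = proj₁ xy
      exy : Joins e x y
      exy = proj₂ (proj₂ xy)
      V′ : Sub n
      V′ = V ∪ ⁅ y ⁆
      E′ : Sub (#pairs n)
      E′ = E ∪ ⁅ e ⁆

      old : V ⊆ V′
      old = ∪⁺ V ⁅ y ⁆ ∘ inj₁
      y∈V′ : y ∈ V′
      y∈V′ = ∪⁺ V ⁅ y ⁆ (inj₂ (∈⁅⁆⁺ y))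
      old-edge : E ⊆ E′
      old-edge = ∪⁺ E ⁅ e ⁆ ∘ inj₁
      new-edge : e ∈ E′
      new-edge = ∪⁺ E ⁅ e ⁆ (inj₂ (∈⁅⁆⁺ e))

      split-edge : ∀ {e′} → e′ ∈ E′ → e′ ∈ E ⊎ e′ ≡ e
      split-edge e′∈ = Sum.map₂ ∈⁅⁆⁻ (∪⁻ E ⁅ e ⁆ e′∈)

      x≢y : x ≢ y
      x≢y refl = y∉ x∈

      at-y : ∀ {e′} → e′ ∈ E′ → Incident y e′ → e′ ≡ e
      at-y e′∈ inc = [ (λ e′∈E → contradiction (T.closed e′∈E inc) y∉) , id ]′ (split-edge e′∈)

      neighbour-y : ∀ {a} → Link (_∈ E′) a y → a ≡ x
      neighbour-y {a} (e′ , e′∈ , j) with at-y e′∈ (joins-incidentʳ j)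
      ... | refl = [ id , (λ { refl → contradiction (loop j (joins-incidentˡ exy)) x≢y }) ]′
                     (joins-ends exy (joins-incidentˡ j))
        where
        loop : Joins e y y → Incident x e → x ≡ y
        loop j i = [ id , id ]′ (joins-ends j i)

      lift : ∀ {a b} → Star (Link (_∈ E)) a b → Star (Link (_∈ E′)) a b
      lift = Star.map λ (e , e∈ , j) → e , old-edge e∈ , j

      toX : ∀ {v} → v ∈ V′ → Star (Link (_∈ E′)) v x
      toX {v} v∈ with ∪⁻ V ⁅ y ⁆ v∈
      ... | inj₁ v∈V = lift (T.reach v∈V x∈)
      ... | inj₂ v∈y = subst (λ z → Star (Link (_∈ E′)) z x) (sym (∈⁅⁆⁻ v∈y))
                         ((e , new-edge , Sum.swap exy) ◅ Star.ε)

      acyclic : Acyclic (_∈ E′)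
      -- The new vertex has `x` as its only neighbour, whereas a vertex on a cycle has two. A cycle
      -- that avoids it uses old edges only.
      acyclic v vs len uniq linked with y Mem.∈? (v ∷ vs)
        where module Mem = DecMembership Fin._≟_
      ... | yes y∈ = let a , b , a≢b , ay , yb = cycle-neighbours v vs len uniq linked y∈
                     in a≢b (trans (neighbour-y ay) (sym (neighbour-y (link-sym yb))))
      ... | no y∉c = T.acyclic v vs len uniq (linked-gmap avoid (avoids v vs y∉c) linked)
        where
        avoids : ∀ w ws → ¬ y ∈ᴸ w ∷ ws → All (_≢ y) (w ∷ ws ++ [ w ])
        avoids w ws y∉c = (λ { refl → y∉c (here refl) }) ∷ go ws (y∉c ∘ there)
          where
          go : ∀ ws → ¬ y ∈ᴸ ws → All (_≢ y) (ws ++ [ w ])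
          go []       _ = (λ { refl → y∉c (here refl) }) ∷ []
          go (u ∷ ws) h = (λ { refl → h (here refl) }) ∷ go ws (h ∘ there)
        avoid : ∀ {a b} → a ≢ y → b ≢ y → Link (_∈ E′) a b → Link (_∈ E) a b
        avoid {a} {b} a≢y b≢y (e′ , e′∈ , j) with split-edge e′∈
        ... | inj₁ e′∈E = e′ , e′∈E , j
        ... | inj₂ refl = ⊥-elim ([ a≢y ∘ sym , b≢y ∘ sym ]′ (joins-ends j (joins-incidentʳ exy)))

    insert : TreeOn S V′
    insert = record
      { E = E′
      ; allowed = λ e′∈ → [ T.allowed , (λ { refl → proj₁ (proj₂ xy) }) ]′ (split-edge e′∈)
      ; closed = closed
      ; reach = λ u∈ v∈ → toX u∈ ◅◅ Star.reverse link-sym (toX v∈)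
      ; acyclic = acyclic
      ; leaf = leaf }
      where
      closed : ∀ {e′ v} → e′ ∈ E′ → Incident v e′ → v ∈ V′
      closed e′∈ inc with split-edge e′∈
      ... | inj₁ e′∈E = old (T.closed e′∈E inc)
      ... | inj₂ refl with joins-ends exy inc
      ... | inj₁ refl = old x∈
      ... | inj₂ refl = y∈V′
      leaf : ∀ {v} → v ∈ V′ → v ∉ S →
             ∃ λ e → e ∈ E′ × Incident v e × (∀ {e′} → e′ ∈ E′ → Incident v e′ → e′ ≡ e)
      leaf {v} v∈ v∉S with ∪⁻ V ⁅ y ⁆ v∈
      ... | inj₂ v∈y with ∈⁅⁆⁻ v∈y
      ... | refl = e , new-edge , joins-incidentʳ exy , at-y
      leaf {v} v∈ v∉S | inj₁ v∈V =
        let e₀ , e₀∈ , inc , only = T.leaf v∈V v∉S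
        in e₀ , old-edge e₀∈ , inc , λ e′∈ inc′ →
          [ (λ e′∈E → only e′∈E inc′)
          , (λ { refl → ⊥-elim ([ (λ { refl → v∉S x∈S }) , (λ { refl → y∉ v∈V }) ]′ (joins-ends exy inc′)) }) ]′
          (split-edge e′∈)

  module _ (K? : ∀ e → Dec (K e)) where

    link? : ∀ u v → Dec (Link K u v)
    link? u v = Fin.any? λ e → K? e ×-dec joins? e u v

    open Growth (Link K) link? link-sym

    -- With a budget of `n` the growth can only end at a set closed in `S`, and a connected `S` has
    -- no other closed nonempty subset than itself.
    spanning : ∀ {S v} → v ∈ S → Conn S → ∃ λ V → TreeOn S V × S ⊆ V
    spanning {S} {v} v∈ conn with grow (TreeOn S) v∈ (point v∈)
      (λ T S⊆U x∈ _ y∉ xy → insert x∈ y∉ xy (S⊆U x∈) T) n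
    ... | V , T , v∈V , V⊆S , inj₁ big = contradiction (#≤n V) (ℕ.<⇒≱ (ℕ.≤-reflexive (sym big)))
    ... | V , T , v∈V , V⊆S , inj₂ (_ , closedV) = V , T , λ w∈ → path-closed closedV (conn v∈ w∈) v∈V

    attach : ∀ {S V} L → S ⊆ V → TreeOn S V → (∀ {w} → w ∈ L → ∃ λ x → x ∈ S × Link K x w) →
             ∀ ws → ∃ λ V′ → TreeOn S V′ × S ⊆ V′ × (∀ {w} → w ∈ᴸ ws → w ∈ L → w ∈ V′)
    attach {V = V} L S⊆V T att [] = V , T , S⊆V , λ ()
    attach L S⊆V T att (w ∷ ws) with attach L S⊆V T att ws
    ... | V′ , T′ , S⊆V′ , cov with w ∈? V′ | w ∈? L
    ... | yes w∈V | _ = V′ , T′ , S⊆V′ , λ { (here refl) _ → w∈V ; (there h) → cov h }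
    ... | no _ | no w∉L = V′ , T′ , S⊆V′ , λ { (here refl) w∈L → contradiction w∈L w∉L ; (there h) → cov h }
    ... | no w∉V | yes w∈L =
      let x , x∈ , xw = att w∈L
      in V′ ∪ ⁅ w ⁆ , insert (S⊆V′ x∈) w∉V xw x∈ T′ , (λ v∈ → old (S⊆V′ v∈)) ,
         λ { (here refl) _ → ∪⁺ V′ ⁅ w ⁆ (inj₂ (∈⁅⁆⁺ w)) ; (there h) w∈L → old (cov h w∈L) }
      where
      old : V′ ⊆ V′ ∪ ⁅ w ⁆
      old = ∪⁺ V′ ⁅ w ⁆ ∘ inj₁

    broomTree : ∀ {S L v} → v ∈ S → Conn S → (∀ {w} → w ∈ L → ∃ λ x → x ∈ S × Link K x w) →
                ∃ λ V → TreeOn S V × S ⊆ V × L ⊆ V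
    broomTree {L = L} v∈ conn att =
      let V , T , S⊆V = spanning v∈ conn
          V′ , T′ , S⊆V′ , cov = attach L S⊆V T att (List.allFin n)
      in V′ , T′ , S⊆V′ , cov (∈-allFin _)

  module _ {G : Graph n} (K⊆G : ∀ {e} → K e → e Subset.∈ Graph.edges G) {S V : Sub n} (T : TreeOn S V) where
    private module T = TreeOn T

    subgraph : Subgraph G
    subgraph = record
      { V = tabulate V
      ; E = tabulate T.E
      ; E⊆G = K⊆G ∘ T.allowed ∘ ∈-tabulate⁻
      ; closed = λ e∈ → ∈-tabulate⁺ (T.closed (∈-tabulate⁻ e∈) (inj₁ refl)) ,
                        ∈-tabulate⁺ (T.closed (∈-tabulate⁻ e∈) (inj₂ refl)) }

    subgraph-tree : ∃ (_∈ V) → IsTree subgraph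
    subgraph-tree (v , v∈) = ((v , ∈-tabulate⁺ v∈) , λ u∈ w∈ →
        Star.map (λ (e , e∈ , j) → e , ∈-tabulate⁺ e∈ , j) (T.reach (∈-tabulate⁻ u∈) (∈-tabulate⁻ w∈))) ,
      λ v vs (len , uniq , linked) → T.acyclic v vs len uniq
        (Linked.map (λ (e , e∈ , j) → e , ∈-tabulate⁻ e∈ , j) linked)

    subgraph-order : order subgraph ≡ # V
    subgraph-order = ∣tabulate∣≡# V

    incident? : ∀ v e → Dec (Incident v e)
    incident? v e = v Fin.≟ proj₁ (ends n e) ⊎-dec v Fin.≟ proj₂ (ends n e)

    subgraph-leaf : ∀ {v} → v ∈ V → v ∉ S → degree subgraph v ≡ 1
    subgraph-leaf {v} v∈ v∉ =
      let e , e∈ , inc , only = T.leaf v∈ v∉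
          star = tabulate T.E Subset.∩ tabulate ⟦ incident? v ⟧
      in trans ∣ star ∣≡# (trans (sum-cong-≗ λ e′ → cong χ (⊆-antisym
           {A = lookup star} {⁅ e ⁆}
           (λ {e′} e′∈ →
             let e′∈E , e′∈inc = Subset.x∈p∩q⁻ (tabulate T.E) (tabulate ⟦ incident? v ⟧) (∈-lookup⁻ e′∈)
             in subst (_∈ ⁅ e ⁆) (sym (only (∈-tabulate⁻ e′∈E) (∈⁻ (incident? v) (∈-tabulate⁻ e′∈inc)))) (∈⁅⁆⁺ e))
           (λ {e′} e′∈ → subst (_∈ lookup star) (sym (∈⁅⁆⁻ e′∈)) (∈-lookup⁺
             (Subset.x∈p∩q⁺ (∈-tabulate⁺ e∈ , ∈-tabulate⁺ (∈⁺ (incident? v) inc))))) e′))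
         (#-⁅⁆ e))

    subgraph-leaves : ∀ {L} → L ⊆ V → (∀ {v} → v ∈ L → v ∉ S) → # L ≤ #leaves subgraph
    subgraph-leaves {L} L⊆V out = ℕ.≤-trans
      (#-mono {A = L} λ v∈ → ∈-lookup⁺ (Subset.x∈p∩q⁺ (∈-tabulate⁺ (L⊆V v∈) ,
        ∈-tabulate⁺ (∈⁺ (λ v → degree subgraph v ℕ.≟ 1) (subgraph-leaf (L⊆V v∈) (out v∈))))))
      (ℕ.≤-reflexive (sym ∣ tabulate V Subset.∩ tabulate (λ v → does (degree subgraph v ℕ.≟ 1)) ∣≡#))

-- Colourings and tm

EdgeBetween : ∀ {n} → Graph n → Fin n → Fin n → Set
EdgeBetween {n} G u v = ∃ λ e → e Subset.∈ edges G × (ends n e ≡ (u , v) ⊎ ends n e ≡ (v , u))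

module _ {n r : ℕ} (G : Graph n) where

  InColor : Coloring r G → Fin r → Edge n → Set
  InColor c k e = Σ (e Subset.∈ edges G) λ e∈ → c e e∈ ≡ k

  inColor? : ∀ c k e → Dec (InColor c k e)
  inColor? c k e with e Subset.∈? edges G
  ... | no e∉  = no (e∉ ∘ proj₁)
  ... | yes e∈ = map′ (e∈ ,_) (λ (e∈′ , eq) → trans (cong (c e) (Vec.[]=-irrelevant e∈ e∈′)) eq)
                      (c e e∈ Fin.≟ k)

  module Colored (c : Coloring r G) (k : Fin r) where
    open Trees {n} (InColor c k) public
    open Growth (Link (InColor c k)) (link? (inColor? c k)) link-sym public

    mono : ∀ {S V} (T : TreeOn S V) → Monochromatic c (subgraph {G} proj₁ T)
    mono T = k , λ e e∈ → proj₂ (TreeOn.allowed T (∈-tabulate⁻ e∈))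

  MonoComponent≥ : Coloring r G → ℕ → Set
  MonoComponent≥ c t = Σ (Subgraph G) λ H → Connected H × Monochromatic c H × t ≤ order H

  -- No search through subgraphs: a connected subgraph of colour `k` lies in a component of that
  -- colour, and each component is realised by a spanning tree.
  monoComponent? : ∀ c t → Dec (MonoComponent≥ c t)
  monoComponent? c t = map′ to from (Fin.any? λ k → Fin.any? λ v → t ℕ.≤? # (comp k v))
    where
    component′ : ∀ k v → _
    component′ k v = Colored.component c k {univ} {v} (mem refl)
    comp : Fin r → Fin n → Sub n
    comp k v = proj₁ (component′ k v)
    to : (∃ λ k → ∃ λ v → t ≤ # (comp k v)) → MonoComponent≥ c t
    to (k , v , t≤) =
      let open Colored c k
          C , conn , v∈ , _ = component′ k v
          V , T , C⊆V = spanning (inColor? c k) v∈ conn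
      in subgraph proj₁ T , proj₁ (subgraph-tree proj₁ T (v , C⊆V v∈)) , mono T ,
         ℕ.≤-trans t≤ (ℕ.≤-trans (#-mono {A = C} {V} C⊆V) (ℕ.≤-reflexive (sym (subgraph-order {G} proj₁ T))))
    from : MonoComponent≥ c t → ∃ λ k → ∃ λ v → t ≤ # (comp k v)
    from (H , ((v , v∈) , reach) , (k , mono-k) , t≤) = k , v , ℕ.≤-trans t≤ (ℕ.≤-trans
      (ℕ.≤-reflexive ∣ Subgraph.V H ∣≡#) (#-mono {A = lookup (Subgraph.V H)} {comp k v} sub))
      where
      open Colored c k
      closedC : ClosedIn univ (comp k v)
      closedC = proj₂ (proj₂ (proj₂ (proj₂ (component′ k v))))
      sub : lookup (Subgraph.V H) ⊆ comp k v
      sub w∈ = path-closed closedC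
        (Star.map (λ (e , e∈ , j) → mem refl , mem refl , e , (Subgraph.E⊆G H e∈ , mono-k e e∈) , j)
                  (reach v∈ (∈-lookup⁻ w∈)))
        (proj₁ (proj₂ (proj₂ (component′ k v))))

allVec? : ∀ {r} m {P : Vec (Fin r) m → Set} → (∀ x → Dec (P x)) → Dec (∀ x → P x)
allVec? zero    P? = map′ (λ { p [] → p }) (λ h → h []) (P? [])
allVec? (suc m) P? = map′ (λ { h (i ∷ x) → h i x }) (λ h i x → h (i ∷ x))
                          (Fin.all? λ i → allVec? m λ x → P? (i ∷ x))

module _ {n s : ℕ} (G : Graph n) where
  fromVec : Vec (Fin (suc s)) (#pairs n) → Coloring (suc s) G
  fromVec x e _ = lookup x e

  colorAt : Coloring (suc s) G → Edge n → Fin (suc s)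
  colorAt c e with e Subset.∈? edges G
  ... | yes e∈ = c e e∈
  ... | no _   = zero

  colorAt-∈ : ∀ c e e∈ → colorAt c e ≡ c e e∈
  colorAt-∈ c e e∈ with e Subset.∈? edges G
  ... | yes e∈′ = cong (c e) (Vec.[]=-irrelevant e∈′ e∈)
  ... | no e∉   = contradiction e∈ e∉

  toVec : Coloring (suc s) G → Vec (Fin (suc s)) (#pairs n)
  toVec c = tabulate (colorAt c)

  fromVec-toVec : ∀ c e e∈ → fromVec (toVec c) e e∈ ≡ c e e∈
  fromVec-toVec c e e∈ = trans (Vec.lookup∘tabulate (colorAt c) e) (colorAt-∈ c e e∈)

  -- Colourings take membership proofs as arguments, so they are not enumerated directly. Vectors of
  -- colours represent all of them up to pointwise equality, non-edges receiving the colour `zero`.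
  forces? : ∀ t → Dec (ForcesMonoComponent (suc s) G t)
  forces? t = map′ forces (λ h x → h (fromVec x))
                   (allVec? (#pairs n) λ x → monoComponent? G (fromVec x) t)
    where
    forces : (∀ x → MonoComponent≥ G (fromVec x) t) → ForcesMonoComponent (suc s) G t
    forces h c = let H , conn , (k , mono) , t≤ = h (toVec c)
                 in H , conn , (k , λ e e∈ → trans (sym (fromVec-toVec c e _)) (mono e e∈)) , t≤

  forces-≤n : ∀ {t} → ForcesMonoComponent (suc s) G t → t ≤ n
  forces-≤n h = let H , _ , _ , t≤ = h (λ _ _ → zero) in ℕ.≤-trans t≤ (Subset.∣p∣≤n (Subgraph.V H))

  -- A search downwards from `n`. Even the bound 0 asks for a nonempty component, so the hypothesis
  -- is a genuine one: it fails for the graph without vertices.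
  tm-exists : ForcesMonoComponent (suc s) G 0 → ∃ (IsTm (suc s) G)
  tm-exists forces₀ = search n λ _ → forces-≤n
    where
    search : ∀ b → (∀ t → ForcesMonoComponent (suc s) G t → t ≤ b) → ∃ (IsTm (suc s) G)
    search zero    upper = 0 , forces₀ , upper
    search (suc b) upper with forces? (suc b)
    ... | yes f = suc b , f , upper
    ... | no ¬f = search b λ t f → s≤s⁻¹ (ℕ.≤∧≢⇒< (upper t f) λ { refl → ¬f f })

  LargeMonoTree : ℕ → Coloring (suc s) G → Set
  LargeMonoTree d₁ c = Σ (Subgraph G) λ H → IsTree H × Monochromatic c H ×
    (d₁ * n ≤ suc d₁ * order H ⊎ d₁ * n ≤ suc d₁ * (s * #leaves H))

  largeMonoTree : ∀ d₂ → 1 ≤ s → scale s (suc d₂) ≤ n → NoHole (density s (suc d₂)) (EdgeBetween G) →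
                  ∀ c → LargeMonoTree (suc d₂) c
  largeMonoTree d₂ s≥1 n≥N hole c = subgraph proj₁ T , subgraph-tree proj₁ T (proj₁ center , S⊆V (proj₂ center)) ,
    mono T , Sum.map (λ h → ℕ.≤-trans h (ℕ.*-monoʳ-≤ (suc (suc d₂)) (ℕ.≤-trans (#-mono {A = core} {V} S⊆V)
                              (ℕ.≤-reflexive (sym (subgraph-order {G} proj₁ T))))))
                     (λ h → ℕ.≤-trans h (ℕ.*-monoʳ-≤ (suc (suc d₂)) (ℕ.*-monoʳ-≤ s
                              (subgraph-leaves {G} proj₁ T {leaves} L⊆V outside)))) large
    where
    hole′ : NoHole (density s (suc d₂)) λ u v → ∃ λ i → Colored.Link G c i (InColor G c i) u v
    hole′ A B hA hB = let u , v , u∈ , v∈ , e , e∈ , j = hole A B hA hB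
                      in u , v , u∈ , v∈ , c e e∈ , e , (e∈ , refl) , j
    broom : Deterministic.Broom {n} {s} d₂ s≥1 (λ i → Colored.Link G c i (InColor G c i))
      (λ i → Colored.link? G c i (inColor? G c i)) (λ i → Colored.link-sym G c i)
    broom = mkBroom d₂ s≥1 _ _ _ n≥N hole′
    open Deterministic.Broom {n} {s} broom
    open Colored {n} {suc s} G c color
    built = broomTree (inColor? G c color) (proj₂ center) connected attached
    V : Sub n
    V = proj₁ built
    T : TreeOn core V
    T = proj₁ (proj₂ built)
    S⊆V : core ⊆ V
    S⊆V = proj₁ (proj₂ (proj₂ built))
    L⊆V : leaves ⊆ V
    L⊆V = proj₂ (proj₂ (proj₂ built))

  #leaves≤order : (H : Subgraph G) → #leaves H ≤ order H
  #leaves≤order H = Subset.∣p∩q∣≤∣p∣ (Subgraph.V H) _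

  -- Were the inequality to fail for the value `t`, the tree found in any colouring would have more
  -- than `t` vertices, and `suc t` would be forced as well.
  tm-large : ∀ d₁ → 1 ≤ s → (∀ c → LargeMonoTree d₁ c) →
             ∃ λ t → IsTm (suc s) G t × d₁ * n ≤ suc d₁ * (s * t)
  tm-large d₁ s≥1 trees = t , tm , bound′
    where
    atLeast : ∀ c → Σ (Subgraph G) λ H → Connected H × Monochromatic c H × d₁ * n ≤ suc d₁ * (s * order H)
    atLeast c = let H , tree , mono , large = trees c in H , proj₁ tree , mono ,
      [ (λ h → ℕ.≤-trans h (ℕ.*-monoʳ-≤ (suc d₁) (ℕ.≤-trans (ℕ.≤-reflexive (sym (ℕ.*-identityˡ _)))
                                                           (ℕ.*-monoˡ-≤ (order H) s≥1))))
      , (λ h → ℕ.≤-trans h (ℕ.*-monoʳ-≤ (suc d₁) (ℕ.*-monoʳ-≤ s (#leaves≤order H)))) ]′ large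
    found = tm-exists λ c → let H , conn , mono , _ = atLeast c in H , conn , mono , z≤n
    t : ℕ
    t = proj₁ found
    tm : IsTm (suc s) G t
    tm = proj₂ found
    bound′ : d₁ * n ≤ suc d₁ * (s * t)
    bound′ = ℕ.≮⇒≥ λ small → ℕ.n≮n t (proj₂ tm (suc t) λ c →
      let H , conn , mono , large = atLeast c
      in H , conn , mono , ℕ.*-cancelˡ-< s _ _ (ℕ.*-cancelˡ-< (suc d₁) _ _ (ℕ.<-≤-trans small large)))

-- Binomial random sets, over the rationals

ι : ℕ → ℚ
ι n = + n ℚ./ 1

private
  toℚᵘ-ι : ∀ n → ℚ.toℚᵘ (ι n) ℚᵘ.≃ ℚᵘ.mkℚᵘ (+ n) 0
  toℚᵘ-ι n = ℚ.toℚᵘ-fromℚᵘ (ℚᵘ.mkℚᵘ (+ n) 0)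

ι-+ : ∀ m n → ι (m ℕ.+ n) ≡ ι m ℚ.+ ι n
ι-+ m n = ℚ.toℚᵘ-injective (ℚᵘ.≃-trans (toℚᵘ-ι (m ℕ.+ n)) (ℚᵘ.≃-sym
  (ℚᵘ.≃-trans (ℚ.toℚᵘ-homo-+ (ι m) (ι n)) (ℚᵘ.≃-trans (ℚᵘ.+-cong (toℚᵘ-ι m) (toℚᵘ-ι n))
    (ℚᵘ.*≡* (cong (ℤ._* + 1) (trans (cong₂ ℤ._+_ (ℤ.*-identityʳ (+ m)) (ℤ.*-identityʳ (+ n)))
                                   (sym (ℤ.pos-+ m n)))))))))

ι-* : ∀ m n → ι (m ℕ.* n) ≡ ι m ℚ.* ι n
ι-* m n = ℚ.toℚᵘ-injective (ℚᵘ.≃-trans (toℚᵘ-ι (m ℕ.* n)) (ℚᵘ.≃-sym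
  (ℚᵘ.≃-trans (ℚ.toℚᵘ-homo-* (ι m) (ι n)) (ℚᵘ.≃-trans (ℚᵘ.*-cong (toℚᵘ-ι m) (toℚᵘ-ι n))
    (ℚᵘ.*≡* (cong (ℤ._* + 1) (sym (ℤ.pos-* m n))))))))

0≤ι : ∀ n → 0ℚ ℚ.≤ ι n
0≤ι n = ℚ.nonNegative⁻¹ (ι n) {{ℚ.normalize-nonNeg n 1}}

ι-mono : ∀ {m n} → m ℕ.≤ n → ι m ℚ.≤ ι n
ι-mono {m} {n} m≤n with ℕ.m≤n⇒∃[o]m+o≡n m≤n
... | k , refl = begin
  ι m              ≡⟨ ℚ.+-identityʳ (ι m) ⟨
  ι m ℚ.+ 0ℚ       ≤⟨ ℚ.+-monoʳ-≤ (ι m) (0≤ι k) ⟩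
  ι m ℚ.+ ι k      ≡⟨ ι-+ m k ⟨
  ι (m ℕ.+ k)      ∎
  where open ℚ.≤-Reasoning

ι-suc : ∀ n → ι (suc n) ≡ 1ℚ ℚ.+ ι n
ι-suc = ι-+ 1

ι-*-1/ : ∀ n .{{_ : NonZero n}} → ι n ℚ.* (+ 1 ℚ./ n) ≡ 1ℚ
ι-*-1/ n@(suc k) = ℚ.toℚᵘ-injective (ℚᵘ.≃-trans (ℚ.toℚᵘ-homo-* (ι n) (+ 1 ℚ./ n))
  (ℚᵘ.≃-trans (ℚᵘ.*-cong (toℚᵘ-ι n) (ℚ.toℚᵘ-fromℚᵘ (ℚᵘ.mkℚᵘ (+ 1) k)))
    (ℚᵘ.*≡* (trans (ℤ.*-identityʳ (+ n ℤ.* + 1)) (trans (ℤ.*-comm (+ n) (+ 1))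
      (cong (+ 1 ℤ.*_) (cong +_ (sym (ℕ.*-identityˡ n)))))))))

mulˡ : ∀ {a b c} → 0ℚ ℚ.≤ a → b ℚ.≤ c → a ℚ.* b ℚ.≤ a ℚ.* c
mulˡ {a} 0≤a = ℚ.*-monoˡ-≤-nonNeg a {{ℚ.nonNegative 0≤a}}

mulʳ : ∀ {a b c} → 0ℚ ℚ.≤ a → b ℚ.≤ c → b ℚ.* a ℚ.≤ c ℚ.* a
mulʳ {a} 0≤a = ℚ.*-monoʳ-≤-nonNeg a {{ℚ.nonNegative 0≤a}}

0≤* : ∀ {a b} → 0ℚ ℚ.≤ a → 0ℚ ℚ.≤ b → 0ℚ ℚ.≤ a ℚ.* b
0≤* {a} {b} 0≤a 0≤b = subst (ℚ._≤ a ℚ.* b) (ℚ.*-zeroʳ a) (mulˡ 0≤a 0≤b)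

0≤-diff : ∀ {a b} → a ℚ.≤ b → 0ℚ ℚ.≤ b ℚ.- a
0≤-diff {a} {b} h = subst (ℚ._≤ b ℚ.- a) (ℚ.+-inverseʳ a) (ℚ.+-monoˡ-≤ (ℚ.- a) h)

0≤1 : 0ℚ ℚ.≤ 1ℚ
0≤1 = 0≤ι 1

-- Replaces the exponential bound on `(1 - q)^n`, cleared of its denominator. The induction rests on
-- `(1 - q)(1 + (n + 1) q) = 1 + nq - (n + 1) q²`.
1-↑-bernoulli : ∀ {q} → 0ℚ ℚ.≤ q → q ℚ.≤ 1ℚ → ∀ n → (1ℚ ℚ.- q) ↑ n ℚ.* (1ℚ ℚ.+ ι n ℚ.* q) ℚ.≤ 1ℚ
1-↑-bernoulli {q} 0≤q q≤1 zero = ℚ.≤-reflexive (trans (ℚ.*-identityˡ _)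
  (trans (cong (1ℚ ℚ.+_) (ℚ.*-zeroˡ q)) (ℚ.+-identityʳ 1ℚ)))
1-↑-bernoulli {q} 0≤q q≤1 (suc n) = begin
  (1ℚ ℚ.- q) ℚ.* (1ℚ ℚ.- q) ↑ n ℚ.* (1ℚ ℚ.+ ι (suc n) ℚ.* q)
    ≡⟨ cong (λ z → (1ℚ ℚ.- q) ℚ.* (1ℚ ℚ.- q) ↑ n ℚ.* (1ℚ ℚ.+ z ℚ.* q)) (ι-suc n) ⟩
  (1ℚ ℚ.- q) ℚ.* P ℚ.* (1ℚ ℚ.+ (1ℚ ℚ.+ ι n) ℚ.* q)
    ≡⟨ expand q P (ι n) ⟩
  P ℚ.* (1ℚ ℚ.+ ι n ℚ.* q) ℚ.- P ℚ.* ((1ℚ ℚ.+ ι n) ℚ.* (q ℚ.* q))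
    ≤⟨ ℚ.+-monoʳ-≤ (P ℚ.* (1ℚ ℚ.+ ι n ℚ.* q)) (ℚ.neg-antimono-≤
         (0≤* (0≤P n) (0≤* (subst (0ℚ ℚ.≤_) (ι-suc n) (0≤ι (suc n))) (0≤* 0≤q 0≤q)))) ⟩
  P ℚ.* (1ℚ ℚ.+ ι n ℚ.* q) ℚ.+ 0ℚ  ≡⟨ ℚ.+-identityʳ _ ⟩
  P ℚ.* (1ℚ ℚ.+ ι n ℚ.* q)         ≤⟨ 1-↑-bernoulli 0≤q q≤1 n ⟩
  1ℚ ∎
  where
  open ℚ.≤-Reasoning
  open +-*-Solver
  P : ℚ
  P = (1ℚ ℚ.- q) ↑ n
  0≤P : ∀ n → 0ℚ ℚ.≤ (1ℚ ℚ.- q) ↑ n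
  0≤P zero    = 0≤1
  0≤P (suc n) = 0≤* (0≤-diff q≤1) (0≤P n)
  expand : ∀ q P n → (1ℚ ℚ.- q) ℚ.* P ℚ.* (1ℚ ℚ.+ (1ℚ ℚ.+ n) ℚ.* q) ≡
           P ℚ.* (1ℚ ℚ.+ n ℚ.* q) ℚ.- P ℚ.* ((1ℚ ℚ.+ n) ℚ.* (q ℚ.* q))
  expand = solve 3 (λ q P n → (con 1ℚ :- q) :* P :* (con 1ℚ :+ (con 1ℚ :+ n) :* q) :=
    P :* (con 1ℚ :+ n :* q) :- P :* ((con 1ℚ :+ n) :* (q :* q))) refl

0≤↑ : ∀ {x} → 0ℚ ℚ.≤ x → ∀ n → 0ℚ ℚ.≤ x ↑ n
0≤↑ 0≤x zero    = 0≤1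
0≤↑ 0≤x (suc n) = 0≤* 0≤x (0≤↑ 0≤x n)

↑-monoˡ : ∀ {x y} → 0ℚ ℚ.≤ x → x ℚ.≤ y → ∀ n → x ↑ n ℚ.≤ y ↑ n
↑-monoˡ 0≤x x≤y zero    = ℚ.≤-refl
↑-monoˡ 0≤x x≤y (suc n) = ℚ.≤-trans (mulʳ (0≤↑ 0≤x n) x≤y) (mulˡ (ℚ.≤-trans 0≤x x≤y) (↑-monoˡ 0≤x x≤y n))

↑≤1 : ∀ {x} → 0ℚ ℚ.≤ x → x ℚ.≤ 1ℚ → ∀ n → x ↑ n ℚ.≤ 1ℚ
↑≤1 0≤x x≤1 zero    = ℚ.≤-refl
↑≤1 {x} 0≤x x≤1 (suc n) = ℚ.≤-trans (mulˡ 0≤x (↑≤1 0≤x x≤1 n))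
  (ℚ.≤-trans (ℚ.≤-reflexive (ℚ.*-identityʳ x)) x≤1)

↑-antimonoʳ : ∀ {x} → 0ℚ ℚ.≤ x → x ℚ.≤ 1ℚ → ∀ {m n} → m ℕ.≤ n → x ↑ n ℚ.≤ x ↑ m
↑-antimonoʳ {x} 0≤x x≤1 {m} m≤n with ℕ.m≤n⇒∃[o]m+o≡n m≤n
... | k , refl = begin
  x ↑ (m ℕ.+ k)      ≡⟨ ^-homo-* x m k ⟩
  x ↑ m ℚ.* x ↑ k    ≤⟨ mulˡ (0≤↑ 0≤x m) (↑≤1 0≤x x≤1 k) ⟩
  x ↑ m ℚ.* 1ℚ       ≡⟨ ℚ.*-identityʳ _ ⟩
  x ↑ m              ∎
  where open ℚ.≤-Reasoning

half-power : ∀ {q} → 0ℚ ℚ.≤ q → q ℚ.≤ 1ℚ → ∀ L → 1ℚ ℚ.≤ ι L ℚ.* q → (1ℚ ℚ.- q) ↑ L ℚ.≤ ½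
half-power {q} 0≤q q≤1 L h = ℚ.*-cancelʳ-≤-pos (1ℚ ℚ.+ 1ℚ) (ℚ.≤-trans
  (mulˡ (0≤↑ (0≤-diff q≤1) L) (ℚ.+-monoʳ-≤ 1ℚ h)) (1-↑-bernoulli 0≤q q≤1 L))

-- The expectation of `f` at a random subset that contains each element independently with
-- probability `q`. It is a polynomial in `q` and is meaningful outside [0,1].
Exp : ℚ → ∀ {m} → (Subset m → ℚ) → ℚ
Exp q {zero}  f = f []
Exp q {suc m} f = q ℚ.* Exp q (f ∘ (true ∷_)) ℚ.+ (1ℚ ℚ.- q) ℚ.* Exp q (f ∘ (false ∷_))

Total : ∀ {m} → (Subset m → ℚ) → ℚ
Total {zero}  f = f []
Total {suc m} f = Total (f ∘ (true ∷_)) ℚ.+ Total (f ∘ (false ∷_))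

module _ where
  open +-*-Solver

  Exp-+ : ∀ q {m} (f g : Subset m → ℚ) → Exp q (λ S → f S ℚ.+ g S) ≡ Exp q f ℚ.+ Exp q g
  Exp-+ q {zero}  f g = refl
  Exp-+ q {suc m} f g = trans
    (cong₂ (λ x y → q ℚ.* x ℚ.+ (1ℚ ℚ.- q) ℚ.* y) (Exp-+ q (f ∘ (true ∷_)) _) (Exp-+ q (f ∘ (false ∷_)) _))
    (solve 6 (λ q r a b c d → q :* (a :+ b) :+ r :* (c :+ d) := (q :* a :+ r :* c) :+ (q :* b :+ r :* d)) refl
      q (1ℚ ℚ.- q) _ _ _ _)

  Exp-const : ∀ q {m} x → Exp q {m} (λ _ → x) ≡ x
  Exp-const q {zero}  x = refl
  Exp-const q {suc m} x = trans (cong (λ y → q ℚ.* y ℚ.+ (1ℚ ℚ.- q) ℚ.* y) (Exp-const q {m} x))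
    (solve 2 (λ q x → q :* x :+ (con 1ℚ :- q) :* x := x) refl q x)

Exp-cong : ∀ q {m} {f g : Subset m → ℚ} → (∀ S → f S ≡ g S) → Exp q f ≡ Exp q g
Exp-cong q {zero}  h = h []
Exp-cong q {suc m} h = cong₂ (λ x y → q ℚ.* x ℚ.+ (1ℚ ℚ.- q) ℚ.* y)
  (Exp-cong q (h ∘ (true ∷_))) (Exp-cong q (h ∘ (false ∷_)))

Exp-Total : ∀ q {m n} (g : Subset n → Subset m → ℚ) →
            Exp q (λ S → Total λ A → g A S) ≡ Total λ A → Exp q (g A)
Exp-Total q {n = zero}  g = refl
Exp-Total q {n = suc n} g = trans (Exp-+ q (λ S → Total λ A → g (true ∷ A) S) _)
  (cong₂ ℚ._+_ (Exp-Total q (g ∘ (true ∷_))) (Exp-Total q (g ∘ (false ∷_))))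

-- The counting half of a union bound over all `2^n` subsets.
Total-bound : ∀ {n} x (f : Subset n → ℚ) → (∀ A → f A ℚ.≤ ½ ↑ n ℚ.* x) → Total f ℚ.≤ x
Total-bound {zero}  x f h = ℚ.≤-trans (h []) (ℚ.≤-reflexive (ℚ.*-identityˡ x))
Total-bound {suc n} x f h = begin
  Total (f ∘ (true ∷_)) ℚ.+ Total (f ∘ (false ∷_)) ≤⟨ ℚ.+-mono-≤ (half true) (half false) ⟩
  ½ ℚ.* x ℚ.+ ½ ℚ.* x                              ≡⟨ ℚ.*-distribʳ-+ x ½ ½ ⟨
  1ℚ ℚ.* x                                         ≡⟨ ℚ.*-identityˡ x ⟩
  x                                                ∎
  where
  open ℚ.≤-Reasoning
  half : ∀ b → Total (f ∘ (b ∷_)) ℚ.≤ ½ ℚ.* x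
  half b = Total-bound (½ ℚ.* x) (f ∘ (b ∷_)) λ A → ℚ.≤-trans (h (b ∷ A)) (ℚ.≤-reflexive
    (trans (cong (ℚ._* x) (ℚ.*-comm ½ (½ ↑ n))) (ℚ.*-assoc (½ ↑ n) ½ x)))

Total-0≤ : ∀ {n} (f : Subset n → ℚ) → (∀ A → 0ℚ ℚ.≤ f A) → 0ℚ ℚ.≤ Total f
Total-0≤ {zero}  f h = h []
Total-0≤ {suc n} f h = ℚ.+-mono-≤ (Total-0≤ (f ∘ (true ∷_)) (h ∘ (true ∷_))) (Total-0≤ (f ∘ (false ∷_)) (h ∘ (false ∷_)))

term≤Total : ∀ {n} (f : Subset n → ℚ) → (∀ A → 0ℚ ℚ.≤ f A) → ∀ A → f A ℚ.≤ Total f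
term≤Total f h [] = ℚ.≤-refl
term≤Total f h (true ∷ A) = ℚ.≤-trans (ℚ.≤-reflexive (sym (ℚ.+-identityʳ _)))
  (ℚ.+-mono-≤ (term≤Total (f ∘ (true ∷_)) (h ∘ (true ∷_)) A) (Total-0≤ (f ∘ (false ∷_)) (h ∘ (false ∷_))))
term≤Total f h (false ∷ A) = ℚ.≤-trans (ℚ.≤-reflexive (sym (ℚ.+-identityˡ _)))
  (ℚ.+-mono-≤ (Total-0≤ (f ∘ (true ∷_)) (h ∘ (true ∷_))) (term≤Total (f ∘ (false ∷_)) (h ∘ (false ∷_)) A))

-- The indicator of `S` being disjoint from `F`, defined along the recursion of `Exp` so that its
-- expectation factorises.
avoids : ∀ {m} → Sub m → Subset m → ℚ
avoids {zero}  F []      = 1ℚ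
avoids {suc m} F (b ∷ S) = if F zero ∧ b then 0ℚ else avoids (F ∘ suc) S

avoids-0≤ : ∀ {m} (F : Sub m) S → 0ℚ ℚ.≤ avoids F S
avoids-0≤ F [] = 0≤1
avoids-0≤ F (b ∷ S) with F zero ∧ b
... | true  = ℚ.≤-refl
... | false = avoids-0≤ (F ∘ suc) S

avoids-1 : ∀ {m} (F : Sub m) S → (∀ {e} → e Subset.∈ S → e ∉ F) → avoids F S ≡ 1ℚ
avoids-1 F [] h = refl
avoids-1 F (b ∷ S) h with F zero in eq | b
... | true  | true  = contradiction (mem eq) (h Vec.here)
... | true  | false = avoids-1 (F ∘ suc) S λ { e∈ (mem f) → h (Vec.there e∈) (mem f) }
... | false | b     = avoids-1 (F ∘ suc) S λ { e∈ (mem f) → h (Vec.there e∈) (mem f) }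

Exp-avoids : ∀ q {m} (F : Sub m) → Exp q (avoids F) ≡ (1ℚ ℚ.- q) ↑ # F
Exp-avoids q {zero}  F = refl
Exp-avoids q {suc m} F with F zero
... | true  = trans (cong₂ (λ x y → q ℚ.* x ℚ.+ (1ℚ ℚ.- q) ℚ.* y) (Exp-const q {m} 0ℚ) (Exp-avoids q (F ∘ suc)))
                    (trans (cong (ℚ._+ (1ℚ ℚ.- q) ℚ.* (1ℚ ℚ.- q) ↑ # (F ∘ suc)) (ℚ.*-zeroʳ q)) (ℚ.+-identityˡ _))
... | false = trans (cong (λ y → q ℚ.* y ℚ.+ (1ℚ ℚ.- q) ℚ.* y) (Exp-avoids q (F ∘ suc)))
    (solve 2 (λ q x → q :* x :+ (con 1ℚ :- q) :* x := x) refl q _)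
  where open +-*-Solver

module _ {q} (0≤q : 0ℚ ℚ.≤ q) (q≤1 : q ℚ.≤ 1ℚ) where
  Exp-mono : ∀ {m} {f g : Subset m → ℚ} → (∀ S → f S ℚ.≤ g S) → Exp q f ℚ.≤ Exp q g
  Exp-mono {zero}  h = h []
  Exp-mono {suc m} h = ℚ.+-mono-≤ (mulˡ 0≤q (Exp-mono (h ∘ (true ∷_))))
                                  (mulˡ (0≤-diff q≤1) (Exp-mono (h ∘ (false ∷_))))

  Exp-0≤ : ∀ {m} {f : Subset m → ℚ} → (∀ S → 0ℚ ℚ.≤ f S) → 0ℚ ℚ.≤ Exp q f
  Exp-0≤ {m} h = ℚ.≤-trans (ℚ.≤-reflexive (sym (Exp-const q {m} 0ℚ))) (Exp-mono h)

  Exp-≤1 : ∀ {m} {f : Subset m → ℚ} → (∀ S → f S ℚ.≤ 1ℚ) → Exp q f ℚ.≤ 1ℚ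
  Exp-≤1 {m} h = ℚ.≤-trans (Exp-mono h) (ℚ.≤-reflexive (Exp-const q {m} 1ℚ))

2ℚ : ℚ
2ℚ = 1ℚ ℚ.+ 1ℚ

-- A Lipschitz constant read off the induction in `Exp-lipschitz`: two recursive terms with factor
-- 2, and two terms from the change of the coefficients. Its size is harmless, as the precision of
-- `p n` is chosen after `n`.
lip : ℕ → ℚ
lip zero    = 1ℚ
lip (suc m) = (2ℚ ℚ.+ 2ℚ) ℚ.* lip m ℚ.+ 2ℚ

0≤2 : 0ℚ ℚ.≤ 2ℚ
0≤2 = ℚ.+-mono-≤ 0≤1 0≤1

lip-≥1 : ∀ m → 1ℚ ℚ.≤ lip m
lip-≥1 zero    = ℚ.≤-refl
lip-≥1 (suc m) = ℚ.≤-trans (ℚ.+-mono-≤ (0≤* (ℚ.+-mono-≤ 0≤2 0≤2) (ℚ.≤-trans 0≤1 (lip-≥1 m))) (ℚ.+-mono-≤ 0≤1 (ℚ.≤-refl {1ℚ})))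
                          (ℚ.≤-refl)

-- The bounds on q hold near [0,1], where Exp q need not be monotone.
Exp-lipschitz : ∀ {q c} → ℚ.∣ q ∣ ℚ.≤ 2ℚ → ℚ.∣ 1ℚ ℚ.- q ∣ ℚ.≤ 2ℚ → 0ℚ ℚ.≤ c → c ℚ.≤ 1ℚ →
                ∀ {m} (f : Subset m → ℚ) → (∀ S → 0ℚ ℚ.≤ f S) → (∀ S → f S ℚ.≤ 1ℚ) →
                ℚ.∣ Exp q f ℚ.- Exp c f ∣ ℚ.≤ lip m ℚ.* ℚ.∣ q ℚ.- c ∣
Exp-lipschitz {q} {c} hq hq′ 0≤c c≤1 {zero} f 0≤f f≤1 = begin
  ℚ.∣ f [] ℚ.- f [] ∣     ≡⟨ cong ℚ.∣_∣ (ℚ.+-inverseʳ (f [])) ⟩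
  0ℚ                      ≤⟨ 0≤* 0≤1 (ℚ.0≤∣p∣ (q ℚ.- c)) ⟩
  1ℚ ℚ.* ℚ.∣ q ℚ.- c ∣    ∎
  where open ℚ.≤-Reasoning
Exp-lipschitz {q} {c} hq hq′ 0≤c c≤1 {suc m} f 0≤f f≤1 = begin
  ℚ.∣ (q ℚ.* a ℚ.+ (1ℚ ℚ.- q) ℚ.* b) ℚ.- (c ℚ.* a′ ℚ.+ (1ℚ ℚ.- c) ℚ.* b′) ∣
    ≡⟨ cong ℚ.∣_∣ (regroup q c a b a′ b′) ⟩
  ℚ.∣ (q ℚ.* (a ℚ.- a′) ℚ.+ (1ℚ ℚ.- q) ℚ.* (b ℚ.- b′)) ℚ.+ (a′ ℚ.* (q ℚ.- c) ℚ.- b′ ℚ.* (q ℚ.- c)) ∣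
    ≤⟨ ℚ.≤-trans (ℚ.∣p+q∣≤∣p∣+∣q∣ (q ℚ.* (a ℚ.- a′) ℚ.+ (1ℚ ℚ.- q) ℚ.* (b ℚ.- b′)) (a′ ℚ.* (q ℚ.- c) ℚ.- b′ ℚ.* (q ℚ.- c)))
         (ℚ.+-mono-≤ (ℚ.∣p+q∣≤∣p∣+∣q∣ (q ℚ.* (a ℚ.- a′)) ((1ℚ ℚ.- q) ℚ.* (b ℚ.- b′)))
                     (ℚ.∣p-q∣≤∣p∣+∣q∣ (a′ ℚ.* (q ℚ.- c)) (b′ ℚ.* (q ℚ.- c)))) ⟩
  (ℚ.∣ q ℚ.* (a ℚ.- a′) ∣ ℚ.+ ℚ.∣ (1ℚ ℚ.- q) ℚ.* (b ℚ.- b′) ∣) ℚ.+ (ℚ.∣ a′ ℚ.* (q ℚ.- c) ∣ ℚ.+ ℚ.∣ b′ ℚ.* (q ℚ.- c) ∣)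
    ≤⟨ ℚ.+-mono-≤ (ℚ.+-mono-≤ (prod hq 0≤2 (Exp-lipschitz hq hq′ 0≤c c≤1 (f ∘ (true ∷_)) (0≤f ∘ (true ∷_)) (f≤1 ∘ (true ∷_))))
                              (prod hq′ 0≤2 (Exp-lipschitz hq hq′ 0≤c c≤1 (f ∘ (false ∷_)) (0≤f ∘ (false ∷_)) (f≤1 ∘ (false ∷_)))))
                  (ℚ.+-mono-≤ (prod (unit true) 0≤1 ℚ.≤-refl) (prod (unit false) 0≤1 ℚ.≤-refl)) ⟩
  (2ℚ ℚ.* (lip m ℚ.* d) ℚ.+ 2ℚ ℚ.* (lip m ℚ.* d)) ℚ.+ (1ℚ ℚ.* d ℚ.+ 1ℚ ℚ.* d)
    ≡⟨ collect (lip m) d ⟩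
  lip (suc m) ℚ.* d ∎
  where
  open ℚ.≤-Reasoning
  open +-*-Solver
  a b a′ b′ d : ℚ
  a  = Exp q (f ∘ (true ∷_))
  b  = Exp q (f ∘ (false ∷_))
  a′ = Exp c (f ∘ (true ∷_))
  b′ = Exp c (f ∘ (false ∷_))
  d  = ℚ.∣ q ℚ.- c ∣
  unit : ∀ x → ℚ.∣ Exp c (f ∘ (x ∷_)) ∣ ℚ.≤ 1ℚ
  unit x = ℚ.≤-trans (ℚ.≤-reflexive (ℚ.0≤p⇒∣p∣≡p (Exp-0≤ 0≤c c≤1 (0≤f ∘ (x ∷_))))) (Exp-≤1 0≤c c≤1 (f≤1 ∘ (x ∷_)))
  prod : ∀ {x y M N} → ℚ.∣ x ∣ ℚ.≤ M → 0ℚ ℚ.≤ M → ℚ.∣ y ∣ ℚ.≤ N → ℚ.∣ x ℚ.* y ∣ ℚ.≤ M ℚ.* N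
  prod {x} {y} hx 0≤M hy = ℚ.≤-trans (ℚ.≤-reflexive (ℚ.∣p*q∣≡∣p∣*∣q∣ x y))
    (ℚ.≤-trans (mulʳ (ℚ.0≤∣p∣ y) hx) (mulˡ 0≤M hy))
  regroup : ∀ q c a b a′ b′ →
    (q ℚ.* a ℚ.+ (1ℚ ℚ.- q) ℚ.* b) ℚ.- (c ℚ.* a′ ℚ.+ (1ℚ ℚ.- c) ℚ.* b′) ≡
    (q ℚ.* (a ℚ.- a′) ℚ.+ (1ℚ ℚ.- q) ℚ.* (b ℚ.- b′)) ℚ.+ (a′ ℚ.* (q ℚ.- c) ℚ.- b′ ℚ.* (q ℚ.- c))
  regroup = solve 6 (λ q c a b a′ b′ →
    (q :* a :+ (con 1ℚ :- q) :* b) :- (c :* a′ :+ (con 1ℚ :- c) :* b′) :=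
    (q :* (a :- a′) :+ (con 1ℚ :- q) :* (b :- b′)) :+ (a′ :* (q :- c) :- b′ :* (q :- c))) refl
  collect : ∀ k d → (2ℚ ℚ.* (k ℚ.* d) ℚ.+ 2ℚ ℚ.* (k ℚ.* d)) ℚ.+ (1ℚ ℚ.* d ℚ.+ 1ℚ ℚ.* d)
                  ≡ ((2ℚ ℚ.+ 2ℚ) ℚ.* k ℚ.+ 2ℚ) ℚ.* d
  collect = solve 2 (λ k d → (con 2ℚ :* (k :* d) :+ con 2ℚ :* (k :* d)) :+ (con 1ℚ :* d :+ con 1ℚ :* d)
                  := ((con 2ℚ :+ con 2ℚ) :* k :+ con 2ℚ) :* d) refl

-- The probability of a graph event as an expectation

sumℚ : List ℚ → ℚ
sumℚ = List.foldr ℚ._+_ 0ℚ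

weightℚ : ℚ → ∀ {m} → Subset m → ℚ
weightℚ q []      = 1ℚ
weightℚ q (b ∷ S) = (if b then q else 1ℚ ℚ.- q) ℚ.* weightℚ q S

seq-weight : ∀ p k {m} (S : Subset m) → ℝ.seq (weight p S) k ≡ weightℚ (ℝ.seq p k) S
seq-weight p k []          = refl
seq-weight p k (true ∷ S)  = cong (ℝ.seq p k ℚ.*_) (seq-weight p k S)
seq-weight p k (false ∷ S) = cong ((1ℚ ℚ.- ℝ.seq p k) ℚ.*_) (seq-weight p k S)

sum-allSubsets : ∀ q m (f : Subset m → ℚ) →
  sumℚ (List.map (λ S → f S ℚ.* weightℚ q S) (allSubsets m)) ≡ Exp q f
sum-allSubsets q zero f = trans (ℚ.+-identityʳ _) (ℚ.*-identityʳ _)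
sum-allSubsets q (suc m) f = trans (split (allSubsets m)) (cong₂ ℚ._+_
  (trans (scaled q true refl (allSubsets m)) (cong (q ℚ.*_) (sum-allSubsets q m (f ∘ (true ∷_)))))
  (trans (scaled (1ℚ ℚ.- q) false refl (allSubsets m)) (cong ((1ℚ ℚ.- q) ℚ.*_) (sum-allSubsets q m (f ∘ (false ∷_))))))
  where
  open +-*-Solver
  g : Subset (suc m) → ℚ
  g S = f S ℚ.* weightℚ q S
  sum-++ : ∀ xs ys → sumℚ (List.map g (xs ++ ys)) ≡ sumℚ (List.map g xs) ℚ.+ sumℚ (List.map g ys)
  sum-++ []       ys = sym (ℚ.+-identityˡ _)
  sum-++ (x ∷ xs) ys = trans (cong (g x ℚ.+_) (sum-++ xs ys)) (sym (ℚ.+-assoc (g x) _ _))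
  split : ∀ xs → sumℚ (List.map g (List.map (true ∷_) xs ++ List.map (false ∷_) xs)) ≡
                 sumℚ (List.map g (List.map (true ∷_) xs)) ℚ.+ sumℚ (List.map g (List.map (false ∷_) xs))
  split xs = sum-++ (List.map (true ∷_) xs) (List.map (false ∷_) xs)
  scaled : ∀ β b → (if b then q else 1ℚ ℚ.- q) ≡ β → ∀ xs →
           sumℚ (List.map g (List.map (b ∷_) xs)) ≡ β ℚ.* sumℚ (List.map (λ S → f (b ∷ S) ℚ.* weightℚ q S) xs)
  scaled β b eq []       = sym (ℚ.*-zeroʳ β)
  scaled β b refl (x ∷ xs) = trans (cong (g (b ∷ x) ℚ.+_) (scaled β b refl xs))
    (solve 4 (λ u β w s → u :* (β :* w) :+ β :* s := β :* (u :* w :+ s)) refl (f (b ∷ x)) β (weightℚ q x) _)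

indicator : Bool → ℚ
indicator b = if b then 1ℚ else 0ℚ

module _ (p : ℝ) (k : ℕ) {m} (B : Subset m → Bool) where
  private
    q : ℚ
    q = ℝ.seq p k

    term : ∀ b (S : Subset m) → ℝ.seq (if b then weight p S else 0ℝ) k ≡ indicator b ℚ.* weightℚ q S
    term true  S = trans (seq-weight p k S) (sym (ℚ.*-identityˡ (weightℚ q S)))
    term false S = sym (ℚ.*-zeroˡ (weightℚ q S))

    summands : List (Subset m) → List ℝ
    summands = List.map λ S → if B S then weight p S else 0ℝ

  seq-sum : ∀ xs → ℝ.seq (sumℝ (summands xs)) k ≡ sumℚ (List.map (λ S → indicator (B S) ℚ.* weightℚ q S) xs)
  seq-sum []       = refl
  seq-sum (S ∷ xs) = cong₂ ℚ._+_ {x = ℝ.seq (if B S then weight p S else 0ℝ) k} (term (B S) S) (seq-sum xs)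

-- Real arithmetic acts termwise on the approximating sequences, which reduces statements about `Pr`
-- to one polynomial evaluated at the rational approximations of `p`.
seq-Pr : ∀ n p (B : Graph n → Bool) k → ℝ.seq (Pr n p B) k ≡ Exp (ℝ.seq p k) (indicator ∘ B ∘ mkGraph)
seq-Pr n p B k = trans (cong (λ rs → ℝ.seq (sumℝ rs) k) (sym (List.map-∘ (allSubsets (#pairs n)))))
  (trans (seq-sum p k (B ∘ mkGraph) (allSubsets (#pairs n)))
         (sum-allSubsets (ℝ.seq p k) (#pairs n) (indicator ∘ B ∘ mkGraph)))

Exp-not : ∀ q {m} (B : Subset m → Bool) → Exp q (indicator ∘ B) ≡ 1ℚ ℚ.- Exp q (indicator ∘ not ∘ B)
Exp-not q {m} B = isolate (Exp q (indicator ∘ B)) (Exp q (indicator ∘ not ∘ B))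
  (trans (sym (Exp-+ q (indicator ∘ B) (indicator ∘ not ∘ B)))
         (trans (Exp-cong q (λ S → complement (B S))) (Exp-const q {m} 1ℚ)))
  where
  open +-*-Solver
  complement : ∀ b → indicator b ℚ.+ indicator (not b) ≡ 1ℚ
  complement true  = refl
  complement false = refl
  isolate : ∀ x y → x ℚ.+ y ≡ 1ℚ → x ≡ 1ℚ ℚ.- y
  isolate x y eq = trans (solve 2 (λ x y → x := (x :+ y) :- y) refl x y) (cong (ℚ._- y) eq)

-- Holes are unlikely

sum-lookup : ∀ {X : Set} (xs : List X) (g : X → ℕ) → sum (g ∘ List.lookup xs) ≡ sumᴸ (List.map g xs)
sum-lookup []       g = refl
sum-lookup (x ∷ xs) g = cong (λ z → g x + z) (sum-lookup xs g)

sum-filter : ∀ {X : Set} {P : X → Set} (P? : ∀ x → Dec (P x)) (g : X → ℕ) xs →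
  sumᴸ (List.map g (List.filter P? xs)) ≡ sumᴸ (List.map (λ x → χ (does (P? x)) * g x) xs)
sum-filter P? g [] = refl
sum-filter P? g (x ∷ xs) with P? x
... | yes _ = cong₂ _+_ (sym (ℕ.+-identityʳ (g x))) (sum-filter P? g xs)
... | no _  = sum-filter P? g xs

sum-tabulate : ∀ {n} {X : Set} (g : X → ℕ) (f : Fin n → X) → sumᴸ (List.map g (List.tabulate f)) ≡ sum (g ∘ f)
sum-tabulate {zero}  g f = refl
sum-tabulate {suc n} g f = cong (λ z → g (f zero) + z) (sum-tabulate g (f ∘ suc))

sum-cartesianProduct : ∀ {X Y : Set} (g : X × Y → ℕ) xs ys → sumᴸ (List.map g (List.cartesianProduct xs ys)) ≡
  sumᴸ (List.map (λ x → sumᴸ (List.map (λ y → g (x , y)) ys)) xs)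
sum-cartesianProduct g []       ys = refl
sum-cartesianProduct g (x ∷ xs) ys = begin
  sumᴸ (List.map g (List.map (x ,_) ys ++ List.cartesianProduct xs ys))
    ≡⟨ cong sumᴸ (List.map-++ g (List.map (x ,_) ys) _) ⟩
  sumᴸ (List.map g (List.map (x ,_) ys) ++ List.map g (List.cartesianProduct xs ys))
    ≡⟨ sumᴸ-++ (List.map g (List.map (x ,_) ys)) _ ⟩
  sumᴸ (List.map g (List.map (x ,_) ys)) + sumᴸ (List.map g (List.cartesianProduct xs ys))
    ≡⟨ cong₂ _+_ (cong sumᴸ (sym (List.map-∘ ys))) (sum-cartesianProduct g xs ys) ⟩
  _ ∎
  where open ≡-Reasoning

sum-edges : ∀ n (g : Fin n × Fin n → ℕ) →
  sum (g ∘ ends n) ≡ sum λ i → sum λ j → χ (does (i Fin.<? j)) * g (i , j)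
sum-edges n g = begin
  sum (g ∘ ends n)                  ≡⟨ sum-lookup (pairs n) g ⟩
  sumᴸ (List.map g (pairs n))   ≡⟨ sum-filter (uncurry Fin._<?_) g (List.cartesianProduct (List.allFin n) (List.allFin n)) ⟩
  sumᴸ (List.map g′ (List.cartesianProduct (List.allFin n) (List.allFin n)))
    ≡⟨ sum-cartesianProduct g′ (List.allFin n) (List.allFin n) ⟩
  sumᴸ (List.map (λ i → sumᴸ (List.map (λ j → g′ (i , j)) (List.allFin n))) (List.allFin n))
    ≡⟨ sum-tabulate (λ i → sumᴸ (List.map (λ j → g′ (i , j)) (List.allFin n))) id ⟩
  sum (λ i → sumᴸ (List.map (λ j → g′ (i , j)) (List.allFin n)))
    ≡⟨ sum-cong-≗ (λ i → sum-tabulate (λ j → g′ (i , j)) id) ⟩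
  sum (λ i → sum λ j → g′ (i , j))  ∎
  where
  open ≡-Reasoning
  g′ : Fin n × Fin n → ℕ
  g′ x = χ (does (uncurry Fin._<?_ x)) * g x

module _ {n} (A B : Sub n) where
  Cross : Fin n × Fin n → Set
  Cross (u , v) = u ∈ A × v ∈ B ⊎ v ∈ A × u ∈ B

  cross? : ∀ x → Dec (Cross x)
  cross? (u , v) = u ∈? A ×-dec v ∈? B ⊎-dec v ∈? A ×-dec u ∈? B

  crossing : Sub (#pairs n)
  crossing = ⟦ (λ e → cross? (ends n e)) ⟧

  private
    φ : Fin n × Fin n → ℕ
    φ x = χ (does (cross? x))

    φ≡1 : ∀ {x} → Cross x → φ x ≡ 1
    φ≡1 {x} h = cong χ (dec-true (cross? x) h)

    ψ : Fin n → Fin n → ℕ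
    ψ i j = χ (does (i Fin.<? j)) * φ (i , j)

    ψ≡1 : ∀ {i j} → i Fin.< j → Cross (i , j) → ψ i j ≡ 1
    ψ≡1 {i} {j} i<j h = cong₂ _*_ (cong χ (dec-true (i Fin.<? j) i<j)) (φ≡1 h)

    pointwise : ∀ i j → χ (A i) * χ (B j) ≤ ψ i j + ψ j i + χ (⁅ i ⁆ j)
    pointwise i j with i ∈? A | j ∈? B
    ... | no i∉ | _ = ℕ.≤-trans (ℕ.*-monoˡ-≤ (χ (B j)) (χ-≤ A i {0} λ i∈ → contradiction i∈ i∉)) z≤n
    ... | yes _ | no j∉ = ℕ.≤-trans (ℕ.*-monoʳ-≤ (χ (A i)) (χ-≤ B j {0} λ j∈ → contradiction j∈ j∉))
          (ℕ.≤-trans (ℕ.≤-reflexive (ℕ.*-zeroʳ (χ (A i)))) z≤n)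
    ... | yes i∈ | yes j∈ = ℕ.≤-trans (ℕ.*-mono-≤ (χ≤1 (A i)) (χ≤1 (B j))) (case Fin.<-cmp i j of λ where
      (tri< i<j _ _) → ℕ.≤-trans (ℕ.≤-reflexive (sym (ψ≡1 i<j (inj₁ (i∈ , j∈)))))
                         (ℕ.≤-trans (ℕ.m≤m+n (ψ i j) (ψ j i)) (ℕ.m≤m+n _ _))
      (tri> _ _ j<i) → ℕ.≤-trans (ℕ.≤-reflexive (sym (ψ≡1 j<i (inj₂ (i∈ , j∈)))))
                         (ℕ.≤-trans (ℕ.m≤n+m (ψ j i) (ψ i j)) (ℕ.m≤m+n _ _))
      (tri≈ _ refl _) → ℕ.≤-trans (ℕ.≤-reflexive (sym (χ-∈ (∈⁅⁆⁺ i)))) (ℕ.m≤n+m _ (ψ i i + ψ i i)))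

  -- A pair of distinct vertices in `A × B` comes from a crossing edge, and each such edge is used
  -- at most twice, once per orientation; pairs on the diagonal number at most `n`.
  crossing-size : # A * # B ≤ # crossing + # crossing + n
  crossing-size = begin
    # A * # B                                 ≡⟨ *-distribʳ-sum (# B) (χ ∘ A) ⟩
    sum (λ i → χ (A i) * # B)                 ≡⟨ sum-cong-≗ (λ i → *-distribˡ-sum (χ (A i)) (χ ∘ B)) ⟩
    sum (λ i → sum λ j → χ (A i) * χ (B j))   ≤⟨ sum-mono-≤ (λ i → sum-mono-≤ (pointwise i)) ⟩
    sum (λ i → sum λ j → ψ i j + ψ j i + χ (⁅ i ⁆ j))
      ≡⟨ sum-cong-≗ (λ i → trans (∑-distrib-+ (λ j → ψ i j + ψ j i) (χ ∘ ⁅ i ⁆))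
                                 (cong₂ _+_ (∑-distrib-+ (ψ i) (flip ψ i)) (#-⁅⁆ i))) ⟩
    sum (λ i → sum (ψ i) + sum (flip ψ i) + 1)
      ≡⟨ trans (∑-distrib-+ (λ i → sum (ψ i) + sum (flip ψ i)) (λ _ → 1))
               (cong₂ _+_ (∑-distrib-+ (λ i → sum (ψ i)) (λ i → sum (flip ψ i))) (#-univ n)) ⟩
    sum (λ i → sum (ψ i)) + sum (λ i → sum (flip ψ i)) + n
      ≡⟨ cong (λ z → sum (λ i → sum (ψ i)) + z + n) (∑-comm (flip ψ)) ⟩
    sum (λ i → sum (ψ i)) + sum (λ i → sum (ψ i)) + n
      ≡⟨ cong (λ z → z + z + n) (sum-edges n φ) ⟨
    # crossing + # crossing + n ∎
    where open ℕ.≤-Reasoning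

-- `A × B` has at least `n² / D²` pairs; as `n ≥ 2D²`, the diagonal takes away at most half of that
-- bound.
crossing-large : ∀ D n a b f → n ≤ D * a → n ≤ D * b → 2 * (D * D) ≤ n → a * b ≤ f + f + n →
                 n * n ≤ 4 * (D * D) * f
crossing-large D n a b f ha hb hn h = ℕ.+-cancelʳ-≤ (n * n) (n * n) _ (begin
  n * n + n * n                           ≡⟨ cong (λ z → n * n + z) (ℕ.+-identityʳ (n * n)) ⟨
  2 * (n * n)                             ≤⟨ ℕ.*-monoʳ-≤ 2 (ℕ.*-mono-≤ ha hb) ⟩
  2 * (D * a * (D * b))                   ≡⟨ lem₁ D a b ⟩
  2 * (D * D) * (a * b)                   ≤⟨ ℕ.*-monoʳ-≤ (2 * (D * D)) h ⟩
  2 * (D * D) * (f + f + n)               ≡⟨ lem₂ (D * D) f n ⟩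
  4 * (D * D) * f + 2 * (D * D) * n       ≤⟨ ℕ.+-monoʳ-≤ _ (ℕ.*-monoˡ-≤ n hn) ⟩
  4 * (D * D) * f + n * n                 ∎)
  where
  open ℕ.≤-Reasoning
  lem₁ : ∀ D a b → 2 * (D * a * (D * b)) ≡ 2 * (D * D) * (a * b)
  lem₁ = solve-∀
  lem₂ : ∀ d f n → 2 * d * (f + f + n) ≡ 4 * d * f + 2 * d * n
  lem₂ = solve-∀

module Holes (D : ℕ) {n : ℕ} where

  Large : Subset n → Set
  Large A = n ≤ D * # (lookup A)

  large? : ∀ A → Dec (Large A)
  large? A = n ℕ.≤? D * # (lookup A)

  Missed : Subset n → Subset n → Subset (#pairs n) → Set
  Missed A B S = ¬ ∃ λ e → e Subset.∈ S × e ∈ crossing (lookup A) (lookup B)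

  Hole : Subset (#pairs n) → Subset n → Subset n → Set
  Hole S A B = Large A × Large B × Missed A B S

  missed? : ∀ A B S → Dec (Missed A B S)
  missed? A B S = ¬? (Fin.any? λ e → e Subset.∈? S ×-dec e ∈? crossing (lookup A) (lookup B))

  hole? : ∀ S → Dec (∃ λ A → ∃ λ B → Hole S A B)
  hole? S = Subset.anySubset? λ A → Subset.anySubset? λ B → large? A ×-dec large? B ×-dec missed? A B S

  noHole : Graph n → Bool
  noHole G = not (does (hole? (Graph.edges G)))

  noHole-sound : ∀ G → Bool.T (noHole G) → NoHole D (EdgeBetween G)
  noHole-sound G t A B hA hB = found (Fin.any? λ e → e Subset.∈? Graph.edges G ×-dec e ∈? crossing A′ B′)
    where
    A′ B′ : Sub n
    A′ = lookup (tabulate A)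
    B′ = lookup (tabulate B)
    absurd : ∀ {P : Set} (d : Dec P) → Bool.T (not (does d)) → ¬ P
    absurd (no ¬p) _ p = ¬p p
    same-size : ∀ (C : Sub n) → n ≤ D * # C → Large (tabulate C)
    same-size C h = subst (λ z → n ≤ D * z) (sum-cong-≗ λ i → cong χ (sym (Vec.lookup∘tabulate C i))) h
    back : ∀ {C : Sub n} {i} → i ∈ lookup (tabulate C) → i ∈ C
    back {C} {i} (mem h) = mem (trans (sym (Vec.lookup∘tabulate C i)) h)
    found : Dec (∃ λ e → e Subset.∈ Graph.edges G × e ∈ crossing A′ B′) →
            ∃₂ λ u v → u ∈ A × v ∈ B × EdgeBetween G u v
    found (no none) = contradiction (tabulate A , tabulate B , same-size A hA , same-size B hB , none)
                                    (absurd (hole? (Graph.edges G)) t)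
    found (yes (e , e∈ , c)) with ∈⁻ (λ e → cross? A′ B′ (ends n e)) c
    ... | inj₁ (u∈ , v∈) = _ , _ , back u∈ , back v∈ , e , e∈ , inj₁ refl
    ... | inj₂ (u∈ , v∈) = _ , _ , back u∈ , back v∈ , e , e∈ , inj₂ refl

  missing : Subset n → Subset n → Subset (#pairs n) → ℚ
  missing A B S = if does (large? A ×-dec large? B) then avoids (crossing (lookup A) (lookup B)) S else 0ℚ

  missing-0≤ : ∀ A B S → 0ℚ ℚ.≤ missing A B S
  missing-0≤ A B S with does (large? A ×-dec large? B)
  ... | true  = avoids-0≤ (crossing (lookup A) (lookup B)) S
  ... | false = ℚ.≤-refl

  missing-1 : ∀ A B S → Hole S A B → 1ℚ ℚ.≤ missing A B S
  missing-1 A B S (lA , lB , none) = ℚ.≤-reflexive (sym (trans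
    (cong (λ b → if b then avoids (crossing (lookup A) (lookup B)) S else 0ℚ) (dec-true (large? A ×-dec large? B) (lA , lB)))
    (avoids-1 (crossing (lookup A) (lookup B)) S λ {e} e∈ e∈F → none (e , e∈ , e∈F))))

  union-bound : ∀ S → indicator (does (hole? S)) ℚ.≤ Total λ A → Total λ B → missing A B S
  union-bound S = go (hole? S)
    where
    inner-0≤ : ∀ A → 0ℚ ℚ.≤ Total λ B → missing A B S
    inner-0≤ A = Total-0≤ (λ B → missing A B S) λ B → missing-0≤ A B S
    go : (d : Dec (∃ λ A → ∃ λ B → Hole S A B)) → indicator (does d) ℚ.≤ Total λ A → Total λ B → missing A B S
    go (no _) = Total-0≤ (λ A → Total λ B → missing A B S) inner-0≤
    go (yes (A , B , h)) = ℚ.≤-trans (missing-1 A B S h) (ℚ.≤-trans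
      (term≤Total (λ B → missing A B S) (λ B → missing-0≤ A B S) B)
      (term≤Total (λ A → Total λ B → missing A B S) inner-0≤ A))

  module _ (D≥1 : 1 ≤ D) (n-large : 12 * (D * D) ≤ n)
           {q : ℚ} (0≤q : 0ℚ ℚ.≤ q) (q≤1 : q ℚ.≤ 1ℚ) (dense : ι (24 * (D * D)) ℚ.≤ q ℚ.* ι n) where
    private
      D² N L : ℕ
      D² = D * D
      N = 12 * D²
      D²≥1 : 1 ≤ D²
      D²≥1 = ℕ.*-mono-≤ D≥1 D≥1
      N≢0 : NonZero N
      N≢0 = >-nonZero (ℕ.*-mono-≤ {1} {12} (s≤s z≤n) D²≥1)
      L = _/_ n N {{N≢0}}

      n≤24D²L : n ≤ 24 * D² * L
      n≤24D²L = begin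
        n                    ≡⟨ ℕ.m≡m%n+[m/n]*n n N {{N≢0}} ⟩
        (n % N) {{N≢0}} + L * N        ≤⟨ ℕ.+-monoˡ-≤ (L * N) (ℕ.<⇒≤ (ℕ.m%n<n n N {{N≢0}})) ⟩
        N + L * N            ≤⟨ ℕ.+-monoˡ-≤ (L * N) (ℕ.m≤n*m N L {{>-nonZero (ℕ.m≥n⇒m/n>0 {{N≢0}} n-large)}}) ⟩
        L * N + L * N        ≡⟨ lem L D² ⟩
        24 * D² * L          ∎
        where
        open ℕ.≤-Reasoning
        lem : ∀ L d → L * (12 * d) + L * (12 * d) ≡ 24 * d * L
        lem = solve-∀

      Lq≥1 : 1ℚ ℚ.≤ ι L ℚ.* q
      Lq≥1 = ℚ.*-cancelˡ-≤-pos (ι (24 * D²)) {{ℚ.normalize-pos (24 * D²) 1 {{_}} {{>-nonZero (ℕ.*-mono-≤ {1} {24} (s≤s z≤n) D²≥1)}}}} (begin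
        ι (24 * D²) ℚ.* 1ℚ             ≡⟨ ℚ.*-identityʳ _ ⟩
        ι (24 * D²)                    ≤⟨ dense ⟩
        q ℚ.* ι n                      ≤⟨ mulˡ 0≤q (ι-mono n≤24D²L) ⟩
        q ℚ.* ι (24 * D² * L)          ≡⟨ ℚ.*-comm q _ ⟩
        ι (24 * D² * L) ℚ.* q          ≡⟨ cong (ℚ._* q) (ι-* (24 * D²) L) ⟩
        ι (24 * D²) ℚ.* ι L ℚ.* q      ≡⟨ ℚ.*-assoc (ι (24 * D²)) (ι L) q ⟩
        ι (24 * D²) ℚ.* (ι L ℚ.* q)    ∎)
        where open ℚ.≤-Reasoning

      long : ∀ f → n * n ≤ 4 * D² * f → L * (n + (n + n)) ≤ f
      long f h = ℕ.*-cancelˡ-≤ (4 * D²) {{>-nonZero (ℕ.*-mono-≤ {1} {4} (s≤s z≤n) D²≥1)}} (begin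
        4 * D² * (L * (n + (n + n)))  ≡⟨ lem D² L n ⟩
        L * N * n                     ≤⟨ ℕ.*-monoˡ-≤ n (ℕ.m/n*n≤m n N {{N≢0}}) ⟩
        n * n                         ≤⟨ h ⟩
        4 * D² * f                    ∎)
        where
        open ℕ.≤-Reasoning
        lem : ∀ d L n → 4 * d * (L * (n + (n + n))) ≡ L * (12 * d) * n
        lem = solve-∀

      tiny : ℚ
      tiny = ½ ↑ n ℚ.* (½ ↑ n ℚ.* ½ ↑ n)

      0≤½ : 0ℚ ℚ.≤ ½
      0≤½ = ℚ.nonNegative⁻¹ ½

      0≤½^ : ∀ k → 0ℚ ℚ.≤ ½ ↑ k
      0≤½^ = 0≤↑ 0≤½

      missing-tiny : ∀ A B → Exp q (missing A B) ℚ.≤ tiny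
      missing-tiny A B = go (large? A ×-dec large? B)
        where
        F : Sub (#pairs n)
        F = crossing (lookup A) (lookup B)
        go : (d : Dec (Large A × Large B)) → Exp q (λ S → if does d then avoids F S else 0ℚ) ℚ.≤ tiny
        go (no _) = ℚ.≤-trans (ℚ.≤-reflexive (Exp-const q {#pairs n} 0ℚ)) (0≤* (0≤½^ n) (0≤* (0≤½^ n) (0≤½^ n)))
        go (yes (lA , lB)) = begin
          Exp q (avoids F)                   ≡⟨ Exp-avoids q F ⟩
          (1ℚ ℚ.- q) ↑ # F                   ≤⟨ ↑-antimonoʳ 0≤r r≤1 (long (# F) (crossing-large D n (# (lookup A)) (# (lookup B)) (# F) lA lB
            (ℕ.≤-trans (ℕ.*-monoˡ-≤ D² {2} {12} (s≤s (s≤s z≤n))) n-large) (crossing-size (lookup A) (lookup B)))) ⟩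
          (1ℚ ℚ.- q) ↑ (L * (n + (n + n)))   ≡⟨ ^-assocʳ (1ℚ ℚ.- q) L (n + (n + n)) ⟨
          ((1ℚ ℚ.- q) ↑ L) ↑ (n + (n + n))   ≤⟨ ↑-monoˡ (0≤↑ 0≤r L) (half-power 0≤q q≤1 L Lq≥1) (n + (n + n)) ⟩
          ½ ↑ (n + (n + n))                  ≡⟨ ^-homo-* ½ n (n + n) ⟩
          ½ ↑ n ℚ.* ½ ↑ (n + n)              ≡⟨ cong (½ ↑ n ℚ.*_) (^-homo-* ½ n n) ⟩
          tiny                               ∎
          where
          open ℚ.≤-Reasoning
          0≤r : 0ℚ ℚ.≤ 1ℚ ℚ.- q
          0≤r = 0≤-diff q≤1
          r≤1 : 1ℚ ℚ.- q ℚ.≤ 1ℚ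
          r≤1 = ℚ.≤-trans (ℚ.+-monoʳ-≤ 1ℚ (ℚ.neg-antimono-≤ 0≤q)) (ℚ.≤-reflexive (ℚ.+-identityʳ 1ℚ))

    -- With `L` the integer part of `n / 12D²`, two large sets have at least `n² / 4D² ≥ 3nL`
    -- crossing edges, and `Lq ≥ 1` makes `(1 - q)^L` at most one half. So a given pair is missed
    -- with probability at most `2^(-3n)`, and the `4^n` pairs of sets leave `2^(-n)`.
    hole-unlikely : Exp q (λ S → indicator (does (hole? S))) ℚ.≤ ½ ↑ n
    hole-unlikely = begin
      Exp q (λ S → indicator (does (hole? S)))               ≤⟨ Exp-mono 0≤q q≤1 union-bound ⟩
      Exp q (λ S → Total λ A → Total λ B → missing A B S)    ≡⟨ Exp-Total q (λ A S → Total λ B → missing A B S) ⟩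
      Total (λ A → Exp q (λ S → Total λ B → missing A B S))
        ≤⟨ Total-bound (½ ↑ n) _ (λ A → ℚ.≤-trans (ℚ.≤-reflexive (Exp-Total q (missing A)))
             (Total-bound (½ ↑ n ℚ.* ½ ↑ n) _ (missing-tiny A))) ⟩
      ½ ↑ n ∎
      where open ℚ.≤-Reasoning

-- Passage to the reals

archimedean : ∀ {x} → 0ℚ ℚ.< x → ∃ λ M → 1ℚ ℚ.≤ ι M ℚ.* x
archimedean {x} 0<x = go x {{ℚ.positive 0<x}}
  where
  go : ∀ x → {{ℚ.Positive x}} → ∃ λ M → 1ℚ ℚ.≤ ι M ℚ.* x
  -- The denominator of `x` serves as `M`.
  go x@(ℚ.mkℚ (+ suc a) d _) = suc d , ℚ.toℚᵘ-cancel-≤ (ℚᵘ.≤-trans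
    (ℚᵘ.*≤* (ℤ.+≤+ bound′))
    (ℚᵘ.≤-reflexive (ℚᵘ.≃-sym (ℚᵘ.≃-trans (ℚ.toℚᵘ-homo-* (ι (suc d)) x)
      (ℚᵘ.*-congʳ {ℚ.toℚᵘ x} (ℚ.toℚᵘ-fromℚᵘ (ℚᵘ.mkℚᵘ (+ suc d) 0)))))))
    where
    bound′ : suc (d + 0 + 0) ≤ suc ((a + d * suc a) * 1)
    bound′ = s≤s (begin
      d + 0 + 0            ≡⟨ trans (ℕ.+-identityʳ (d + 0)) (ℕ.+-identityʳ d) ⟩
      d                    ≤⟨ ℕ.m≤m*n d (suc a) ⟩
      d * suc a            ≤⟨ ℕ.m≤n+m (d * suc a) a ⟩
      a + d * suc a        ≡⟨ ℕ.*-identityʳ _ ⟨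
      (a + d * suc a) * 1  ∎)
      where open ℕ.≤-Reasoning

0<1/ : ∀ n .{{_ : NonZero n}} → 0ℚ ℚ.< + 1 ℚ./ n
0<1/ n = ℚ.positive⁻¹ (+ 1 ℚ./ n) {{ℚ.normalize-pos 1 n}}

0<* : ∀ {x y} → 0ℚ ℚ.< x → 0ℚ ℚ.< y → 0ℚ ℚ.< x ℚ.* y
0<* {x} {y} 0<x 0<y = ℚ.positive⁻¹ (x ℚ.* y) {{ℚ.pos*pos⇒pos x {{ℚ.positive 0<x}} y {{ℚ.positive 0<y}}}}

-- From `1-↑-bernoulli` at one half: `½^n (1 + n/2) ≤ 1`, and `n/2` eventually exceeds `1 / τ`.
½-power-small : ∀ {τ} → 0ℚ ℚ.< τ → ∃ λ N → ∀ n → N ≤ n → ½ ↑ n ℚ.≤ τ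
½-power-small {τ} 0<τ = let M , h = archimedean 0<τ in M * 2 , λ n hn → begin
  ½ ↑ n                                      ≡⟨ ℚ.*-identityʳ (½ ↑ n) ⟨
  ½ ↑ n ℚ.* 1ℚ                               ≤⟨ mulˡ (0≤½↑ n) (ℚ.≤-trans h (mulʳ (ℚ.<⇒≤ 0<τ) (half M n hn))) ⟩
  ½ ↑ n ℚ.* ((1ℚ ℚ.+ ι n ℚ.* ½) ℚ.* τ)       ≡⟨ ℚ.*-assoc (½ ↑ n) _ τ ⟨
  ½ ↑ n ℚ.* (1ℚ ℚ.+ ι n ℚ.* ½) ℚ.* τ         ≤⟨ mulʳ (ℚ.<⇒≤ 0<τ) (1-↑-bernoulli {½} 0≤½ ½≤1 n) ⟩
  1ℚ ℚ.* τ                                   ≡⟨ ℚ.*-identityˡ τ ⟩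
  τ                                          ∎
  where
  open ℚ.≤-Reasoning
  0≤½ : 0ℚ ℚ.≤ ½
  0≤½ = ℚ.nonNegative⁻¹ ½
  ½≤1 : ½ ℚ.≤ 1ℚ
  ½≤1 = ℚ.*≤* (ℤ.+≤+ (s≤s z≤n))
  0≤½↑ : ∀ n → 0ℚ ℚ.≤ ½ ↑ n
  0≤½↑ = 0≤↑ 0≤½
  half : ∀ M n → M * 2 ≤ n → ι M ℚ.≤ 1ℚ ℚ.+ ι n ℚ.* ½
  half M n hn = begin
    ι M                    ≡⟨ ℚ.*-identityʳ (ι M) ⟨
    ι M ℚ.* (ι 2 ℚ.* ½)    ≡⟨ ℚ.*-assoc (ι M) (ι 2) ½ ⟨
    ι M ℚ.* ι 2 ℚ.* ½      ≡⟨ cong (ℚ._* ½) (ι-* M 2) ⟨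
    ι (M * 2) ℚ.* ½        ≤⟨ mulʳ 0≤½ (ι-mono hn) ⟩
    ι n ℚ.* ½              ≡⟨ ℚ.+-identityˡ _ ⟨
    0ℚ ℚ.+ ι n ℚ.* ½       ≤⟨ ℚ.+-monoˡ-≤ (ι n ℚ.* ½) 0≤1 ⟩
    1ℚ ℚ.+ ι n ℚ.* ½       ∎

∣∣-≤ : ∀ {x y} → x ℚ.≤ y → ℚ.- x ℚ.≤ y → ℚ.∣ x ∣ ℚ.≤ y
∣∣-≤ {x} {y} h h′ = [ (λ eq → subst (ℚ._≤ y) (sym eq) h) , (λ eq → subst (ℚ._≤ y) (sym eq) h′) ]′
                    (ℚ.∣p∣≡p∨∣p∣≡-p x)

x≤∣x∣ : ∀ x → x ℚ.≤ ℚ.∣ x ∣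
x≤∣x∣ x = [ (λ eq → ℚ.≤-reflexive (sym eq)) , (λ eq → nonpos eq (ℚ.≤-total 0ℚ x)) ]′ (ℚ.∣p∣≡p∨∣p∣≡-p x)
  where
  nonpos : ℚ.∣ x ∣ ≡ ℚ.- x → 0ℚ ℚ.≤ x ⊎ x ℚ.≤ 0ℚ → x ℚ.≤ ℚ.∣ x ∣
  nonpos _ (inj₁ 0≤x) = ℚ.≤-reflexive (sym (ℚ.0≤p⇒∣p∣≡p 0≤x))
  nonpos _ (inj₂ x≤0) = ℚ.≤-trans x≤0 (ℚ.0≤∣p∣ x)

-x≤∣x∣ : ∀ x → ℚ.- x ℚ.≤ ℚ.∣ x ∣
-x≤∣x∣ x = subst (ℚ.- x ℚ.≤_) (ℚ.∣-p∣≡∣p∣ x) (x≤∣x∣ (ℚ.- x))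

move-+ : ∀ {a b c} → a ℚ.≤ b ℚ.+ c → a ℚ.- b ℚ.≤ c
move-+ {a} {b} {c} h = subst (a ℚ.- b ℚ.≤_) (lem b c) (ℚ.+-monoˡ-≤ (ℚ.- b) h)
  where
  open +-*-Solver
  lem : ∀ b c → b ℚ.+ c ℚ.- b ≡ c
  lem = solve 2 (λ b c → b :+ c :- b := c) refl

move-- : ∀ {a b c} → a ℚ.- b ℚ.≤ c → a ℚ.≤ b ℚ.+ c
move-- {a} {b} {c} h = subst (ℚ._≤ b ℚ.+ c) (lem a b) (ℚ.+-monoʳ-≤ b h)
  where
  open +-*-Solver
  lem : ∀ a b → b ℚ.+ (a ℚ.- b) ≡ a
  lem = solve 2 (λ a b → b :+ (a :- b) := a) refl

neg-flip : ∀ {a b} → 0ℚ ℚ.≤ a ℚ.+ b → ℚ.- a ℚ.≤ b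
neg-flip {a} {b} h = subst (ℚ._≤ b) (ℚ.+-identityˡ (ℚ.- a)) (move-+ {0ℚ} {a} {b} h)

-- The rational approximations of a real number in [0,1] may lie slightly outside [0,1].
record Clamped (q θ : ℚ) : Set where
  field
    c      : ℚ
    0≤c    : 0ℚ ℚ.≤ c
    c≤1    : c ℚ.≤ 1ℚ
    near   : ℚ.∣ q ℚ.- c ∣ ℚ.≤ θ
    above  : ∀ {x} → x ℚ.≤ 1ℚ → x ℚ.≤ q → x ℚ.≤ c

clamp : ∀ q {θ} → 0ℚ ℚ.≤ θ → 0ℚ ℚ.≤ q ℚ.+ θ → q ℚ.≤ 1ℚ ℚ.+ θ → Clamped q θ
clamp q {θ} 0≤θ low high with ℚ.≤-total 0ℚ q | ℚ.≤-total q 1ℚ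
... | inj₂ q≤0 | _ = record
  { c = 0ℚ ; 0≤c = ℚ.≤-refl ; c≤1 = 0≤1
  ; near = ∣∣-≤ (ℚ.≤-trans (ℚ.≤-reflexive (ℚ.+-identityʳ q)) (ℚ.≤-trans q≤0 0≤θ))
                (ℚ.≤-trans (ℚ.≤-reflexive (cong ℚ.-_ (ℚ.+-identityʳ q))) (neg-flip {q} {θ} low))
  ; above = λ _ x≤q → ℚ.≤-trans x≤q q≤0 }
... | inj₁ 0≤q | inj₁ q≤1 = record
  { c = q ; 0≤c = 0≤q ; c≤1 = q≤1
  ; near = ℚ.≤-trans (ℚ.≤-reflexive (cong ℚ.∣_∣ (ℚ.+-inverseʳ q))) 0≤θ
  ; above = λ _ x≤q → x≤q }
... | inj₁ _ | inj₂ 1≤q = record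
  { c = 1ℚ ; 0≤c = 0≤1 ; c≤1 = ℚ.≤-refl
  ; near = ℚ.≤-trans (ℚ.≤-reflexive (ℚ.0≤p⇒∣p∣≡p (0≤-diff 1≤q))) (move-+ {q} {1ℚ} {θ} high)
  ; above = λ x≤1 _ → x≤1 }

module _ (D : ℕ) (D≥1 : 1 ≤ D) {n : ℕ} (n-large : 24 * (D * D) ≤ n) .{{_ : NonZero n}}
         {τ : ℚ} (0<τ : 0ℚ ℚ.< τ) (power-small : ½ ↑ n ℚ.≤ τ) where
  open Holes D {n}

  private
    x : ℚ
    x = ι (24 * (D * D)) ℚ.* (+ 1 ℚ./ n)

    x*n : x ℚ.* ι n ≡ ι (24 * (D * D))
    x*n = trans (ℚ.*-assoc (ι (24 * (D * D))) (+ 1 ℚ./ n) (ι n))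
      (trans (cong (ι (24 * (D * D)) ℚ.*_) (trans (ℚ.*-comm (+ 1 ℚ./ n) (ι n)) (ι-*-1/ n))) (ℚ.*-identityʳ _))

    x≤1 : x ℚ.≤ 1ℚ
    x≤1 = ℚ.≤-trans (mulʳ (ℚ.<⇒≤ (0<1/ n)) (ι-mono n-large)) (ℚ.≤-reflexive (ι-*-1/ n))

    K : ℚ
    K = lip (#pairs n)

    0<K : 0ℚ ℚ.< K
    0<K = ℚ.<-≤-trans (ℚ.positive⁻¹ 1ℚ) (lip-≥1 (#pairs n))

    K-positive : ℚ.Positive K
    K-positive = ℚ.positive 0<K

    K⁻¹ : ℚ
    K⁻¹ = (ℚ.1/ K) {{ℚ.pos⇒nonZero K {{K-positive}}}}

    K*K⁻¹ : K ℚ.* (K⁻¹ ℚ.* τ) ≡ τ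
    K*K⁻¹ = trans (sym (ℚ.*-assoc K K⁻¹ τ))
      (trans (cong (ℚ._* τ) (ℚ.*-inverseʳ K {{ℚ.pos⇒nonZero K {{K-positive}}}})) (ℚ.*-identityˡ τ))

  -- The minimum of 1 and `τ / K`; being at most 1, it keeps `q` and `1 - q` within the range that
  -- `Exp-lipschitz` asks for.
  tolerance : ∃ λ θ → 0ℚ ℚ.< θ × θ ℚ.≤ 1ℚ × lip (#pairs n) ℚ.* θ ℚ.≤ τ
  tolerance with ℚ.≤-total 1ℚ (K⁻¹ ℚ.* τ)
  ... | inj₁ 1≤ = 1ℚ , ℚ.positive⁻¹ 1ℚ , ℚ.≤-refl , ℚ.≤-trans (mulˡ (ℚ.<⇒≤ 0<K) 1≤) (ℚ.≤-reflexive K*K⁻¹)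
  ... | inj₂ ≤1 = K⁻¹ ℚ.* τ , 0<* (ℚ.positive⁻¹ K⁻¹ {{ℚ.1/pos⇒pos K {{K-positive}}}}) 0<τ , ≤1 , ℚ.≤-reflexive K*K⁻¹

  module _ {q θ : ℚ} (0<θ : 0ℚ ℚ.< θ) (θ≤1 : θ ℚ.≤ 1ℚ) (Kθ≤τ : lip (#pairs n) ℚ.* θ ℚ.≤ τ)
           (low : 0ℚ ℚ.≤ q ℚ.+ θ) (high : q ℚ.≤ 1ℚ ℚ.+ θ)
           (dense : ι (48 * (D * D)) ℚ.* (+ 1 ℚ./ n) ℚ.≤ q ℚ.+ ι (24 * (D * D)) ℚ.* (+ 1 ℚ./ n)) where
    private
      open Clamped (clamp q (ℚ.<⇒≤ 0<θ) low high)

      x+x : ι (48 * (D * D)) ℚ.* (+ 1 ℚ./ n) ≡ x ℚ.+ x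
      x+x = trans (cong (ℚ._* (+ 1 ℚ./ n)) (trans (cong ι (ℕ.*-distribʳ-+ (D * D) 24 24)) (ι-+ (24 * (D * D)) (24 * (D * D)))))
                  (ℚ.*-distribʳ-+ (+ 1 ℚ./ n) (ι (24 * (D * D))) (ι (24 * (D * D))))

      x≤q : x ℚ.≤ q
      x≤q = subst (ℚ._≤ q) (lem x) (move-+ {x ℚ.+ x} {x} {q} (subst (ℚ._≤ x ℚ.+ q) x+x
              (ℚ.≤-trans dense (ℚ.≤-reflexive (ℚ.+-comm q x)))))
        where
        open +-*-Solver
        lem : ∀ x → x ℚ.+ x ℚ.- x ≡ x
        lem = solve 1 (λ x → x :+ x :- x := x) refl

      hole : ℚ → ℚ
      hole q = Exp q (λ S → indicator (does (hole? S)))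

      hole-c : hole c ℚ.≤ τ
      hole-c = ℚ.≤-trans (hole-unlikely D≥1 (ℕ.≤-trans (ℕ.*-monoˡ-≤ (D * D) {12} {24} (ℕ.m≤m+n 12 12)) n-large) 0≤c c≤1
        (ℚ.≤-trans (ℚ.≤-reflexive (sym x*n)) (mulʳ (0≤ι n) (above x≤1 x≤q)))) power-small

      indicator-0≤ : ∀ b → 0ℚ ℚ.≤ indicator b
      indicator-0≤ true  = 0≤1
      indicator-0≤ false = ℚ.≤-refl

      indicator-≤1 : ∀ b → indicator b ℚ.≤ 1ℚ
      indicator-≤1 true  = ℚ.≤-refl
      indicator-≤1 false = 0≤1

      ∣q∣≤2 : ℚ.∣ q ∣ ℚ.≤ 2ℚ
      ∣q∣≤2 = ∣∣-≤ (ℚ.≤-trans high (ℚ.+-monoʳ-≤ 1ℚ θ≤1))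
        (ℚ.≤-trans (neg-flip {q} {θ} low) (ℚ.≤-trans θ≤1 (ℚ.+-monoʳ-≤ 1ℚ 0≤1)))

      ∣1-q∣≤2 : ℚ.∣ 1ℚ ℚ.- q ∣ ℚ.≤ 2ℚ
      ∣1-q∣≤2 = ∣∣-≤ (ℚ.+-monoʳ-≤ 1ℚ (ℚ.≤-trans (neg-flip {q} {θ} low) θ≤1))
        (ℚ.≤-trans (ℚ.≤-reflexive (lem q)) (ℚ.≤-trans (move-+ {q} {1ℚ} {θ} high) (ℚ.≤-trans θ≤1 (ℚ.+-monoʳ-≤ 1ℚ 0≤1))))
        where
        open +-*-Solver
        lem : ∀ q → ℚ.- (1ℚ ℚ.- q) ≡ q ℚ.- 1ℚ
        lem = solve 1 (λ q → :- (con 1ℚ :- q) := q :- con 1ℚ) refl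

      hole-near : ℚ.∣ hole q ℚ.- hole c ∣ ℚ.≤ τ
      hole-near = ℚ.≤-trans (Exp-lipschitz ∣q∣≤2 ∣1-q∣≤2 0≤c c≤1 (λ S → indicator (does (hole? S)))
          (λ S → indicator-0≤ (does (hole? S))) (λ S → indicator-≤1 (does (hole? S))))
        (ℚ.≤-trans (mulˡ (ℚ.<⇒≤ 0<K) near) Kθ≤τ)

    hole-small : Exp q (λ S → indicator (does (hole? S))) ℚ.≤ τ ℚ.+ τ
    hole-small = ℚ.≤-trans (move-- {hole q} {hole c} {τ} (ℚ.≤-trans (x≤∣x∣ (hole q ℚ.- hole c)) hole-near))
                           (ℚ.+-monoˡ-≤ τ hole-c)

    -- For `q` outside [0,1] the polynomial may drop below 0. The upper half of the limit needs a
    -- bound on how far.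
    hole-not-negative : ℚ.- Exp q (λ S → indicator (does (hole? S))) ℚ.≤ τ
    hole-not-negative = begin
      ℚ.- hole q                        ≡⟨ lem (hole q) (hole c) ⟩
      ℚ.- (hole q ℚ.- hole c) ℚ.- hole c ≤⟨ ℚ.+-mono-≤ (ℚ.≤-trans (-x≤∣x∣ (hole q ℚ.- hole c)) hole-near)
                                             (ℚ.neg-antimono-≤ (Exp-0≤ 0≤c c≤1 (λ S → indicator-0≤ (does (hole? S))))) ⟩
      τ ℚ.+ 0ℚ                          ≡⟨ ℚ.+-identityʳ τ ⟩
      τ                                 ∎
      where
      open ℚ.≤-Reasoning
      open +-*-Solver
      lem : ∀ a b → ℚ.- a ≡ ℚ.- (a ℚ.- b) ℚ.- b
      lem = solve 2 (λ a b → :- a := :- (a :- b) :- b) refl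

-- The constant 48 is twice the 24 of `hole-unlikely`: half of `48D² / n` absorbs the error when
-- approximations of `p n` are compared with it.
noHole-likely : ∀ D → 1 ≤ D → (p : ℕ → ℝ) → (∀ n → 0ℝ ≤ℝ p n × p n ≤ℝ 1ℝ) →
  (∃ λ n₀ → ∀ n → .{{_ : NonZero n}} → n₀ ≤ n → fromℕ (48 * (D * D)) /ℝ n ≤ℝ p n) →
  (λ n → Pr n (p n) (Holes.noHole D)) ⟶ 1ℝ
noHole-likely D D≥1 p p∈ (n₀ , p-large) δ (δ₁ , 0<δ₁ , Nδ , δ≥δ₁) =
  1 ℕ.⊔ n₀ ℕ.⊔ (24 * (D * D) ℕ.⊔ N₁) , λ n hn →
    let a≤ = ℕ.m⊔n≤o⇒m≤o (1 ℕ.⊔ n₀) (24 * (D * D) ℕ.⊔ N₁) hn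
        b≤ = ℕ.m⊔n≤o⇒n≤o (1 ℕ.⊔ n₀) (24 * (D * D) ℕ.⊔ N₁) hn
    in conclude n {{>-nonZero (ℕ.m⊔n≤o⇒m≤o 1 n₀ a≤)}} (ℕ.m⊔n≤o⇒n≤o 1 n₀ a≤)
         (ℕ.m⊔n≤o⇒m≤o (24 * (D * D)) N₁ b≤) (ℕ.m⊔n≤o⇒n≤o (24 * (D * D)) N₁ b≤)
  where
  τ : ℚ
  -- Up to two parts go to the probability of a hole, the third is the positive gap that `<ℝ`
  -- demands.
  τ = (+ 1 ℚ./ 3) ℚ.* δ₁
  0<τ : 0ℚ ℚ.< τ
  0<τ = 0<* (0<1/ 3) 0<δ₁
  3τ : τ ℚ.+ τ ℚ.+ τ ≡ δ₁
  3τ = solve 1 (λ d → con (+ 1 ℚ./ 3) :* d :+ con (+ 1 ℚ./ 3) :* d :+ con (+ 1 ℚ./ 3) :* d := d) refl δ₁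
    where open +-*-Solver
  N₁ : ℕ
  N₁ = proj₁ (½-power-small 0<τ)
  hole : ∀ n → ℚ → ℚ
  hole n q = Exp q {#pairs n} (λ S → indicator (does (Holes.hole? D {n} S)))
  seq-noHole : ∀ n k → ℝ.seq (Pr n (p n) (Holes.noHole D)) k ≡ 1ℚ ℚ.- hole n (ℝ.seq (p n) k)
  seq-noHole n k = trans (seq-Pr n (p n) (Holes.noHole D {n}) k)
    (flip-sides (hole n q) (Exp q {#pairs n} (λ S → indicator (not (does (Holes.hole? D {n} S)))))
      (Exp-not q {#pairs n} (λ S → does (Holes.hole? D {n} S))))
    where
    open +-*-Solver
    q : ℚ
    q = ℝ.seq (p n) k
    flip-sides : ∀ a b → a ≡ 1ℚ ℚ.- b → b ≡ 1ℚ ℚ.- a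
    flip-sides a b eq = trans (solve 1 (λ b → b := con 1ℚ :- (con 1ℚ :- b)) refl b) (cong (λ z → 1ℚ ℚ.- z) (sym eq))
  conclude : ∀ n → .{{_ : NonZero n}} → n₀ ≤ n → 24 * (D * D) ≤ n → N₁ ≤ n →
             (1ℝ -ℝ δ <ℝ Pr n (p n) (Holes.noHole D)) × (Pr n (p n) (Holes.noHole D) <ℝ 1ℝ +ℝ δ)
  conclude n n≥n₀ n-large n≥N₁ = (τ , 0<τ , k₀ , lower) , (τ , 0<τ , k₀ , upper)
    where
    ps = proj₂ (½-power-small 0<τ) n n≥N₁
    tol = tolerance D D≥1 n-large 0<τ ps
    θ = proj₁ tol
    0<θ = proj₁ (proj₂ tol)
    y : ℚ
    y = ι (24 * (D * D)) ℚ.* (+ 1 ℚ./ n)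
    0<y : 0ℚ ℚ.< y
    0<y = 0<* (ℚ.positive⁻¹ (ι (24 * (D * D))) {{ℚ.normalize-pos (24 * (D * D)) 1 {{_}}
      {{>-nonZero (ℕ.*-mono-≤ {1} {24} (s≤s z≤n) (ℕ.*-mono-≤ D≥1 D≥1))}}}}) (0<1/ n)
    low = proj₁ (p∈ n) θ 0<θ
    high = proj₂ (p∈ n) θ 0<θ
    dense = p-large n n≥n₀ y 0<y
    k₁ k₂ k₀ : ℕ
    k₁ = Nδ ℕ.⊔ proj₁ low
    k₂ = proj₁ high ℕ.⊔ proj₁ dense
    k₀ = k₁ ℕ.⊔ k₂
    module _ (k : ℕ) (hk : k₀ ≤ k) where
      q e : ℚ
      q = ℝ.seq (p n) k
      e = hole n q
      hk₁ = ℕ.m⊔n≤o⇒m≤o k₁ k₂ hk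
      hk₂ = ℕ.m⊔n≤o⇒n≤o k₁ k₂ hk
      δ≥ : δ₁ ℚ.≤ ℝ.seq δ k
      δ≥ = subst (ℚ._≤ ℝ.seq δ k) (ℚ.+-identityˡ δ₁) (δ≥δ₁ k (ℕ.m⊔n≤o⇒m≤o Nδ (proj₁ low) hk₁))
      lowₖ = proj₂ low k (ℕ.m⊔n≤o⇒n≤o Nδ (proj₁ low) hk₁)
      highₖ = proj₂ high k (ℕ.m⊔n≤o⇒m≤o (proj₁ high) (proj₁ dense) hk₂)
      denseₖ = proj₂ dense k (ℕ.m⊔n≤o⇒n≤o (proj₁ high) (proj₁ dense) hk₂)
      e≤ : e ℚ.≤ τ ℚ.+ τ
      e≤ = hole-small D D≥1 n-large 0<τ ps 0<θ (proj₁ (proj₂ (proj₂ tol))) (proj₂ (proj₂ (proj₂ tol))) lowₖ highₖ denseₖ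
      -e≤ : ℚ.- e ℚ.≤ τ
      -e≤ = hole-not-negative D D≥1 n-large 0<τ ps 0<θ (proj₁ (proj₂ (proj₂ tol))) (proj₂ (proj₂ (proj₂ tol))) lowₖ highₖ denseₖ
      open ℚ.≤-Reasoning
      open +-*-Solver
      lower : (1ℚ ℚ.- ℝ.seq δ k) ℚ.+ τ ℚ.≤ ℝ.seq (Pr n (p n) (Holes.noHole D)) k
      lower = begin
        (1ℚ ℚ.- ℝ.seq δ k) ℚ.+ τ            ≤⟨ ℚ.+-monoˡ-≤ τ (ℚ.+-monoʳ-≤ 1ℚ (ℚ.neg-antimono-≤ δ≥)) ⟩
        (1ℚ ℚ.- δ₁) ℚ.+ τ                   ≡⟨ cong (λ z → (1ℚ ℚ.- z) ℚ.+ τ) 3τ ⟨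
        (1ℚ ℚ.- (τ ℚ.+ τ ℚ.+ τ)) ℚ.+ τ      ≡⟨ solve 1 (λ t → (con 1ℚ :- (t :+ t :+ t)) :+ t := con 1ℚ :- (t :+ t)) refl τ ⟩
        1ℚ ℚ.- (τ ℚ.+ τ)                    ≤⟨ ℚ.+-monoʳ-≤ 1ℚ (ℚ.neg-antimono-≤ e≤) ⟩
        1ℚ ℚ.- e                            ≡⟨ seq-noHole n k ⟨
        ℝ.seq (Pr n (p n) (Holes.noHole D)) k ∎
      upper : ℝ.seq (Pr n (p n) (Holes.noHole D)) k ℚ.+ τ ℚ.≤ 1ℚ ℚ.+ ℝ.seq δ k
      upper = begin
        ℝ.seq (Pr n (p n) (Holes.noHole D)) k ℚ.+ τ ≡⟨ cong (ℚ._+ τ) (seq-noHole n k) ⟩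
        (1ℚ ℚ.- e) ℚ.+ τ                    ≤⟨ ℚ.+-monoˡ-≤ τ (ℚ.+-monoʳ-≤ 1ℚ -e≤) ⟩
        (1ℚ ℚ.+ τ) ℚ.+ τ                    ≡⟨ ℚ.+-identityʳ _ ⟨
        (1ℚ ℚ.+ τ) ℚ.+ τ ℚ.+ 0ℚ             ≤⟨ ℚ.+-monoʳ-≤ ((1ℚ ℚ.+ τ) ℚ.+ τ) (ℚ.<⇒≤ 0<τ) ⟩
        (1ℚ ℚ.+ τ) ℚ.+ τ ℚ.+ τ              ≡⟨ solve 1 (λ t → (con 1ℚ :+ t) :+ t :+ t := con 1ℚ :+ (t :+ t :+ t)) refl τ ⟩
        1ℚ ℚ.+ (τ ℚ.+ τ ℚ.+ τ)              ≡⟨ cong (1ℚ ℚ.+_) 3τ ⟩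
        1ℚ ℚ.+ δ₁                           ≤⟨ ℚ.+-monoʳ-≤ 1ℚ δ≥ ⟩
        1ℚ ℚ.+ ℝ.seq δ k ∎

-- From fractions to the real bound, and the theorem

-- With `d = M + 2`, the Archimedean bound gives `1 / d ≤ e`, hence `1 - e ≤ (d - 1) / d`. Adding 2
-- to `M` ensures the `d ≥ 2` of the deterministic part.
scaled-≤ : ∀ M {δ₀ e} → 0ℚ ℚ.≤ δ₀ → 1ℚ ℚ.≤ ι M ℚ.* δ₀ → δ₀ ℚ.≤ e →
           ∀ n x → suc M * n ≤ suc (suc M) * x → (1ℚ ℚ.- e) ℚ.* ι n ℚ.≤ ι x
scaled-≤ M {δ₀} {e} 0≤δ₀ hM δ₀≤e n x h = ℚ.*-cancelˡ-≤-pos (ι d) {{ℚ.normalize-pos d 1}} (begin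
  ι d ℚ.* ((1ℚ ℚ.- e) ℚ.* ι n)    ≡⟨ solve 3 (λ d e n → d :* ((con 1ℚ :- e) :* n) := (d :- d :* e) :* n) refl (ι d) e (ι n) ⟩
  (ι d ℚ.- ι d ℚ.* e) ℚ.* ι n     ≤⟨ mulʳ (0≤ι n) (ℚ.+-monoʳ-≤ (ι d) (ℚ.neg-antimono-≤ 1≤de)) ⟩
  (ι d ℚ.- 1ℚ) ℚ.* ι n            ≡⟨ cong (λ z → (z ℚ.- 1ℚ) ℚ.* ι n) (ι-suc (suc M)) ⟩
  (1ℚ ℚ.+ ι (suc M) ℚ.- 1ℚ) ℚ.* ι n
    ≡⟨ solve 2 (λ m n → (con 1ℚ :+ m :- con 1ℚ) :* n := m :* n) refl (ι (suc M)) (ι n) ⟩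
  ι (suc M) ℚ.* ι n               ≡⟨ ι-* (suc M) n ⟨
  ι (suc M * n)                   ≤⟨ ι-mono h ⟩
  ι (d * x)                       ≡⟨ ι-* d x ⟩
  ι d ℚ.* ι x                     ∎)
  where
  open ℚ.≤-Reasoning
  open +-*-Solver
  d : ℕ
  d = suc (suc M)
  1≤de : 1ℚ ℚ.≤ ι d ℚ.* e
  1≤de = ℚ.≤-trans hM (ℚ.≤-trans (mulʳ 0≤δ₀ (ι-mono (ℕ.m≤n⇒m≤1+n (ℕ.n≤1+n M)))) (mulˡ (0≤ι d) δ₀≤e))

ε-bound : ∀ ε → 0ℝ <ℝ ε → ∃ λ M → (∀ n x → suc M * n ≤ suc (suc M) * x → (1ℝ -ℝ ε) *ℝ fromℕ n ≤ℝ fromℕ x) ×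
  (∀ n s x → .{{_ : NonZero s}} → suc M * n ≤ suc (suc M) * (s * x) → ((1ℝ -ℝ ε) *ℝ fromℕ n) /ℝ s ≤ℝ fromℕ x)
ε-bound ε (δ₀ , 0<δ₀ , N , h) = M ,
  (λ n x hx δ 0<δ → N , λ k hk → ℚ.≤-trans (approx k hk n x hx) (slack 0<δ)) ,
  λ n s x hx δ 0<δ → N , λ k hk → ℚ.≤-trans
    (ℚ.≤-trans (mulʳ (ℚ.<⇒≤ (0<1/ s)) (approx k hk n (s * x) hx)) (ℚ.≤-reflexive (cancel s x))) (slack 0<δ)
  where
  M : ℕ
  M = proj₁ (archimedean 0<δ₀)
  approx : ∀ k → N ≤ k → ∀ n x → suc M * n ≤ suc (suc M) * x → (1ℚ ℚ.- ℝ.seq ε k) ℚ.* ι n ℚ.≤ ι x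
  approx k hk = scaled-≤ M (ℚ.<⇒≤ 0<δ₀) (proj₂ (archimedean 0<δ₀))
                  (subst (ℚ._≤ ℝ.seq ε k) (ℚ.+-identityˡ δ₀) (h k hk))
  slack : ∀ {a δ} → 0ℚ ℚ.< δ → a ℚ.≤ a ℚ.+ δ
  slack {a} 0<δ = ℚ.≤-trans (ℚ.≤-reflexive (sym (ℚ.+-identityʳ a))) (ℚ.+-monoʳ-≤ a (ℚ.<⇒≤ 0<δ))
  cancel : ∀ s x .{{_ : NonZero s}} → ι (s * x) ℚ.* (+ 1 ℚ./ s) ≡ ι x
  cancel s x = trans (cong (ℚ._* (+ 1 ℚ./ s)) (trans (ι-* s x) (ℚ.*-comm (ι s) (ι x))))
    (trans (ℚ.*-assoc (ι x) (ι s) (+ 1 ℚ./ s)) (trans (cong (ι x ℚ.*_) (ι-*-1/ s)) (ℚ.*-identityʳ (ι x))))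

-- The event is declared false for small n, where the deterministic argument does not apply.
eventually-aas : ∀ N D → 1 ≤ D → (p : ℕ → ℝ) → (∀ n → 0ℝ ≤ℝ p n × p n ≤ℝ 1ℝ) →
  (∃ λ n₀ → ∀ n → .{{_ : NonZero n}} → n₀ ≤ n → fromℕ (48 * (D * D)) /ℝ n ≤ℝ p n) →
  (A : ∀ n → Graph n → Set) → (∀ n G → N ≤ n → NoHole D (EdgeBetween G) → A n G) → Aas p A
eventually-aas N D D≥1 p p∈ p-large A h = B , sound , limit
  where
  event : Bool → ∀ n → Graph n → Bool
  event b n G = if b then Holes.noHole D G else false
  B : ∀ n → Graph n → Bool
  B n = event (does (N ℕ.≤? n)) n
  sound : ∀ n G → Bool.T (B n G) → A n G
  sound n G = go (N ℕ.≤? n)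
    where
    go : (d : Dec (N ≤ n)) → Bool.T (event (does d) n G) → A n G
    go (yes N≤n) t = h n G N≤n (Holes.noHole-sound D G t)
  limit : (λ n → Pr n (p n) (B n)) ⟶ 1ℝ
  limit δ 0<δ =
    let N′ , close = noHole-likely D D≥1 p p∈ p-large δ 0<δ
    in N ℕ.⊔ N′ , λ n hn → subst (λ b → (1ℝ -ℝ δ <ℝ Pr n (p n) (event b n)) × (Pr n (p n) (event b n) <ℝ 1ℝ +ℝ δ))
         (sym (dec-true (N ℕ.≤? n) (ℕ.m⊔n≤o⇒m≤o N N′ hn))) (close n (ℕ.m⊔n≤o⇒n≤o N N′ hn))

LargeTreesAas : ℕ → ℝ → Set
LargeTreesAas s′ ε = Σ ℝ λ C → (p : ℕ → ℝ) → (∀ n → 0ℝ ≤ℝ p n × p n ≤ℝ 1ℝ) →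
  (∃ λ n₀ → ∀ n → .{{_ : NonZero n}} → n₀ ≤ n → C /ℝ n ≤ℝ p n) →
  Aas p (λ n G → (c : Coloring (suc (suc s′)) G) →
    MonoTreeOfOrder≥ G c ((1ℝ -ℝ ε) *ℝ fromℕ n)
    ⊎ MonoTreeWithLeaves≥ G c (((1ℝ -ℝ ε) *ℝ fromℕ n) /ℝ suc s′))
  × Aas p (λ n G → TmAtLeast (suc (suc s′)) G (((1ℝ -ℝ ε) *ℝ fromℕ n) /ℝ suc s′))

density≥1 : ∀ s d₁ → 1 ≤ density s d₁
density≥1 s d₁ = ℕ.*-mono-≤ (ℕ.m^n>0 2 (length (tests s (labelBound s d₁)))) (ℕ.*-mono-≤ {1} {2} {1} {suc d₁} (s≤s z≤n) (s≤s z≤n))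

largeTreesAas : ∀ s′ ε → 0ℝ <ℝ ε → LargeTreesAas s′ ε
largeTreesAas s′ ε 0<ε = assemble (density s (suc M)) (scale s (suc M)) (density≥1 s (suc M))
  λ n G → largeMonoTree G M (s≤s z≤n)
  where
  s M : ℕ
  s = suc s′
  M = proj₁ (ε-bound ε 0<ε)
  assemble : ∀ D N → 1 ≤ D → (∀ n (G : Graph n) → N ≤ n → NoHole D (EdgeBetween G) → ∀ c → LargeMonoTree {n} {s} G (suc M) c) →
             LargeTreesAas s′ ε
  assemble D N D≥1 trees = fromℕ (48 * (D * D)) , λ p p∈ p-large →
    eventually-aas N D D≥1 p p∈ p-large _ (λ n G n≥N hole c → convert n G c (trees n G n≥N hole c)) ,
    eventually-aas N D D≥1 p p∈ p-large _ (λ n G n≥N hole →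
      let t , tm , large = tm-large {n} {s} G (suc M) (s≤s z≤n) (trees n G n≥N hole)
      in t , tm , proj₂ bounds n s t large)
    where
    bounds = proj₂ (ε-bound ε 0<ε)
    convert : ∀ n (G : Graph n) c → LargeMonoTree {n} {s} G (suc M) c →
      MonoTreeOfOrder≥ G c ((1ℝ -ℝ ε) *ℝ fromℕ n) ⊎ MonoTreeWithLeaves≥ G c (((1ℝ -ℝ ε) *ℝ fromℕ n) /ℝ s)
    convert n G c (H , tree , mono , inj₁ h) = inj₁ (H , tree , mono , proj₁ bounds n (order H) h)
    convert n G c (H , tree , mono , inj₂ h) = inj₂ (H , tree , mono , proj₂ bounds n s (#leaves H) h)

theorem1p8 : (r : ℕ) → .{{_ : NonTrivial r}} →
    Σ ℝ λ ε₀ → 0ℝ <ℝ ε₀ ×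
    ((ε : ℝ) → 0ℝ <ℝ ε → ε ≤ℝ ε₀ →
    Σ ℝ λ C →
    (p : ℕ → ℝ) →
    (∀ n → 0ℝ ≤ℝ p n × p n ≤ℝ 1ℝ) →
    (∃ λ n₀ → ∀ n → .{{_ : NonZero n}} → n₀ ≤ n → C /ℝ n ≤ℝ p n) →
    Aas p (λ n G → (c : Coloring r G) →
    MonoTreeOfOrder≥ G c ((1ℝ -ℝ ε) *ℝ fromℕ n)
    ⊎ MonoTreeWithLeaves≥ G c (((1ℝ -ℝ ε) *ℝ fromℕ n) /ℝ (r ∸ 1)))
    × Aas p (λ n G → TmAtLeast r G (((1ℝ -ℝ ε) *ℝ fromℕ n) /ℝ (r ∸ 1))))
theorem1p8 zero {{()}}
theorem1p8 (suc zero) {{()}}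
theorem1p8 (suc (suc s′)) = 1ℝ , (1ℚ , ℚ.positive⁻¹ 1ℚ , 0 , λ _ _ → ℚ.≤-reflexive (ℚ.+-identityˡ 1ℚ)) ,
  λ ε 0<ε _ → largeTreesAas s′ ε 0<ε
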